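{- For $k\in\mathbb{N}_0$ let \[ \alpha_q(k)=q^{2k}[8k+1]\frac{(q;q^4)_k^2\,(xq;q^4)_k\,(q/x;q^4)_k}{(q^4;q^4)_k^2\,(xq^4;q^4)_k\,(q^4/x;q^4)_k}, \] \[ s_q(k)=\sum_{j=0}^k\alpha_q(j)\alpha_q(k-j),\qquad t_q(k)=\sum_{j=0}^k\sum_{i=0}^{k-j}\alpha_q(j)\alpha_q(i)\alpha_q(k-j-i), \] \[ u_q(k)=\sum_{j=0}^k\sum_{i=0}^{k-j}\sum_{h=0}^{k-j-i}\alpha_q(j)\alpha_q(i)\alpha_q(h)\alpha_q(k-j-i-h). \] Then for every positive integer $n$ all of whose prime factors are congruent to $1$ modulo $4$, modulo $[n](1-xq^n)(x-q^n)$ we have \[ \sum_{k=0}^{n-1}s_q(k)\equiv[n]^2\frac{(q^2;q^4)_{(n-1)/4}^2}{(q^4;q^4)_{(n-1)/4}^2}q^{(1-n)/2},\qquad \sum_{k=0}^{n-1}t_q(k)\equiv[n]^3\frac{(q^2;q^4)_{(n-1)/4}^3}{(q^4;q^4)_{(n-1)/4}^3}q^{3(1-n)/4}, \] \[ \sum_{k=0}^{n-1}u_q(k)\equiv[n]^4\frac{(q^2;q^4)_{(n-1)/4}^4}{(q^4;q^4)_{(n-1)/4}^4}q^{1-n}. \]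
   Context: $x$ is an indeterminate and $q$ a variable. $(a;q)_0=1$, $(a;q)_k=\prod_{j=0}^{k-1}(1-aq^j)$; $[n]=[n]_q=(1-q^n)/(1-q)$. For rational functions $A,B$ and a polynomial $P$, $A\equiv B\pmod P$ means that, writing $A-B=A_1/A_2$ in lowest terms, $P$ divides $A_1$ and $\gcd(P,A_2)=1$. -}

module Defs where

open import Data.Nat as ℕ using (ℕ; zero; suc)
open import Data.Rational as ℚ using (ℚ; 0ℚ; 1ℚ)
open import Data.List using (List; []; _∷_; map)
open import Data.Product using (Σ; _×_; _,_; ∃)
open import Relation.Binary.PropositionalEquality using (_≡_)
open import Relation.Nullary using (¬_)

-- Polynomials in x over ℚ : coefficient lists (constant term first)

P₁ : Set
P₁ = List ℚ

_+₁_ : P₁ → P₁ → P₁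
[] +₁ r = r
(a ∷ p) +₁ [] = a ∷ p
(a ∷ p) +₁ (b ∷ r) = (a ℚ.+ b) ∷ (p +₁ r)

_*₁_ : P₁ → P₁ → P₁
[] *₁ r = []
(a ∷ p) *₁ r = map (a ℚ.*_) r +₁ (0ℚ ∷ (p *₁ r))

coeff₁ : P₁ → ℕ → ℚ
coeff₁ [] _ = 0ℚ
coeff₁ (a ∷ p) zero = a
coeff₁ (a ∷ p) (suc j) = coeff₁ p j

-- Polynomials in x and q over ℚ, i.e. ℚ[x,q]:
-- list of coefficients of q^0, q^1, ... each being a polynomial in x.

Poly : Set
Poly = List P₁

infixl 6 _+ᴾ_ _-ᴾ_
infixl 7 _*ᴾ_

_+ᴾ_ : Poly → Poly → Poly
[] +ᴾ r = r
(a ∷ p) +ᴾ [] = a ∷ p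
(a ∷ p) +ᴾ (b ∷ r) = (a +₁ b) ∷ (p +ᴾ r)

_*ᴾ_ : Poly → Poly → Poly
[] *ᴾ r = []
(a ∷ p) *ᴾ r = map (a *₁_) r +ᴾ ([] ∷ (p *ᴾ r))

-ᴾ_ : Poly → Poly
-ᴾ p = map (map (λ a → ℚ.- a)) p

_-ᴾ_ : Poly → Poly → Poly
p -ᴾ r = p +ᴾ (-ᴾ r)

0ᴾ 1ᴾ xᴾ qᴾ : Poly
0ᴾ = []
1ᴾ = (1ℚ ∷ []) ∷ []
xᴾ = (0ℚ ∷ 1ℚ ∷ []) ∷ []
qᴾ = [] ∷ (1ℚ ∷ []) ∷ []

_^ᴾ_ : Poly → ℕ → Poly
p ^ᴾ zero = 1ᴾ
p ^ᴾ suc n = p *ᴾ (p ^ᴾ n)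

coeff : Poly → ℕ → ℕ → ℚ
coeff [] _ _ = 0ℚ
coeff (a ∷ p) zero j = coeff₁ a j
coeff (a ∷ p) (suc i) j = coeff p i j

infix 4 _≈ᴾ_
_≈ᴾ_ : Poly → Poly → Set
p ≈ᴾ r = ∀ i j → coeff p i j ≡ coeff r i j

infix 4 _∣ᴾ_
_∣ᴾ_ : Poly → Poly → Set
d ∣ᴾ p = Σ Poly λ c → d *ᴾ c ≈ᴾ p

IsUnit : Poly → Set
IsUnit u = u ∣ᴾ 1ᴾ

Coprime : Poly → Poly → Set
Coprime p r = ∀ d → d ∣ᴾ p → d ∣ᴾ r → IsUnit d

Frac : Set
Frac = Poly × Poly

num den : Frac → Poly
num (a , b) = a
den (a , b) = b

infixl 6 _+ᶠ_ _-ᶠ_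
infixl 7 _*ᶠ_ _/ᶠ_

poly : Poly → Frac
poly p = p , 1ᴾ

_+ᶠ_ : Frac → Frac → Frac
(a , b) +ᶠ (c , d) = (a *ᴾ d +ᴾ c *ᴾ b) , (b *ᴾ d)

_-ᶠ_ : Frac → Frac → Frac
(a , b) -ᶠ (c , d) = (a *ᴾ d -ᴾ c *ᴾ b) , (b *ᴾ d)

_*ᶠ_ : Frac → Frac → Frac
(a , b) *ᶠ (c , d) = (a *ᴾ c) , (b *ᴾ d)

_/ᶠ_ : Frac → Frac → Frac
(a , b) /ᶠ (c , d) = (a *ᴾ d) , (b *ᴾ c)

0ᶠ 1ᶠ xᶠ qᶠ : Frac
0ᶠ = poly 0ᴾ
1ᶠ = poly 1ᴾ
xᶠ = poly xᴾ
qᶠ = poly qᴾ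

_^ᶠ_ : Frac → ℕ → Frac
f ^ᶠ zero = 1ᶠ
f ^ᶠ suc n = f *ᶠ (f ^ᶠ n)

q^-_ : ℕ → Frac
q^- m = 1ᶠ /ᶠ (qᶠ ^ᶠ m)

sumᶠ : ℕ → (ℕ → Frac) → Frac
sumᶠ zero f = 0ᶠ
sumᶠ (suc k) f = sumᶠ k f +ᶠ f k

prodᶠ : ℕ → (ℕ → Frac) → Frac
prodᶠ zero f = 1ᶠ
prodᶠ (suc k) f = prodᶠ k f *ᶠ f k

poch : Frac → Frac → ℕ → Frac
poch a b k = prodᶠ k λ j → 1ᶠ -ᶠ a *ᶠ (b ^ᶠ j)

qint : ℕ → Poly
qint zero = 0ᴾ
qint (suc n) = qint n +ᴾ qᴾ ^ᴾ n

-- Congruence of rational functions modulo a polynomial P: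
-- A - B = A₁/A₂ in lowest terms, P ∣ A₁, gcd(P, A₂) = 1.
-- (A and B are required to be genuine rational functions: nonzero denominators.)

infix 4 _≡_mod_
infixr 8 _^ᶠ_ _^ᴾ_
_≡_mod_ : Frac → Frac → Poly → Set
A ≡ B mod P =
  ¬ (den A ≈ᴾ 0ᴾ) × ¬ (den B ≈ᴾ 0ᴾ) ×
  Σ Poly λ A₁ → Σ Poly λ A₂ →
    ¬ (A₂ ≈ᴾ 0ᴾ) ×
    (num (A -ᶠ B) *ᴾ A₂ ≈ᴾ A₁ *ᴾ den (A -ᶠ B)) ×
    Coprime A₁ A₂ ×
    (P ∣ᴾ A₁) ×
    Coprime P A₂

q⁴ : Frac
q⁴ = qᶠ ^ᶠ 4

α : ℕ → Frac
α k = (qᶠ ^ᶠ (2 ℕ.* k)) *ᶠ poly (qint (8 ℕ.* k ℕ.+ 1)) *ᶠ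
      ((poch qᶠ q⁴ k ^ᶠ 2) *ᶠ poch (xᶠ *ᶠ qᶠ) q⁴ k *ᶠ poch (qᶠ /ᶠ xᶠ) q⁴ k
       /ᶠ ((poch q⁴ q⁴ k ^ᶠ 2) *ᶠ poch (xᶠ *ᶠ q⁴) q⁴ k *ᶠ poch (q⁴ /ᶠ xᶠ) q⁴ k))

s t u : ℕ → Frac
s k = sumᶠ (suc k) λ j → α j *ᶠ α (k ℕ.∸ j)
t k = sumᶠ (suc k) λ j → sumᶠ (suc (k ℕ.∸ j)) λ i →
        α j *ᶠ α i *ᶠ α (k ℕ.∸ j ℕ.∸ i)
u k = sumᶠ (suc k) λ j → sumᶠ (suc (k ℕ.∸ j)) λ i → sumᶠ (suc (k ℕ.∸ j ℕ.∸ i)) λ h →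
        α j *ᶠ α i *ᶠ α h *ᶠ α (k ℕ.∸ j ℕ.∸ i ℕ.∸ h)

modulus : ℕ → Poly
modulus n = qint n *ᴾ (1ᴾ -ᴾ xᴾ *ᴾ qᴾ ^ᴾ n) *ᴾ (xᴾ -ᴾ qᴾ ^ᴾ n)

ratio : ℕ → Frac
ratio m = poch (qᶠ ^ᶠ 2) q⁴ m /ᶠ poch q⁴ q⁴ m

{-# OPTIONS --safe #-}
module Submission where

-- Modulo x - q^n or 1 - x q^n the factor (q^(1-n);q⁴)_k kills α(k) for k > m = (n-1)/4, so the
-- truncated r-fold convolution (r ≤ 4, hence r m < n) is the r-th power of Σ α(k), and that sum is
-- a terminating very-well-poised ₆φ₅, evaluated by a telescoping certificate. For [n], idempotents
-- split ℚ[q]/[n] into rings where q is a primitive d-th root of unity, d ∣ n; there α(a d + b) is a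
-- constant depending on a times α(b), α(b) vanishes for (d-1)/4 < b < d, and α(b) = -α((d-1)/4 - b),
-- so the truncated convolution is 0, as is the right-hand side. Lowest terms A₁/A₂ of N/D are a
-- solution of N A₂ = A₁ D of least degree, found by elimination over ℚ. The modulus divides A₁,
-- and then the coprimality of A₁ and A₂ makes A₂ coprime to the modulus.

open import Level using (0ℓ)
open import Data.Empty using (⊥-elim)
open import Data.Product using (Σ; ∃; _×_; _,_; proj₁; proj₂)
open import Data.Sum using (_⊎_; inj₁; inj₂; [_,_]′; map₁; map₂)
open import Data.Maybe using (Maybe; just; nothing)
open import Data.Nat as ℕ using (ℕ; zero; suc; _∸_)
import Data.Nat.Properties as ℕₚ
import Data.Nat.DivMod as ℕ
import Data.Nat.Divisibility as ℕ
import Data.Nat.Solver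
open import Data.Nat.ListAction using (product)
open import Data.Nat.Primality using (Prime)
open import Data.Nat.Primality.Factorisation using (factorise; PrimeFactorisation)
open import Data.Integer as ℤ using (ℤ; +_; -[1+_])
import Data.Integer.Properties as ℤₚ
open import Data.Rational as ℚ using (ℚ; 0ℚ; 1ℚ)
import Data.Rational.Properties as ℚₚ
open import Data.List using (List; []; _∷_; map; _++_; length)
open import Data.List.Properties using (length-map)
open import Data.List.Relation.Unary.All using (All; []; _∷_)
import Data.List.Relation.Unary.All.Properties as All
open import Relation.Nullary using (Dec; yes; no; ¬_)
open import Relation.Binary using (tri<; tri≈; tri>)
open import Relation.Binary.PropositionalEquality as ≡ using (_≡_; _≢_)
open import Algebra.Bundles using (CommutativeRing)
open import Algebra.Morphism.Bundles using (RingHomomorphism)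
import Algebra.Solver.Ring
import Algebra.Solver.Ring.AlmostCommutativeRing as ACR

module ℕS = Data.Nat.Solver.+-*-Solver

-- The obstacle modulo [n] is that α(k) has poles at the roots of unity where it is to be evaluated:
-- for k ≥ d its denominator contains (1 - q^(4j))² with j a multiple of d. So a fraction is tied to
-- its value by a relation: some representation of it must have a denominator that becomes a unit.
-- Such a representation exists because zeros and poles alternate: for j = ad, ..., ad+d-1 the term
-- ratio has a double zero at j = ad + (d-1)/4, where d divides 4j+1, and a double pole at the last
-- j, where d divides 4(j+1). Each zero precedes its pole, and over a full block the two cancel. The
-- condition on prime factors makes every divisor d of n congruent to 1 modulo 4, so (d-1)/4 is an
-- integer. Four indices up to (d-1)/4 still sum to less than d, which is why the argument reaches
-- fourfold convolutions. The factors containing x are handled in total quotient rings, where 1 -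
-- x^j becomes a unit; inverting only regular elements keeps vanishing equivalent to divisibility.

Ring₀ : Set₁
Ring₀ = CommutativeRing 0ℓ 0ℓ

-- A ring solver with integer coefficients, for rings without decidable equality

module IntegerSolver (R : Ring₀) where
  open CommutativeRing R
  open import Algebra.Properties.Ring ring using (-‿distribˡ-*; -‿distribʳ-*; -‿involutive; -0#≈0#)
  open import Algebra.Properties.AbelianGroup +-abelianGroup using (⁻¹-∙-comm)
  open import Algebra.Properties.Semiring.Mult.TCOptimised semiring
    using (1+×; ×-homo-+; ×1-homo-*) renaming (_×_ to _∙_)
  open import Relation.Binary.Reasoning.Setoid setoid

  fromℤ : ℤ → Carrier
  fromℤ (+ n)    = n ∙ 1#
  fromℤ -[1+ n ] = - (suc n ∙ 1#)

  private
    minus-suc : ∀ a b c → a - b ≈ (c + a) - (c + b)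
    minus-suc a b c = sym (begin
      (c + a) - (c + b)       ≈⟨ +-cong (+-comm c a) (sym (⁻¹-∙-comm c b)) ⟩
      (a + c) + (- c + - b)   ≈⟨ +-assoc a c _ ⟩
      a + (c + (- c + - b))   ≈⟨ +-congˡ (sym (+-assoc c (- c) (- b))) ⟩
      a + ((c + - c) + - b)   ≈⟨ +-congˡ (+-congʳ (-‿inverseʳ c)) ⟩
      a + (0# + - b)          ≈⟨ +-congˡ (+-identityˡ _) ⟩
      a - b                   ∎)

  fromℤ-⊖ : ∀ m n → fromℤ (m ℤ.⊖ n) ≈ m ∙ 1# - n ∙ 1#
  fromℤ-⊖ m zero = sym (trans (+-congˡ -0#≈0#) (+-identityʳ _))
  fromℤ-⊖ zero (suc n) = sym (+-identityˡ _)
  fromℤ-⊖ (suc m) (suc n) rewrite ℤₚ.[1+m]⊖[1+n]≡m⊖n m n = begin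
    fromℤ (m ℤ.⊖ n)                     ≈⟨ fromℤ-⊖ m n ⟩
    m ∙ 1# - n ∙ 1#                     ≈⟨ minus-suc _ _ 1# ⟩
    (1# + m ∙ 1#) - (1# + n ∙ 1#)       ≈⟨ +-cong (1+× m 1#) (-‿cong (1+× n 1#)) ⟨
    suc m ∙ 1# - suc n ∙ 1#             ∎

  fromℤ-+ : ∀ i j → fromℤ (i ℤ.+ j) ≈ fromℤ i + fromℤ j
  fromℤ-+ (+ m) (+ n) = ×-homo-+ 1# m n
  fromℤ-+ (+ m) -[1+ n ] = fromℤ-⊖ m (suc n)
  fromℤ-+ -[1+ m ] (+ n) = trans (fromℤ-⊖ n (suc m)) (+-comm _ _)
  fromℤ-+ -[1+ m ] -[1+ n ] = begin
    - (suc (suc (m ℕ.+ n)) ∙ 1#)        ≡⟨ ≡.cong (λ k → - (k ∙ 1#)) (≡.cong suc (ℕₚ.+-suc m n)) ⟨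
    - ((suc m ℕ.+ suc n) ∙ 1#)          ≈⟨ -‿cong (×-homo-+ 1# (suc m) (suc n)) ⟩
    - (suc m ∙ 1# + suc n ∙ 1#)         ≈⟨ ⁻¹-∙-comm _ _ ⟨
    - (suc m ∙ 1#) + - (suc n ∙ 1#)     ∎

  fromℤ-neg : ∀ i → fromℤ (ℤ.- i) ≈ - fromℤ i
  fromℤ-neg (+ zero)  = sym -0#≈0#
  fromℤ-neg (+ suc n) = refl
  fromℤ-neg -[1+ n ]  = sym (-‿involutive _)

  fromℤ-* : ∀ i j → fromℤ (i ℤ.* j) ≈ fromℤ i * fromℤ j
  fromℤ-* (+ m) (+ n) rewrite ≡.sym (ℤₚ.pos-* m n) = ×1-homo-* m n
  fromℤ-* (+ zero) -[1+ n ] = sym (zeroˡ _)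
  fromℤ-* (+ suc m) -[1+ n ] = trans (-‿cong (×1-homo-* (suc m) (suc n))) (-‿distribʳ-* _ _)
  fromℤ-* -[1+ m ] (+ zero) rewrite ℕₚ.*-zeroʳ m = sym (zeroʳ _)
  fromℤ-* -[1+ m ] (+ suc n) = trans (-‿cong (×1-homo-* (suc m) (suc n))) (-‿distribˡ-* _ _)
  fromℤ-* -[1+ m ] -[1+ n ] = begin
    (suc m ℕ.* suc n) ∙ 1#              ≈⟨ ×1-homo-* (suc m) (suc n) ⟩
    suc m ∙ 1# * suc n ∙ 1#             ≈⟨ -‿involutive _ ⟨
    - (- (suc m ∙ 1# * suc n ∙ 1#))     ≈⟨ -‿cong (-‿distribˡ-* _ _) ⟩
    - (- (suc m ∙ 1#) * suc n ∙ 1#)     ≈⟨ -‿distribʳ-* _ _ ⟩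
    - (suc m ∙ 1#) * - (suc n ∙ 1#)     ∎

  private
    morphism : CommutativeRing.rawRing ℤₚ.+-*-commutativeRing ACR.-Raw-AlmostCommutative⟶ ACR.fromCommutativeRing R
    morphism = record
      { ⟦_⟧ = fromℤ ; +-homo = fromℤ-+ ; *-homo = fromℤ-* ; -‿homo = fromℤ-neg
      ; 0-homo = refl ; 1-homo = refl }

    coeff≟ : (i j : ℤ) → Maybe (fromℤ i ≈ fromℤ j)
    coeff≟ i j with i ℤ.≟ j
    ... | yes ≡.refl = just refl
    ... | no _       = nothing

  open Algebra.Solver.Ring _ (ACR.fromCommutativeRing R) morphism coeff≟ public
    using (solve; _:=_; _:+_; _:*_; _:-_; :-_; _:^_; con; Polynomial)

  :1 : ∀ {n} → Polynomial n
  :1 = con (+ 1)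

-- Rings, quotients and total quotient rings

module RingTheory (R : Ring₀) where
  open CommutativeRing R public
  open import Algebra.Properties.CommutativeSemiring.Exp commutativeSemiring public
    using (_^_; ^-congˡ; ^-homo-*; ^-assocʳ; ^-distrib-*)
  open import Algebra.Properties.Ring ring public using (-0#≈0#)
  open import Algebra.Properties.AbelianGroup +-abelianGroup
  open IntegerSolver R public
  open import Relation.Binary.Reasoning.Setoid setoid

  infix 4 _∣_
  _∣_ : Carrier → Carrier → Set
  d ∣ a = Σ Carrier λ c → d * c ≈ a

  Unit : Carrier → Set
  Unit a = a ∣ 1#

  Regular : Carrier → Set
  Regular a = ∀ b → a * b ≈ 0# → b ≈ 0#

  -≈0⇒≈ : ∀ {a b} → a - b ≈ 0# → a ≈ b
  -≈0⇒≈ = x∙y⁻¹≈ε⇒x≈y _ _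

  ≈⇒-≈0 : ∀ {a b} → a ≈ b → a - b ≈ 0#
  ≈⇒-≈0 = x≈y⇒x∙y⁻¹≈ε

  1^ : ∀ k → 1# ^ k ≈ 1#
  1^ zero = refl
  1^ (suc k) = trans (*-identityˡ _) (1^ k)

  ^-≡ : ∀ a {k l} → k ≡ l → a ^ k ≈ a ^ l
  ^-≡ a ≡.refl = refl

  unit-1 : Unit 1#
  unit-1 = 1# , *-identityˡ 1#

  unit-cong : ∀ {a b} → a ≈ b → Unit a → Unit b
  unit-cong a≈b (c , ac≈1) = c , trans (*-congʳ (sym a≈b)) ac≈1

  unit-* : ∀ {a b} → Unit a → Unit b → Unit (a * b)
  unit-* {a} {b} (a′ , p) (b′ , r) = a′ * b′ , (begin
    a * b * (a′ * b′)      ≈⟨ solve 4 (λ a b c d → a :* b :* (c :* d) := a :* c :* (b :* d)) refl a b a′ b′ ⟩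
    a * a′ * (b * b′)      ≈⟨ *-cong p r ⟩
    1# * 1#                ≈⟨ *-identityˡ 1# ⟩
    1#                     ∎)

  unit-neg : ∀ {a} → Unit a → Unit (- a)
  unit-neg {a} (b , p) = - b , trans (solve 2 (λ a b → :- a :* :- b := a :* b) refl a b) p

  unit-swap : ∀ {a b} → Unit (a - b) → Unit (b - a)
  unit-swap {a} {b} u = unit-cong (solve 2 (λ a b → :- (a :- b) := b :- a) refl a b) (unit-neg u)

  unit-^ : ∀ {a} k → Unit a → Unit (a ^ k)
  unit-^ zero u = unit-1
  unit-^ (suc k) u = unit-* u (unit-^ k u)

  unit-∣ : ∀ {a b} → a ∣ b → Unit b → Unit a
  unit-∣ (c , p) (d , r) = c * d , trans (sym (*-assoc _ c d)) (trans (*-congʳ p) r)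

  unit⇒regular : ∀ {a} → Unit a → Regular a
  unit⇒regular {a} (c , p) b ab≈0 = begin
    b              ≈⟨ *-identityˡ b ⟨
    1# * b         ≈⟨ *-congʳ p ⟨
    a * c * b      ≈⟨ solve 3 (λ a c b → a :* c :* b := c :* (a :* b)) refl a c b ⟩
    c * (a * b)    ≈⟨ *-congˡ ab≈0 ⟩
    c * 0#         ≈⟨ zeroʳ c ⟩
    0#             ∎

  regular-cancel : ∀ {u a b} → Regular u → u * a ≈ u * b → a ≈ b
  regular-cancel {u} {a} {b} r p = -≈0⇒≈ (r (a - b) (trans
    (solve 3 (λ u a b → u :* (a :- b) := u :* a :- u :* b) refl u a b) (≈⇒-≈0 p)))

  unit-cancel : ∀ {u a b} → Unit u → u * a ≈ u * b → a ≈ b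
  unit-cancel u = regular-cancel (unit⇒regular u)

  regular-1 : Regular 1#
  regular-1 = unit⇒regular unit-1

  regular-* : ∀ {a b} → Regular a → Regular b → Regular (a * b)
  regular-* {a} {b} ra rb c p = rb c (ra (b * c) (trans (sym (*-assoc a b c)) p))

  trivial : 1# ≈ 0# → ∀ a → a ≈ 0#
  trivial p a = trans (sym (*-identityˡ a)) (trans (*-congʳ p) (zeroˡ a))

  *-distribʳ-sub : ∀ a b c r → (a - c * b) * r ≈ a * r - c * (b * r)
  *-distribʳ-sub = solve 4 (λ a b c r → (a :- c :* b) :* r := a :* r :- c :* (b :* r)) refl

  -- The last term is split off, as in `sumᶠ` and `prodᶠ`, so that fractions and their values are
  -- compared term by term.
  sum prod : ℕ → (ℕ → Carrier) → Carrier
  sum zero f = 0#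
  sum (suc k) f = sum k f + f k
  prod zero f = 1#
  prod (suc k) f = prod k f * f k

  sum-cong : ∀ k {f g : ℕ → Carrier} → (∀ i → i ℕ.< k → f i ≈ g i) → sum k f ≈ sum k g
  sum-cong zero p = refl
  sum-cong (suc k) p = +-cong (sum-cong k (λ i i<k → p i (ℕₚ.m<n⇒m<1+n i<k))) (p k ℕₚ.≤-refl)

  sum-zero : ∀ k {f : ℕ → Carrier} → (∀ i → i ℕ.< k → f i ≈ 0#) → sum k f ≈ 0#
  sum-zero zero p = refl
  sum-zero (suc k) p = trans (+-cong (sum-zero k (λ i i<k → p i (ℕₚ.m<n⇒m<1+n i<k))) (p k ℕₚ.≤-refl)) (+-identityˡ 0#)

  sum-+ : ∀ k (f g : ℕ → Carrier) → sum k (λ i → f i + g i) ≈ sum k f + sum k g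
  sum-+ zero f g = sym (+-identityˡ 0#)
  sum-+ (suc k) f g = trans (+-congʳ (sum-+ k f g))
    (solve 4 (λ a b c d → a :+ b :+ (c :+ d) := a :+ c :+ (b :+ d)) refl _ _ _ _)

  sum-*ˡ : ∀ k c (f : ℕ → Carrier) → sum k (λ i → c * f i) ≈ c * sum k f
  sum-*ˡ zero c f = sym (zeroʳ c)
  sum-*ˡ (suc k) c f = trans (+-congʳ (sum-*ˡ k c f)) (sym (distribˡ c _ _))

  sum-*ʳ : ∀ k c (f : ℕ → Carrier) → sum k (λ i → f i * c) ≈ sum k f * c
  sum-*ʳ k c f = trans (sum-cong k (λ i _ → *-comm (f i) c)) (trans (sum-*ˡ k c f) (*-comm c _))

  sum-append : ∀ k l (f : ℕ → Carrier) → sum (k ℕ.+ l) f ≈ sum k f + sum l (λ i → f (k ℕ.+ i))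
  sum-append k zero f rewrite ℕₚ.+-identityʳ k = sym (+-identityʳ _)
  sum-append k (suc l) f rewrite ℕₚ.+-suc k l = trans (+-congʳ (sum-append k l f)) (+-assoc _ _ _)

  sum-suc : ∀ k (f : ℕ → Carrier) → sum (suc k) f ≈ f 0 + sum k (λ i → f (suc i))
  sum-suc k f = trans (sum-append 1 k f) (+-congʳ (+-identityˡ _))

  sum-reverse : ∀ k (f g : ℕ → Carrier) → (∀ i j → suc (i ℕ.+ j) ≡ k → f i ≈ g j) → sum k f ≈ sum k g
  sum-reverse zero f g p = refl
  sum-reverse (suc k) f g p = begin
    sum k f + f k                     ≈⟨ +-cong (sum-reverse k f (λ j → g (suc j)) (λ i j e → p i (suc j) (≡.cong suc (≡.trans (ℕₚ.+-suc i j) e))))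
                                                (p k 0 (≡.cong suc (ℕₚ.+-identityʳ k))) ⟩
    sum k (λ j → g (suc j)) + g 0     ≈⟨ +-comm _ _ ⟩
    g 0 + sum k (λ j → g (suc j))     ≈⟨ sum-suc k g ⟨
    sum (suc k) g                     ∎

  prod-cong : ∀ k {f g : ℕ → Carrier} → (∀ i → i ℕ.< k → f i ≈ g i) → prod k f ≈ prod k g
  prod-cong zero p = refl
  prod-cong (suc k) p = *-cong (prod-cong k (λ i i<k → p i (ℕₚ.m<n⇒m<1+n i<k))) (p k ℕₚ.≤-refl)

  prod-unit : ∀ k {f : ℕ → Carrier} → (∀ i → i ℕ.< k → Unit (f i)) → Unit (prod k f)
  prod-unit zero p = unit-1
  prod-unit (suc k) p = unit-* (prod-unit k (λ i i<k → p i (ℕₚ.m<n⇒m<1+n i<k))) (p k ℕₚ.≤-refl)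

  prod-* : ∀ k (f g : ℕ → Carrier) → prod k (λ i → f i * g i) ≈ prod k f * prod k g
  prod-* zero f g = sym (*-identityˡ 1#)
  prod-* (suc k) f g = trans (*-congʳ (prod-* k f g))
    (solve 4 (λ a b c d → a :* b :* (c :* d) := a :* c :* (b :* d)) refl _ _ _ _)

  prod-append : ∀ k l (f : ℕ → Carrier) → prod (k ℕ.+ l) f ≈ prod k f * prod l (λ i → f (k ℕ.+ i))
  prod-append k zero f rewrite ℕₚ.+-identityʳ k = sym (*-identityʳ _)
  prod-append k (suc l) f rewrite ℕₚ.+-suc k l = trans (*-congʳ (prod-append k l f)) (*-assoc _ _ _)

  [_]_ : ℕ → Carrier → Carrier
  [ k ] y = sum k (y ^_)

  geometric : ∀ y k → (1# - y) * [ k ] y ≈ 1# - y ^ k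
  geometric y zero = trans (zeroʳ _) (sym (-‿inverseʳ 1#))
  geometric y (suc k) = begin
    (1# - y) * ([ k ] y + y ^ k)                 ≈⟨ distribˡ _ _ _ ⟩
    (1# - y) * [ k ] y + (1# - y) * y ^ k        ≈⟨ +-congʳ (geometric y k) ⟩
    1# - y ^ k + (1# - y) * y ^ k                ≈⟨ solve 2 (λ y z → :1 :- z :+ (:1 :- y) :* z := :1 :- y :* z) refl y (y ^ k) ⟩
    1# - y * y ^ k                               ∎

  1-y∣1-y^ : ∀ y k → 1# - y ∣ 1# - y ^ k
  1-y∣1-y^ y k = _ , geometric y k

  1-y^∣1-y^ : ∀ y {d n} N → n ≡ N ℕ.* d → 1# - y ^ d ∣ 1# - y ^ n
  1-y^∣1-y^ y {d} N ≡.refl = let (c , e) = 1-y∣1-y^ (y ^ d) N in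
    c , trans e (+-congˡ (-‿cong (trans (^-assocʳ y d N) (^-≡ y (ℕₚ.*-comm d N)))))

  []-cong : ∀ k {y z} → y ≈ z → [ k ] y ≈ [ k ] z
  []-cong k p = sum-cong k (λ i _ → ^-congˡ i p)

  []-1 : ∀ k → [ k ] 1# ≈ sum k (λ _ → 1#)
  []-1 k = sum-cong k (λ i _ → 1^ i)

  -- An odd power of -y is -1, so 1 - (-y) divides 1 - (-1). This is what makes 1 + q^(2j)
  -- invertible at roots of unity of odd order.
  1+y∣2 : ∀ y k → y ^ suc (k ℕ.+ k) ≈ 1# → 1# + y ∣ 1# + 1#
  1+y∣2 y k p = let (c , h) = 1-y∣1-y^ (- y) (suc (k ℕ.+ k)) in c , (begin
    (1# + y) * c                 ≈⟨ *-congʳ (solve 1 (λ y → :1 :+ y := :1 :- :- y) refl y) ⟩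
    (1# - - y) * c               ≈⟨ h ⟩
    1# - (- y) ^ suc (k ℕ.+ k)   ≈⟨ +-congˡ (-‿cong (odd k)) ⟩
    1# - - y ^ suc (k ℕ.+ k)     ≈⟨ +-congˡ (-‿cong (-‿cong p)) ⟩
    1# - - 1#                    ≈⟨ solve 0 (:1 :- :- :1 := :1 :+ :1) refl ⟩
    1# + 1#                      ∎)
    where
    odd : ∀ k → (- y) ^ suc (k ℕ.+ k) ≈ - (y ^ suc (k ℕ.+ k))
    odd zero = solve 1 (λ y → :- y :* :1 := :- (y :* :1)) refl y
    odd (suc k) = begin
      (- y) ^ suc (suc k ℕ.+ suc k)                  ≈⟨ ^-≡ (- y) (≡.cong (λ i → suc (suc i)) (ℕₚ.+-suc k k)) ⟩
      - y * (- y * (- y) ^ suc (k ℕ.+ k))            ≈⟨ *-congˡ (*-congˡ (odd k)) ⟩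
      - y * (- y * - (y ^ suc (k ℕ.+ k)))            ≈⟨ solve 2 (λ y z → :- y :* (:- y :* :- z) := :- (y :* (y :* z))) refl y _ ⟩
      - (y * (y * y ^ suc (k ℕ.+ k)))                ≈⟨ -‿cong (^-≡ y (≡.cong (λ i → suc (suc i)) (ℕₚ.+-suc k k))) ⟨
      - y ^ suc (suc k ℕ.+ suc k)                    ∎

-- Ring homomorphisms

Hom : Ring₀ → Ring₀ → Set
Hom R S = RingHomomorphism (CommutativeRing.rawRing R) (CommutativeRing.rawRing S)

module _ {R S : Ring₀} where
  private
    module R = RingTheory R
    module S = RingTheory S

  mkHom : (f : R.Carrier → S.Carrier) → (∀ {a b} → a R.≈ b → f a S.≈ f b) →
          (∀ a b → f (a R.+ b) S.≈ f a S.+ f b) → (∀ a b → f (a R.* b) S.≈ f a S.* f b) →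
          f R.1# S.≈ S.1# → Hom R S
  mkHom f f-cong f-+ f-* f-1 = record
    { ⟦_⟧ = f
    ; isRingHomomorphism = record
      { isSemiringHomomorphism = record
        { isNearSemiringHomomorphism = record
          { +-isMonoidHomomorphism = record
            { isMagmaHomomorphism = record
              { isRelHomomorphism = record { cong = f-cong } ; homo = f-+ }
            ; ε-homo = f-0 }
          ; *-homo = f-* }
        ; 1#-homo = f-1 }
      ; -‿homo = f-neg } }
    where
    open import Relation.Binary.Reasoning.Setoid S.setoid
    f-0 : f R.0# S.≈ S.0#
    f-0 = begin
      f R.0#                               ≈⟨ S.solve 1 (λ a → a S.:= a S.:+ a S.:- a) S.refl _ ⟩
      f R.0# S.+ f R.0# S.- f R.0#         ≈⟨ S.+-congʳ (f-+ R.0# R.0#) ⟨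
      f (R.0# R.+ R.0#) S.- f R.0#         ≈⟨ S.≈⇒-≈0 (f-cong (R.+-identityˡ R.0#)) ⟩
      S.0#                                 ∎
    f-neg : ∀ a → f (R.- a) S.≈ S.- f a
    f-neg a = begin
      f (R.- a)                            ≈⟨ S.solve 2 (λ a b → b S.:= a S.:+ b S.:- a) S.refl (f a) _ ⟩
      f a S.+ f (R.- a) S.- f a            ≈⟨ S.+-congʳ (f-+ a (R.- a)) ⟨
      f (a R.- a) S.- f a                  ≈⟨ S.+-congʳ (S.trans (f-cong (R.-‿inverseʳ a)) f-0) ⟩
      S.0# S.- f a                         ≈⟨ S.+-identityˡ _ ⟩
      S.- f a                              ∎

module HomTheory {R S : Ring₀} (φ : Hom R S) where
  private
    module R = RingTheory R
    module S = RingTheory S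
  open RingHomomorphism φ public

  homo-unit : ∀ {a} → R.Unit a → S.Unit ⟦ a ⟧
  homo-unit (b , p) = ⟦ b ⟧ , S.trans (S.sym (*-homo _ b)) (S.trans (⟦⟧-cong p) 1#-homo)

  homo-- : ∀ a b → ⟦ a R.- b ⟧ S.≈ ⟦ a ⟧ S.- ⟦ b ⟧
  homo-- a b = S.trans (+-homo a (R.- b)) (S.+-congˡ (-‿homo b))

  homo-1- : ∀ a → ⟦ R.1# R.- a ⟧ S.≈ S.1# S.- ⟦ a ⟧
  homo-1- a = S.trans (homo-- R.1# a) (S.+-congʳ 1#-homo)

  homo-^ : ∀ a k → ⟦ a R.^ k ⟧ S.≈ ⟦ a ⟧ S.^ k
  homo-^ a zero = 1#-homo
  homo-^ a (suc k) = S.trans (*-homo a _) (S.*-congˡ (homo-^ a k))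

  homo-sum : ∀ k f → ⟦ R.sum k f ⟧ S.≈ S.sum k (λ i → ⟦ f i ⟧)
  homo-sum zero f = 0#-homo
  homo-sum (suc k) f = S.trans (+-homo _ _) (S.+-congʳ (homo-sum k f))

  homo-[] : ∀ k y → ⟦ R.[ k ] y ⟧ S.≈ S.[ k ] ⟦ y ⟧
  homo-[] k y = S.trans (homo-sum k (y R.^_)) (S.sum-cong k (λ i _ → homo-^ y i))

_∘ʰ_ : {R S T : Ring₀} → Hom S T → Hom R S → Hom R T
_∘ʰ_ {R} {S} {T} ψ φ = mkHom {R} {T} (λ a → ψ.⟦ φ.⟦ a ⟧ ⟧) (λ p → ψ.⟦⟧-cong (φ.⟦⟧-cong p))
  (λ a b → T.trans (ψ.⟦⟧-cong (φ.+-homo a b)) (ψ.+-homo _ _))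
  (λ a b → T.trans (ψ.⟦⟧-cong (φ.*-homo a b)) (ψ.*-homo _ _))
  (T.trans (ψ.⟦⟧-cong φ.1#-homo) ψ.1#-homo)
  where
  module T = RingTheory T
  module φ = HomTheory {R} {S} φ
  module ψ = HomTheory {S} {T} ψ

module Quotient (R : Ring₀) (p : CommutativeRing.Carrier R) where
  open RingTheory R
  open import Relation.Binary.Reasoning.Setoid setoid

  private
    infix 4 _≋_
    record _≋_ (a b : Carrier) : Set where
      constructor mk
      field divides : p ∣ a - b

  ≈⇒≋ : ∀ {a b} → a ≈ b → a ≋ b
  ≈⇒≋ e = mk (0# , trans (zeroʳ p) (sym (≈⇒-≈0 e)))

  private
    +-cong′ : ∀ {a b c d} → a ≋ b → c ≋ d → a + c ≋ b + d
    +-cong′ {a} {b} {c} {d} (mk (k , e)) (mk (l , f)) = mk (k + l , (begin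
      p * (k + l)         ≈⟨ distribˡ p k l ⟩
      p * k + p * l       ≈⟨ +-cong e f ⟩
      a - b + (c - d)     ≈⟨ solve 4 (λ a b c d → a :- b :+ (c :- d) := a :+ c :- (b :+ d)) refl a b c d ⟩
      a + c - (b + d)     ∎))

    *-cong′ : ∀ {a b c d} → a ≋ b → c ≋ d → a * c ≋ b * d
    *-cong′ {a} {b} {c} {d} (mk (k , e)) (mk (l , f)) = mk (k * c + b * l , (begin
      p * (k * c + b * l)           ≈⟨ solve 5 (λ p k c b l → p :* (k :* c :+ b :* l) := p :* k :* c :+ b :* (p :* l)) refl p k c b l ⟩
      p * k * c + b * (p * l)       ≈⟨ +-cong (*-congʳ e) (*-congˡ f) ⟩
      (a - b) * c + b * (c - d)     ≈⟨ solve 4 (λ a b c d → (a :- b) :* c :+ b :* (c :- d) := a :* c :- b :* d) refl a b c d ⟩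
      a * c - b * d                 ∎))

    neg-cong′ : ∀ {a b} → a ≋ b → - a ≋ - b
    neg-cong′ {a} {b} (mk (k , e)) = mk (- k , (begin
      p * - k       ≈⟨ solve 2 (λ p k → p :* :- k := :- (p :* k)) refl p k ⟩
      - (p * k)     ≈⟨ -‿cong e ⟩
      - (a - b)     ≈⟨ solve 2 (λ a b → :- (a :- b) := :- a :- :- b) refl a b ⟩
      - a - - b     ∎))

    sym′ : ∀ {a b} → a ≋ b → b ≋ a
    sym′ {a} {b} (mk (k , e)) = mk (- k , (begin
      p * - k       ≈⟨ solve 2 (λ p k → p :* :- k := :- (p :* k)) refl p k ⟩
      - (p * k)     ≈⟨ -‿cong e ⟩
      - (a - b)     ≈⟨ solve 2 (λ a b → :- (a :- b) := b :- a) refl a b ⟩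
      b - a         ∎))

    trans′ : ∀ {a b c} → a ≋ b → b ≋ c → a ≋ c
    trans′ {a} {b} {c} (mk (k , e)) (mk (l , f)) = mk (k + l , (begin
      p * (k + l)         ≈⟨ distribˡ p k l ⟩
      p * k + p * l       ≈⟨ +-cong e f ⟩
      a - b + (b - c)     ≈⟨ solve 3 (λ a b c → a :- b :+ (b :- c) := a :- c) refl a b c ⟩
      a - c               ∎))

  quotient : Ring₀
  quotient = record
    { Carrier = Carrier ; _≈_ = _≋_ ; _+_ = _+_ ; _*_ = _*_ ; -_ = -_ ; 0# = 0# ; 1# = 1#
    ; isCommutativeRing = record
      { isRing = record
        { +-isAbelianGroup = record
          { isGroup = record
            { isMonoid = record
              { isSemigroup = record
                { isMagma = record
                  { isEquivalence = record { refl = ≈⇒≋ refl ; sym = sym′ ; trans = trans′ }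
                  ; ∙-cong = +-cong′ }
                ; assoc = λ a b c → ≈⇒≋ (+-assoc a b c) }
              ; identity = (λ a → ≈⇒≋ (+-identityˡ a)) , (λ a → ≈⇒≋ (+-identityʳ a)) }
            ; inverse = (λ a → ≈⇒≋ (-‿inverseˡ a)) , (λ a → ≈⇒≋ (-‿inverseʳ a))
            ; ⁻¹-cong = neg-cong′ }
          ; comm = λ a b → ≈⇒≋ (+-comm a b) }
        ; *-cong = *-cong′
        ; *-assoc = λ a b c → ≈⇒≋ (*-assoc a b c)
        ; *-identity = (λ a → ≈⇒≋ (*-identityˡ a)) , (λ a → ≈⇒≋ (*-identityʳ a))
        ; distrib = (λ a b c → ≈⇒≋ (distribˡ a b c)) , (λ a b c → ≈⇒≋ (distribʳ a b c)) }
      ; *-comm = λ a b → ≈⇒≋ (*-comm a b) } }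

  π : Hom R quotient
  π = mkHom {R} {quotient} (λ a → a) ≈⇒≋ (λ _ _ → ≈⇒≋ refl) (λ _ _ → ≈⇒≋ refl) (≈⇒≋ refl)

  ∣⇒≈0 : ∀ {a} → p ∣ a → CommutativeRing._≈_ quotient a 0#
  ∣⇒≈0 {a} (c , e) = mk (c , trans e (solve 1 (λ a → a := a :- con (ℤ.+ 0)) refl a))

  ≈0⇒∣ : ∀ {a} → CommutativeRing._≈_ quotient a 0# → p ∣ a
  ≈0⇒∣ {a} (mk (c , e)) = c , trans e (trans (+-congˡ -0#≈0#) (+-identityʳ a))

-- Exactly the regular elements are inverted, so R may have zero divisors: the construction is
-- applied to ℚ[x,q] and also to its quotients by the factors of the modulus. Injectivity of `ι` is
-- what brings results back to R.
module TotalQuotient (R : Ring₀) where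
  open RingTheory R
  open import Relation.Binary.Reasoning.Setoid setoid

  private
    record Fraction : Set where
      constructor _/_by_
      field
        top     : Carrier
        bottom  : Carrier
        regular : Regular bottom
    open Fraction

    infix 4 _≋_
    record _≋_ (z w : Fraction) : Set where
      constructor mk
      field cross : top z * bottom w ≈ top w * bottom z

    trans′ : ∀ {x y z} → x ≋ y → y ≋ z → x ≋ z
    trans′ {a / b by _} {c / d by r} {e / f by _} (mk p) (mk q) = mk (regular-cancel r (begin
      d * (a * f)   ≈⟨ solve 3 (λ d a f → d :* (a :* f) := a :* d :* f) refl d a f ⟩
      a * d * f     ≈⟨ *-congʳ p ⟩
      c * b * f     ≈⟨ solve 3 (λ c b f → c :* b :* f := c :* f :* b) refl c b f ⟩
      c * f * b     ≈⟨ *-congʳ q ⟩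
      e * d * b     ≈⟨ solve 3 (λ e d b → e :* d :* b := d :* (e :* b)) refl e d b ⟩
      d * (e * b)   ∎))

    _⊕_ _⊛_ : Fraction → Fraction → Fraction
    (a / b by r) ⊕ (c / d by s) = (a * d + c * b) / (b * d) by regular-* r s
    (a / b by r) ⊛ (c / d by s) = (a * c) / (b * d) by regular-* r s

    neg : Fraction → Fraction
    neg (a / b by r) = (- a) / b by r

    +-cong′ : ∀ {x y u v} → x ≋ y → u ≋ v → x ⊕ u ≋ y ⊕ v
    +-cong′ {a / b by _} {c / d by _} {e / f by _} {g / h by _} (mk p) (mk q) = mk (begin
      (a * f + e * b) * (d * h)             ≈⟨ solve 6 (λ a f e b d h → (a :* f :+ e :* b) :* (d :* h) := a :* d :* (f :* h) :+ e :* h :* (b :* d)) refl a f e b d h ⟩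
      a * d * (f * h) + e * h * (b * d)     ≈⟨ +-cong (*-congʳ p) (*-congʳ q) ⟩
      c * b * (f * h) + g * f * (b * d)     ≈⟨ solve 6 (λ c b f h g d → c :* b :* (f :* h) :+ g :* f :* (b :* d) := (c :* h :+ g :* d) :* (b :* f)) refl c b f h g d ⟩
      (c * h + g * d) * (b * f)             ∎)

    *-cong′ : ∀ {x y u v} → x ≋ y → u ≋ v → x ⊛ u ≋ y ⊛ v
    *-cong′ {a / b by _} {c / d by _} {e / f by _} {g / h by _} (mk p) (mk q) = mk (begin
      a * e * (d * h)         ≈⟨ solve 4 (λ a e d h → a :* e :* (d :* h) := a :* d :* (e :* h)) refl a e d h ⟩
      a * d * (e * h)         ≈⟨ *-cong p q ⟩
      c * b * (g * f)         ≈⟨ solve 4 (λ a e d h → a :* e :* (d :* h) := a :* d :* (e :* h)) refl c b g f ⟩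
      c * g * (b * f)         ∎)

    neg-cong′ : ∀ {x y} → x ≋ y → neg x ≋ neg y
    neg-cong′ {a / b by _} {c / d by _} (mk p) = mk (begin
      - a * d      ≈⟨ solve 2 (λ a d → :- a :* d := :- (a :* d)) refl a d ⟩
      - (a * d)    ≈⟨ -‿cong p ⟩
      - (c * b)    ≈⟨ solve 2 (λ a d → :- (a :* d) := :- a :* d) refl c b ⟩
      - c * b      ∎)

    :0 : ∀ {n} → Polynomial n
    :0 = con ℤ.0ℤ

    0′ 1′ : Fraction
    0′ = 0# / 1# by regular-1
    1′ = 1# / 1# by regular-1

    +-assoc′ : ∀ x y z → (x ⊕ y) ⊕ z ≋ x ⊕ (y ⊕ z)
    +-assoc′ (a / b by _) (c / d by _) (e / f by _) = mk (solve 6 (λ a b c d e f →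
      ((a :* d :+ c :* b) :* f :+ e :* (b :* d)) :* (b :* (d :* f)) := (a :* (d :* f) :+ (c :* f :+ e :* d) :* b) :* (b :* d :* f)) refl a b c d e f)

    +-comm′ : ∀ x y → x ⊕ y ≋ y ⊕ x
    +-comm′ (a / b by _) (c / d by _) = mk (solve 4 (λ a b c d →
      (a :* d :+ c :* b) :* (d :* b) := (c :* b :+ a :* d) :* (b :* d)) refl a b c d)

    +-idˡ′ : ∀ x → 0′ ⊕ x ≋ x
    +-idˡ′ (a / b by _) = mk (solve 2 (λ a b → (:0 :* b :+ a :* :1) :* b := a :* (:1 :* b)) refl a b)

    +-invˡ′ : ∀ x → neg x ⊕ x ≋ 0′
    +-invˡ′ (a / b by _) = mk (solve 2 (λ a b → (:- a :* b :+ a :* b) :* :1 := :0 :* (b :* b)) refl a b)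

    *-assoc′ : ∀ x y z → (x ⊛ y) ⊛ z ≋ x ⊛ (y ⊛ z)
    *-assoc′ (a / b by _) (c / d by _) (e / f by _) = mk (solve 6 (λ a b c d e f →
      a :* c :* e :* (b :* (d :* f)) := a :* (c :* e) :* (b :* d :* f)) refl a b c d e f)

    *-comm′ : ∀ x y → x ⊛ y ≋ y ⊛ x
    *-comm′ (a / b by _) (c / d by _) = mk (solve 4 (λ a b c d → a :* c :* (d :* b) := c :* a :* (b :* d)) refl a b c d)

    *-idˡ′ : ∀ x → 1′ ⊛ x ≋ x
    *-idˡ′ (a / b by _) = mk (solve 2 (λ a b → :1 :* a :* b := a :* (:1 :* b)) refl a b)

    distribˡ′ : ∀ x y z → x ⊛ (y ⊕ z) ≋ (x ⊛ y) ⊕ (x ⊛ z)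
    distribˡ′ (a / b by _) (c / d by _) (e / f by _) = mk (solve 6 (λ a b c d e f →
      a :* (c :* f :+ e :* d) :* (b :* d :* (b :* f)) := (a :* c :* (b :* f) :+ a :* e :* (b :* d)) :* (b :* (d :* f))) refl a b c d e f)

  private
    fractions′ : Ring₀
    fractions′ = record
      { Carrier = Fraction ; _≈_ = _≋_ ; _+_ = _⊕_ ; _*_ = _⊛_ ; -_ = neg ; 0# = 0′ ; 1# = 1′
      ; isCommutativeRing = record
        { isRing = record
          { +-isAbelianGroup = record
            { isGroup = record
              { isMonoid = record
                { isSemigroup = record
                  { isMagma = record
                    { isEquivalence = record { refl = mk refl ; sym = λ (mk e) → mk (sym e) ; trans = trans′ }
                    ; ∙-cong = +-cong′ }
                  ; assoc = +-assoc′ }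
                ; identity = +-idˡ′ , λ x → trans′ (+-comm′ x 0′) (+-idˡ′ x) }
              ; inverse = +-invˡ′ , λ x → trans′ (+-comm′ x (neg x)) (+-invˡ′ x)
              ; ⁻¹-cong = neg-cong′ }
            ; comm = +-comm′ }
          ; *-cong = *-cong′
          ; *-assoc = *-assoc′
          ; *-identity = *-idˡ′ , λ x → trans′ (*-comm′ x 1′) (*-idˡ′ x)
          ; distrib = distribˡ′ , λ x y z → trans′ (*-comm′ (y ⊕ z) x)
              (trans′ (distribˡ′ x y z)
                (+-cong′ (*-comm′ x y) (*-comm′ x z))) }
        ; *-comm = *-comm′ } }

  abstract
    fractions : Ring₀
    fractions = fractions′

    ι : Hom R fractions
    ι = mkHom {R} {fractions} (λ a → a / 1# by regular-1) (λ p → mk (*-congʳ p))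
      (λ a b → mk (solve 2 (λ a b → (a :+ b) :* (:1 :* :1) := (a :* :1 :+ b :* :1) :* :1) refl a b))
      (λ a b → mk (solve 2 (λ a b → a :* b :* (:1 :* :1) := a :* b :* :1) refl a b))
      (mk refl)

  private
    module Q = RingTheory fractions
    module ι = HomTheory {R} {fractions} ι

  abstract
    ι-injective : ∀ {a b} → ι.⟦ a ⟧ Q.≈ ι.⟦ b ⟧ → a ≈ b
    ι-injective (mk p) = trans (sym (*-identityʳ _)) (trans p (*-identityʳ _))

    regular⇒unit : ∀ {a} → Regular a → Q.Unit ι.⟦ a ⟧
    regular⇒unit {a} r = 1# / a by r , mk (solve 1 (λ a → a :* :1 :* :1 := :1 :* (:1 :* a)) refl a)

  unit⇒regular-ι : ∀ {a} → Q.Unit ι.⟦ a ⟧ → Regular a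
  unit⇒regular-ι {a} u b p = ι-injective (Q.trans (Q.unit⇒regular u ι.⟦ b ⟧
    (Q.trans (Q.sym (ι.*-homo a b)) (Q.trans (ι.⟦⟧-cong p) ι.0#-homo))) (Q.sym ι.0#-homo))

-- Truncated powers of a sequence

data Order : Set where
  two three four : Order

-- The vanishing modulo [n] is an induction that starts with one factor, so the order is needed in
-- the form r + 1.
pred-order : Order → ℕ
pred-order two   = 1
pred-order three = 2
pred-order four  = 3

order : Order → ℕ
order o = suc (pred-order o)

order≤4 : ∀ o → order o ℕ.≤ 4
order≤4 two   = ℕ.s≤s (ℕ.s≤s ℕ.z≤n)
order≤4 three = ℕ.s≤s (ℕ.s≤s (ℕ.s≤s ℕ.z≤n))
order≤4 four  = ℕₚ.≤-refl

module TruncatedPowers (R : Ring₀) where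
  open RingTheory R
  open import Relation.Binary.Reasoning.Setoid setoid

  -- truncated f r M is the sum of f k₁ * … * f kᵣ over k₁ + … + kᵣ < M.
  truncated : (ℕ → Carrier) → ℕ → ℕ → Carrier
  truncated f zero zero = 0#
  truncated f zero (suc M) = 1#
  truncated f (suc r) M = sum M (λ j → f j * truncated f r (M ∸ j))

  truncated-zero : ∀ f r → truncated f r 0 ≈ 0#
  truncated-zero f zero = refl
  truncated-zero f (suc r) = refl

  truncated-0-pos : ∀ f M → 0 ℕ.< M → truncated f 0 M ≈ 1#
  truncated-0-pos f (suc M) _ = refl

  truncated-1 : ∀ f M → truncated f 1 M ≈ sum M f
  truncated-1 f M = sum-cong M (λ j j<M → trans (*-congˡ (truncated-0-pos f (M ∸ j) (ℕₚ.m<n⇒0<n∸m j<M))) (*-identityʳ (f j)))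

  sum-extend : ∀ k l f → (∀ i → k ℕ.≤ i → f i ≈ 0#) → sum (k ℕ.+ l) f ≈ sum k f
  sum-extend k l f p = trans (sum-append k l f) (trans (+-congˡ (sum-zero l (λ i _ → p (k ℕ.+ i) (ℕₚ.m≤m+n k i)))) (+-identityʳ _))

  sum-extend-≤ : ∀ {k l} f → k ℕ.≤ l → (∀ i → k ℕ.≤ i → f i ≈ 0#) → sum l f ≈ sum k f
  sum-extend-≤ {k} {l} f k≤l p = ≡.subst (λ j → sum j f ≈ sum k f) (ℕₚ.m+[n∸m]≡n k≤l) (sum-extend k (l ∸ k) f p)

  -- Both sides run over the triangle i + j < n. Raising n by one adds the diagonal i + j = n, which
  -- gives each inner sum on the right one new term.
  sum-convolution : ∀ n (f g : ℕ → Carrier) →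
    sum n (λ k → sum (suc k) (λ j → f j * g (k ∸ j))) ≈ sum n (λ j → f j * sum (n ∸ j) g)
  sum-convolution zero f g = refl
  sum-convolution (suc n) f g = begin
    sum n (λ k → sum (suc k) (λ j → f j * g (k ∸ j))) + sum (suc n) (λ j → f j * g (n ∸ j))
      ≈⟨ +-congʳ (sum-convolution n f g) ⟩
    sum n (λ j → f j * sum (n ∸ j) g) + sum (suc n) (λ j → f j * g (n ∸ j))
      ≈⟨ +-congʳ (trans (+-congˡ last) (+-identityʳ _)) ⟨
    sum (suc n) (λ j → f j * sum (n ∸ j) g) + sum (suc n) (λ j → f j * g (n ∸ j))
      ≈⟨ sum-+ (suc n) _ _ ⟨
    sum (suc n) (λ j → f j * sum (n ∸ j) g + f j * g (n ∸ j))
      ≈⟨ sum-cong (suc n) step ⟩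
    sum (suc n) (λ j → f j * sum (suc n ∸ j) g)   ∎
    where
    last : f n * sum (n ∸ n) g ≈ 0#
    last rewrite ℕₚ.n∸n≡0 n = zeroʳ (f n)
    step : ∀ j → j ℕ.< suc n → f j * sum (n ∸ j) g + f j * g (n ∸ j) ≈ f j * sum (suc n ∸ j) g
    step j j<1+n rewrite ℕₚ.+-∸-assoc 1 (ℕₚ.≤-pred j<1+n) = sym (distribˡ (f j) _ _)

  conv₂ conv₃ conv₄ : (ℕ → Carrier) → ℕ → Carrier
  conv₂ f k = sum (suc k) λ j → f j * f (k ∸ j)
  conv₃ f k = sum (suc k) λ j → sum (suc (k ∸ j)) λ i → f j * f i * f (k ∸ j ∸ i)
  conv₄ f k = sum (suc k) λ j → sum (suc (k ∸ j)) λ i → sum (suc (k ∸ j ∸ i)) λ h →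
    f j * f i * f h * f (k ∸ j ∸ i ∸ h)

  sum-conv₂ : ∀ f n → sum n (conv₂ f) ≈ truncated f 2 n
  sum-conv₂ f n = trans (sum-convolution n f f) (sum-cong n (λ j _ → *-congˡ (sym (truncated-1 f (n ∸ j)))))

  sum-conv₃ : ∀ f n → sum n (conv₃ f) ≈ truncated f 3 n
  sum-conv₃ f n = begin
    sum n (conv₃ f)
      ≈⟨ sum-cong n (λ k _ → sum-cong (suc k) (λ j _ → trans (sum-cong (suc (k ∸ j)) (λ i _ → *-assoc _ _ _)) (sum-*ˡ (suc (k ∸ j)) (f j) _))) ⟩
    sum n (λ k → sum (suc k) (λ j → f j * conv₂ f (k ∸ j)))
      ≈⟨ sum-convolution n f (conv₂ f) ⟩
    sum n (λ j → f j * sum (n ∸ j) (conv₂ f))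
      ≈⟨ sum-cong n (λ j _ → *-congˡ (sum-conv₂ f (n ∸ j))) ⟩
    truncated f 3 n ∎

  sum-conv₄ : ∀ f n → sum n (conv₄ f) ≈ truncated f 4 n
  sum-conv₄ f n = begin
    sum n (conv₄ f)
      ≈⟨ sum-cong n (λ k _ → sum-cong (suc k) (λ j _ → trans (sum-cong (suc (k ∸ j)) (λ i _ →
           trans (sum-cong (suc (k ∸ j ∸ i)) (λ h _ → trans (*-congʳ (*-assoc _ _ _)) (*-assoc _ _ _))) (sum-*ˡ (suc (k ∸ j ∸ i)) (f j) _)))
           (sum-*ˡ (suc (k ∸ j)) (f j) _))) ⟩
    sum n (λ k → sum (suc k) (λ j → f j * conv₃ f (k ∸ j)))
      ≈⟨ sum-convolution n f (conv₃ f) ⟩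
    sum n (λ j → f j * sum (n ∸ j) (conv₃ f))
      ≈⟨ sum-cong n (λ j _ → *-congˡ (sum-conv₃ f (n ∸ j))) ⟩
    truncated f 4 n ∎

  conv : Order → (ℕ → Carrier) → ℕ → Carrier
  conv two   = conv₂
  conv three = conv₃
  conv four  = conv₄

  sum-conv : ∀ o f n → sum n (conv o f) ≈ truncated f (order o) n
  sum-conv two   = sum-conv₂
  sum-conv three = sum-conv₃
  sum-conv four  = sum-conv₄

  -- Indices outside 0, ..., m contribute nothing and r indices within it sum to at most r m, so a
  -- cutoff above r m cuts off nothing and the sum factors.
  truncated-finite : ∀ f m → (∀ k → m ℕ.< k → f k ≈ 0#) →
    ∀ r M → r ℕ.* m ℕ.< M → truncated f r M ≈ sum (suc m) f ^ r
  truncated-finite f m f≈0 zero M p = truncated-0-pos f M p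
  truncated-finite f m f≈0 (suc r) M p = begin
    sum M (λ j → f j * truncated f r (M ∸ j))
      ≈⟨ sum-extend-≤ _ (ℕₚ.≤-trans (ℕ.s≤s (ℕₚ.m≤m+n m (r ℕ.* m))) p) (λ j m<j → trans (*-congʳ (f≈0 j m<j)) (zeroˡ _)) ⟩
    sum (suc m) (λ j → f j * truncated f r (M ∸ j))
      ≈⟨ sum-cong (suc m) (λ j j<1+m → *-congˡ (truncated-finite f m f≈0 r (M ∸ j) (bound j (ℕₚ.≤-pred j<1+m)))) ⟩
    sum (suc m) (λ j → f j * sum (suc m) f ^ r)
      ≈⟨ sum-*ʳ (suc m) _ f ⟩
    sum (suc m) f ^ suc r ∎
    where
    bound : ∀ j → j ℕ.≤ m → r ℕ.* m ℕ.< M ∸ j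
    bound j j≤m = ℕₚ.≤-trans (ℕₚ.m+n≤o⇒m≤o∸n (suc (r ℕ.* m)) (≡.subst (ℕ._≤ M) (≡.cong suc (ℕₚ.+-comm m (r ℕ.* m))) p)) (ℕₚ.∸-monoʳ-≤ M j≤m)

  sum-blocks : ∀ N d f → sum (N ℕ.* d) f ≈ sum N (λ a → sum d (λ b → f (a ℕ.* d ℕ.+ b)))
  sum-blocks zero d f = refl
  sum-blocks (suc N) d f = begin
    sum (d ℕ.+ N ℕ.* d) f                                  ≡⟨ ≡.cong (λ k → sum k f) (ℕₚ.+-comm d (N ℕ.* d)) ⟩
    sum (N ℕ.* d ℕ.+ d) f                                  ≈⟨ sum-append (N ℕ.* d) d f ⟩
    sum (N ℕ.* d) f + sum d (λ b → f (N ℕ.* d ℕ.+ b))      ≈⟨ +-congʳ (sum-blocks N d f) ⟩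
    sum (suc N) (λ a → sum d (λ b → f (a ℕ.* d ℕ.+ b)))    ∎

  module _ (d m : ℕ) (f c g : ℕ → Carrier)
    (f-block : ∀ a b → b ℕ.< d → f (a ℕ.* d ℕ.+ b) ≈ c a * g b)
    (g≈0 : ∀ b → m ℕ.< b → b ℕ.< d → g b ≈ 0#)
    (Σg≈0 : sum d g ≈ 0#) where

    -- Here e is the total of the residues already chosen. Writing the first index as ad + b, the
    -- cutoff for the others becomes (N - a)d - (e + b). The bound on e says that residues never add
    -- up to a full block, so the remaining sum is the same for all b ≤ m, and block a contributes a
    -- multiple of the sum of g.
    truncated-periodic : ∀ r N e → e ℕ.+ suc r ℕ.* m ℕ.< d → truncated f (suc r) (N ℕ.* d ∸ e) ≈ 0#
    truncated-periodic r N e p = begin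
      -- Rounding up to whole blocks is harmless: the added terms have cutoff 0 in their second
      -- factor.
      sum (N ℕ.* d ∸ e) h         ≈⟨ sum-extend-≤ h (ℕₚ.m∸n≤m (N ℕ.* d) e) (λ j q → trans (*-congˡ (tail j q)) (zeroʳ _)) ⟨
      sum (N ℕ.* d) h             ≈⟨ sum-blocks N d h ⟩
      sum N (λ a → sum d (λ b → h (a ℕ.* d ℕ.+ b)))   ≈⟨ sum-zero N block ⟩
      0#                          ∎
      where
      h : ℕ → Carrier
      h j = f j * truncated f r (N ℕ.* d ∸ e ∸ j)
      tail : ∀ j → N ℕ.* d ∸ e ℕ.≤ j → truncated f r (N ℕ.* d ∸ e ∸ j) ≈ 0#
      tail j q rewrite ℕₚ.m≤n⇒m∸n≡0 q = truncated-zero f r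
      shift : ∀ a b → N ℕ.* d ∸ e ∸ (a ℕ.* d ℕ.+ b) ≡ (N ∸ a) ℕ.* d ∸ (e ℕ.+ b)
      shift a b = ≡.trans (ℕₚ.∸-+-assoc (N ℕ.* d) e (a ℕ.* d ℕ.+ b)) (≡.trans (≡.cong (N ℕ.* d ∸_) (lem e (a ℕ.* d) b))
        (≡.trans (≡.sym (ℕₚ.∸-+-assoc (N ℕ.* d) (a ℕ.* d) (e ℕ.+ b))) (≡.cong (_∸ (e ℕ.+ b)) (≡.sym (ℕₚ.*-distribʳ-∸ d N a)))))
        where
        lem : ∀ x y z → x ℕ.+ (y ℕ.+ z) ≡ y ℕ.+ (x ℕ.+ z)
        lem x y z = ≡.trans (≡.sym (ℕₚ.+-assoc x y z)) (≡.trans (≡.cong (ℕ._+ z) (ℕₚ.+-comm x y)) (ℕₚ.+-assoc y x z))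
      -- For b ≤ m the inner factor no longer depends on b: it is 0 if r > 0 and 1 if r = 0.
      inner : ∀ r → e ℕ.+ suc r ℕ.* m ℕ.< d → ∀ a → a ℕ.< N → Σ Carrier λ t → ∀ b → b ℕ.≤ m → truncated f r ((N ∸ a) ℕ.* d ∸ (e ℕ.+ b)) ≈ t
      inner zero p a a<N = 1# , λ b b≤m → truncated-0-pos f _ (ℕₚ.m<n⇒0<n∸m
        (ℕₚ.<-≤-trans (ℕₚ.≤-<-trans (ℕₚ.+-monoʳ-≤ e (ℕₚ.≤-trans b≤m (ℕₚ.m≤m+n m 0))) p) (ℕₚ.m≤n*m d (N ∸ a) {{ℕ.>-nonZero (ℕₚ.m<n⇒0<n∸m a<N)}})))
      inner (suc r) p a a<N = 0# , λ b b≤m → truncated-periodic r (N ∸ a) (e ℕ.+ b)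
        (ℕₚ.≤-<-trans (ℕₚ.≤-reflexive (ℕₚ.+-assoc e b _)) (ℕₚ.≤-<-trans (ℕₚ.+-monoʳ-≤ e (ℕₚ.+-monoˡ-≤ _ b≤m)) p))
      block : ∀ a → a ℕ.< N → sum d (λ b → h (a ℕ.* d ℕ.+ b)) ≈ 0#
      block a a<N = begin
        sum d (λ b → h (a ℕ.* d ℕ.+ b))   ≈⟨ sum-cong d term ⟩
        sum d (λ b → c a * t * g b)       ≈⟨ sum-*ˡ d (c a * t) g ⟩
        c a * t * sum d g                 ≈⟨ *-congˡ Σg≈0 ⟩
        c a * t * 0#                      ≈⟨ zeroʳ _ ⟩
        0#                                ∎
        where
        t = proj₁ (inner r p a a<N)
        term : ∀ b → b ℕ.< d → h (a ℕ.* d ℕ.+ b) ≈ c a * t * g b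
        term b b<d with ℕₚ.<-≤-connex m b
        ... | inj₁ m<b = begin
          h (a ℕ.* d ℕ.+ b)      ≈⟨ *-congʳ (trans (f-block a b b<d) (trans (*-congˡ (g≈0 b m<b b<d)) (zeroʳ _))) ⟩
          0# * _                 ≈⟨ zeroˡ _ ⟩
          0#                     ≈⟨ trans (*-congˡ (g≈0 b m<b b<d)) (zeroʳ _) ⟨
          c a * t * g b          ∎
        ... | inj₂ b≤m = begin
          h (a ℕ.* d ℕ.+ b)                                                      ≈⟨ *-congʳ (f-block a b b<d) ⟩
          c a * g b * truncated f r (N ℕ.* d ∸ e ∸ (a ℕ.* d ℕ.+ b))              ≡⟨ ≡.cong (λ k → c a * g b * truncated f r k) (shift a b) ⟩
          c a * g b * truncated f r ((N ∸ a) ℕ.* d ∸ (e ℕ.+ b))                  ≈⟨ *-congˡ (proj₂ (inner r p a a<N) b b≤m) ⟩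
          c a * g b * t                                                          ≈⟨ solve 3 (λ c g t → c :* g :* t := c :* t :* g) refl (c a) (g b) t ⟩
          c a * t * g b                                                          ∎

-- A terminating very-well-poised sum

module WellPoised (R : Ring₀) where
  open RingTheory R

  module Sums (a Q : Carrier)
    (unit-a   : Unit a)
    (unit-1-Q : ∀ k → Unit (1# - Q ^ suc k))
    (unit-1-aQ : ∀ k → Unit (1# - a * Q ^ k))
    (unit-Q-aQ : ∀ j m → Unit (Q ^ suc j - a * Q ^ m)) where

    open import Relation.Binary.Reasoning.Setoid setoid

    private
      sq : Carrier → Carrier
      sq y = y * y

    -- Their quotient is the term ratio of the ₆φ₅ series with base Q and parameters a; a, a²Q^m,
    -- Q^(-m), whose argument is Q/a². Negative powers of Q are cleared, which turns 1 - Q^(j-m)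
    -- into Q^j - Q^m. The very-well-poised factor 1 - aQ^(2k) is added in `F`, without the usual
    -- normalisation by 1 - a.
    numerator denominator : ℕ → ℕ → Carrier
    numerator m j = Q * (sq (1# - a * Q ^ j) * ((1# - a * a * Q ^ m * Q ^ j) * (Q ^ j - Q ^ m)))
    denominator m j = a * (sq (1# - Q ^ suc j) * ((1# - a * Q ^ m * Q ^ suc j) * (Q ^ suc j - a * Q ^ m)))

    private
      unit-1-avQ : ∀ m j → Unit (1# - a * Q ^ m * Q ^ j)
      unit-1-avQ m j = unit-cong (+-congˡ (-‿cong (trans (*-congˡ (^-homo-* Q m j)) (sym (*-assoc _ _ _))))) (unit-1-aQ (m ℕ.+ j))

    unit-denominator : ∀ m j → Unit (denominator m j)
    unit-denominator m j = unit-* unit-a (unit-* (unit-* (unit-1-Q j) (unit-1-Q j)) (unit-* (unit-1-avQ m (suc j)) (unit-Q-aQ j m)))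

    β : ℕ → ℕ → Carrier
    β m k = prod k (λ j → numerator m j * proj₁ (unit-denominator m j))

    F : ℕ → ℕ → Carrier
    F m k = (1# - a * Q ^ k * Q ^ k) * β m k

    private
      cancel-unit : ∀ {u} (w : Unit u) b n → b * (n * proj₁ w) * u ≈ b * n
      cancel-unit {u} (u′ , e) b n = begin
        b * (n * u′) * u       ≈⟨ solve 4 (λ b n u u′ → b :* (n :* u′) :* u := b :* n :* (u :* u′)) refl b n u u′ ⟩
        b * n * (u * u′)       ≈⟨ *-congˡ e ⟩
        b * n * 1#             ≈⟨ *-identityʳ _ ⟩
        b * n                  ∎

    β-suc : ∀ m k → β m (suc k) * denominator m k ≈ β m k * numerator m k
    β-suc m k = cancel-unit (unit-denominator m k) (β m k) (numerator m k)

    β-vanishes : ∀ m k → m ℕ.< k → β m k ≈ 0#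
    β-vanishes m (suc k) m<1+k with ℕₚ.m≤n⇒m<n∨m≡n (ℕₚ.≤-pred m<1+k)
    ... | inj₁ m<k = trans (*-congʳ (β-vanishes m k m<k)) (zeroˡ _)
    ... | inj₂ ≡.refl = trans (*-congˡ (trans (*-congʳ zero-factor) (zeroˡ _))) (zeroʳ _)
      where
      zero-factor : numerator m m ≈ 0#
      zero-factor = trans (*-congˡ (trans (*-congˡ (trans (*-congˡ (-‿inverseʳ (Q ^ m))) (zeroʳ _))) (zeroʳ _))) (zeroʳ Q)

    -- The certificate of the telescoping
    --   a(1-av)(1-Qv) F(m+1,k) - (1-aQv)(1-a²v) F(m,k) = G(m,k+1) - G(m,k),   v = Q^m,
    -- is G(m,k+1) = -(1-a²Qv²)(1-a)² C(m,k).
    private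
      numC denC : ℕ → ℕ → Carrier
      numC m i = sq (1# - a * Q ^ suc i) * ((1# - a * a * Q ^ m * Q ^ suc i) * (Q ^ suc i - Q * Q ^ m))
      denC m i = a * (sq (1# - Q ^ suc i) * ((1# - a * Q ^ m * Q ^ suc (suc i)) * (Q ^ suc i - a * Q ^ m)))

      unit-denC : ∀ m i → Unit (denC m i)
      unit-denC m i = unit-* unit-a (unit-* (unit-* (unit-1-Q i) (unit-1-Q i)) (unit-* (unit-1-avQ m (suc (suc i))) (unit-Q-aQ i m)))

      C : ℕ → ℕ → Carrier
      C m k = prod k (λ i → numC m i * proj₁ (unit-denC m i))

      C-suc : ∀ m k → C m (suc k) * denC m k ≈ C m k * numC m k
      C-suc m k = cancel-unit (unit-denC m k) (C m k) (numC m k)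

      C-vanishes : ∀ m k → m ℕ.< k → C m k ≈ 0#
      C-vanishes m (suc k) m<1+k with ℕₚ.m≤n⇒m<n∨m≡n (ℕₚ.≤-pred m<1+k)
      ... | inj₁ m<k = trans (*-congʳ (C-vanishes m k m<k)) (zeroˡ _)
      ... | inj₂ ≡.refl = trans (*-congˡ (trans (*-congʳ (trans (*-congˡ (trans (*-congˡ (-‿inverseʳ (Q * Q ^ m))) (zeroʳ _))) (zeroʳ _))) (zeroˡ _))) (zeroʳ _)

      -- If x′/x = N/D and c′/c = N′/D′, then x A = c B propagates to x′ A′ = c′ B′.
      propagate : ∀ {x x′ c c′ N D N′ D′ A B A′ B′} → Unit D → Unit D′ → Unit A →
        x′ * D ≈ x * N → c′ * D′ ≈ c * N′ → x * A ≈ c * B → B * N * A′ * D′ ≈ N′ * B′ * D * A → x′ * A′ ≈ c′ * B′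
      propagate {x} {x′} {c} {c′} {N} {D} {N′} {D′} {A} {B} {A′} {B′} uD uD′ uA p q r s =
        unit-cancel (unit-* uD (unit-* uD′ uA)) (begin
          D * (D′ * A) * (x′ * A′)      ≈⟨ solve 5 (λ D D′ A x A′ → D :* (D′ :* A) :* (x :* A′) := x :* D :* (A :* A′ :* D′)) refl D D′ A x′ A′ ⟩
          x′ * D * (A * A′ * D′)        ≈⟨ *-congʳ p ⟩
          x * N * (A * A′ * D′)         ≈⟨ solve 5 (λ x N A A′ D′ → x :* N :* (A :* A′ :* D′) := x :* A :* (N :* A′ :* D′)) refl x N A A′ D′ ⟩
          x * A * (N * A′ * D′)         ≈⟨ *-congʳ r ⟩
          c * B * (N * A′ * D′)         ≈⟨ solve 5 (λ c B N A′ D′ → c :* B :* (N :* A′ :* D′) := c :* (B :* N :* A′ :* D′)) refl c B N A′ D′ ⟩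
          c * (B * N * A′ * D′)         ≈⟨ *-congˡ s ⟩
          c * (N′ * B′ * D * A)         ≈⟨ solve 5 (λ c N B D A → c :* (N :* B :* D :* A) := c :* N :* (B :* D :* A)) refl c N′ B′ D A ⟩
          c * N′ * (B′ * D * A)         ≈⟨ *-congʳ q ⟨
          c′ * D′ * (B′ * D * A)        ≈⟨ solve 5 (λ c D′ B D A → c :* D′ :* (B :* D :* A) := D :* (D′ :* A) :* (c :* B)) refl c′ D′ B′ D A ⟩
          D * (D′ * A) * (c′ * B′)      ∎)

      -- The products β m (k+1), β (m+1) (k+1) and C m k share all but a bounded number of factors:
      -- the first is C m k times B₁/A₁, the second C m k times B₂/A₂. Both summands of the
      -- recurrence thereby become multiples of the certificate.
      A₁ B₁ A₂ B₂ : ℕ → ℕ → Carrier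
      A₁ m k = a * (sq (1# - Q ^ suc k) * ((1# - a * Q ^ m * Q) * (Q ^ suc k - a * Q ^ m)))
      B₁ m k = sq (1# - a) * ((1# - a * a * Q ^ m) * (Q ^ suc k - Q * Q ^ m))
      A₂ m k = a * (1# - a * Q ^ m) * ((1# - a * Q ^ m * Q ^ suc (suc k)) * sq (1# - Q ^ suc k))
      B₂ m k = sq (1# - a) * ((1# - a * a * Q ^ m * Q ^ suc k) * (1# - Q * Q ^ m))

      unit-A₁ : ∀ m k → Unit (A₁ m k)
      unit-A₁ m k = unit-* unit-a (unit-* (unit-* (unit-1-Q k) (unit-1-Q k))
        (unit-* (unit-cong (+-congˡ (-‿cong (*-congˡ (*-identityʳ Q)))) (unit-1-avQ m 1)) (unit-Q-aQ k m)))

      unit-A₂ : ∀ m k → Unit (A₂ m k)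
      unit-A₂ m k = unit-* (unit-* unit-a (unit-1-aQ m)) (unit-* (unit-1-avQ m (suc (suc k))) (unit-* (unit-1-Q k) (unit-1-Q k)))

      β-C : ∀ m k → β m (suc k) * A₁ m k ≈ C m k * B₁ m k
      β-C m zero = unit-cancel (unit-denominator m 0) (begin
        denominator m 0 * (β m 1 * A₁ m 0)       ≈⟨ solve 3 (λ d b a → d :* (b :* a) := b :* d :* a) refl _ _ _ ⟩
        β m 1 * denominator m 0 * A₁ m 0         ≈⟨ *-congʳ (β-suc m 0) ⟩
        1# * numerator m 0 * A₁ m 0              ≈⟨ solve 5 (λ q a v p r →
            :1 :* (q :* ((:1 :- a :* :1) :* (:1 :- a :* :1) :* ((:1 :- a :* a :* v :* :1) :* (:1 :- v)))) :* (a :* (p :* ((:1 :- a :* v :* q) :* r)))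
            := a :* (p :* ((:1 :- a :* v :* (q :* :1)) :* r)) :* (:1 :* ((:1 :- a) :* (:1 :- a) :* ((:1 :- a :* a :* v) :* (q :* :1 :- q :* v)))))
            refl Q a (Q ^ m) (sq (1# - Q ^ 1)) (Q ^ 1 - a * Q ^ m) ⟩
        denominator m 0 * (1# * B₁ m 0)          ∎)
      β-C m (suc k) = propagate (unit-denominator m (suc k)) (unit-denC m k) (unit-A₁ m k)
        (β-suc m (suc k)) (C-suc m k) (β-C m k)
        (solve 13 (λ q a v u 1-a² f g h i p r s t →
          1-a² :* (f :* (u :- q :* v)) :* (q :* (h :* (g :* (u :- v)))) :* (a :* (p :* (t :* i))) :* (a :* (r :* (s :* (u :- a :* v))))
          := h :* (g :* (u :- q :* v)) :* (1-a² :* (f :* (q :* u :- q :* v))) :* (a :* (p :* (s :* i))) :* (a :* (r :* (t :* (u :- a :* v)))))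
          refl Q a (Q ^ m) (Q ^ suc k) (sq (1# - a)) (1# - a * a * Q ^ m) (1# - a * a * Q ^ m * Q ^ suc k) (sq (1# - a * Q ^ suc k))
            (Q ^ suc (suc k) - a * Q ^ m) (sq (1# - Q ^ suc (suc k))) (sq (1# - Q ^ suc k)) (1# - a * Q ^ m * Q ^ suc (suc k)) (1# - a * Q ^ m * Q))

      β′-C : ∀ m k → β (suc m) (suc k) * A₂ m k ≈ C m k * B₂ m k
      β′-C m zero = unit-cancel (unit-denominator (suc m) 0) (begin
        denominator (suc m) 0 * (β (suc m) 1 * A₂ m 0)       ≈⟨ solve 3 (λ d b a → d :* (b :* a) := b :* d :* a) refl _ _ _ ⟩
        β (suc m) 1 * denominator (suc m) 0 * A₂ m 0         ≈⟨ *-congʳ (β-suc (suc m) 0) ⟩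
        1# * numerator (suc m) 0 * A₂ m 0                    ≈⟨ solve 4 (λ q a v p →
            :1 :* (q :* ((:1 :- a :* :1) :* (:1 :- a :* :1) :* ((:1 :- a :* a :* (q :* v) :* :1) :* (:1 :- q :* v)))) :* (a :* (:1 :- a :* v) :* ((:1 :- a :* v :* (q :* (q :* :1))) :* p))
            := a :* (p :* ((:1 :- a :* (q :* v) :* (q :* :1)) :* (q :* :1 :- a :* (q :* v)))) :* (:1 :* ((:1 :- a) :* (:1 :- a) :* ((:1 :- a :* a :* v :* (q :* :1)) :* (:1 :- q :* v)))))
            refl Q a (Q ^ m) (sq (1# - Q ^ 1)) ⟩
        denominator (suc m) 0 * (1# * B₂ m 0)                ∎)
      β′-C m (suc k) = propagate (unit-denominator (suc m) (suc k)) (unit-denC m k) (unit-A₂ m k)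
        (β-suc (suc m) (suc k)) (C-suc m k) (β′-C m k)
        (trans (solve 12 (λ q a v u 1-a² f f′ h p r s s′ →
          1-a² :* (f :* (:1 :- q :* v)) :* (q :* (h :* (f′ :* (u :- q :* v)))) :* (a :* (:1 :- a :* v) :* (s′ :* p)) :* (a :* (r :* (s :* (u :- a :* v))))
          := h :* (f :* (u :- q :* v)) :* (1-a² :* (f′ :* (:1 :- q :* v))) :* (a :* (p :* (s′ :* (q :* u :- a :* (q :* v))))) :* (a :* (:1 :- a :* v) :* (s :* r)))
          refl Q a (Q ^ m) (Q ^ suc k) (sq (1# - a)) (1# - a * a * Q ^ m * Q ^ suc k) (1# - a * a * (Q * Q ^ m) * Q ^ suc k) (sq (1# - a * Q ^ suc k))
            (sq (1# - Q ^ suc (suc k))) (sq (1# - Q ^ suc k)) (1# - a * Q ^ m * Q ^ suc (suc k)) (1# - a * Q ^ m * Q ^ suc (suc (suc k))))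
          -- Two factors were opaque to the solver although each occurs in two bracketings: the
          -- extra Q belongs to Q^m in `β (suc m)` and to the power with exponent k in `A₂` and
          -- `B₂`.
          (*-congʳ (*-cong
            (*-congˡ (*-congˡ (*-congʳ (+-congˡ (-‿cong (solve 4 (λ a v q u → a :* a :* (q :* v) :* u := a :* a :* v :* (q :* u)) refl a (Q ^ m) Q (Q ^ suc k)))))))
            (*-congˡ (*-congˡ (*-congʳ (+-congˡ (-‿cong (solve 4 (λ a v q u → a :* v :* (q :* u) := a :* (q :* v) :* u) refl a (Q ^ m) Q (Q ^ suc (suc k)))))))))))

      c₁ c₂ κ : ℕ → Carrier
      c₁ m = a * (1# - a * Q ^ m) * (1# - Q * Q ^ m)
      c₂ m = (1# - a * Q ^ m * Q) * (1# - a * a * Q ^ m)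
      κ m = (1# - a * a * Q * Q ^ m * Q ^ m) * sq (1# - a)

      -- Once both values of β and C m (k+1) are expressed through C m k, what remains is a
      -- polynomial identity in a, Q, u = Q^(k+1) and v = Q^m.
      telescope-step : ∀ m k → c₁ m * F (suc m) (suc k) - c₂ m * F m (suc k) ≈ - (κ m * C m (suc k)) + κ m * C m k
      telescope-step m k = unit-cancel (unit-denC m k) (begin
        U * (c₁ m * F (suc m) (suc k) - c₂ m * F m (suc k))
          ≈⟨ solve 12 (λ a av v u q w s t x b′ b 1-a²v →
               a :* (s :* (t :* x)) :* (a :* av :* (:1 :- q :* v) :* (w :* b′) :- (:1 :- a :* v :* q) :* 1-a²v :* (w :* b))
               := w :* (a :* x :* (:1 :- q :* v) :* (b′ :* (a :* av :* (t :* s))) :- 1-a²v :* t :* (b :* (a :* (s :* ((:1 :- a :* v :* q) :* x))))))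
               refl a (1# - a * v) v u Q w (sq (1# - u)) (1# - a * v * Q ^ suc (suc k)) (u - a * v) (β (suc m) (suc k)) (β m (suc k)) (1# - a * a * v) ⟩
        w * (a * (u - a * v) * (1# - Q * v) * (β (suc m) (suc k) * A₂ m k) - (1# - a * a * v) * (1# - a * v * Q ^ suc (suc k)) * (β m (suc k) * A₁ m k))
          ≈⟨ *-congˡ (+-cong (*-congˡ (β′-C m k)) (-‿cong (*-congˡ (β-C m k)))) ⟩
        w * (a * (u - a * v) * (1# - Q * v) * (C m k * B₂ m k) - (1# - a * a * v) * (1# - a * v * Q ^ suc (suc k)) * (C m k * B₁ m k))
          ≈⟨ solve 6 (λ a v u q c s →
               (:1 :- a :* u :* u) :* (a :* (u :- a :* v) :* (:1 :- q :* v) :* (c :* (s :* ((:1 :- a :* a :* v :* u) :* (:1 :- q :* v)))) :- (:1 :- a :* a :* v) :* (:1 :- a :* v :* (q :* u)) :* (c :* (s :* ((:1 :- a :* a :* v) :* (u :- q :* v)))))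
               := :- ((:1 :- a :* a :* q :* v :* v) :* s :* (c :* ((:1 :- a :* u) :* (:1 :- a :* u) :* ((:1 :- a :* a :* v :* u) :* (u :- q :* v))))) :+ (a :* ((:1 :- u) :* (:1 :- u) :* ((:1 :- a :* v :* (q :* u)) :* (u :- a :* v)))) :* ((:1 :- a :* a :* q :* v :* v) :* s :* c))
               refl a v u Q (C m k) (sq (1# - a)) ⟩
        - (κ m * (C m k * numC m k)) + U * (κ m * C m k)
          ≈⟨ +-congʳ (-‿cong (*-congˡ (C-suc m k))) ⟨
        - (κ m * (C m (suc k) * U)) + U * (κ m * C m k)
          ≈⟨ solve 4 (λ k c u d → :- (k :* (c :* u)) :+ u :* (k :* d) := u :* (:- (k :* c) :+ k :* d)) refl (κ m) (C m (suc k)) U (C m k) ⟩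
        U * (- (κ m * C m (suc k)) + κ m * C m k) ∎)
        where
        u = Q ^ suc k
        v = Q ^ m
        w = 1# - a * Q ^ suc k * Q ^ suc k
        U = denC m k

      telescope : ∀ m k → c₁ m * sum (suc k) (F (suc m)) - c₂ m * sum (suc k) (F m) ≈ - (κ m * C m k)
      telescope m zero = solve 3 (λ a q v →
        a :* (:1 :- a :* v) :* (:1 :- q :* v) :* (con (ℤ.+ 0) :+ (:1 :- a :* :1 :* :1) :* :1) :- (:1 :- a :* v :* q) :* (:1 :- a :* a :* v) :* (con (ℤ.+ 0) :+ (:1 :- a :* :1 :* :1) :* :1)
        := :- ((:1 :- a :* a :* q :* v :* v) :* ((:1 :- a) :* (:1 :- a)) :* :1)) refl a Q (Q ^ m)
      telescope m (suc k) = begin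
        c₁ m * (sum (suc k) (F (suc m)) + F (suc m) (suc k)) - c₂ m * (sum (suc k) (F m) + F m (suc k))
          ≈⟨ solve 6 (λ c d s f t g → c :* (s :+ f) :- d :* (t :+ g) := (c :* s :- d :* t) :+ (c :* f :- d :* g)) refl (c₁ m) (c₂ m) _ _ _ _ ⟩
        (c₁ m * sum (suc k) (F (suc m)) - c₂ m * sum (suc k) (F m)) + (c₁ m * F (suc m) (suc k) - c₂ m * F m (suc k))
          ≈⟨ +-cong (telescope m k) (telescope-step m k) ⟩
        - (κ m * C m k) + (- (κ m * C m (suc k)) + κ m * C m k)
          ≈⟨ solve 2 (λ x y → :- x :+ (:- y :+ x) := :- y) refl _ _ ⟩
        - (κ m * C m (suc k)) ∎

    -- Induction on m with K fixed, so that both sums of the recurrence have the same range. For K >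
    -- m the certificate `C m K` is 0, since its factor at i = m is, and the recurrence becomes
    -- c₁(m) S(m+1) = c₂(m) S(m). The closed form is the product of these quotients, multiplied out.
    sum-F : ∀ m K → m ℕ.≤ K →
      sum (suc K) (F m) * (a ^ m * prod m (λ j → 1# - Q ^ suc j)) ≈ (1# - a * Q ^ m) * prod m (λ j → 1# - a * a * Q ^ j)
    sum-F zero K _ = begin
      sum (suc K) (F 0) * (1# * 1#)     ≈⟨ *-congʳ (trans (sum-suc K (F 0)) (+-congˡ (sum-zero K (λ i _ → trans (*-congˡ (β-vanishes 0 (suc i) (ℕ.s≤s ℕ.z≤n))) (zeroʳ _))))) ⟩
      (F 0 0 + 0#) * (1# * 1#)          ≈⟨ solve 1 (λ a → ((:1 :- a :* :1 :* :1) :* :1 :+ con (ℤ.+ 0)) :* (:1 :* :1) := (:1 :- a :* :1) :* :1) refl a ⟩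
      (1# - a * 1#) * 1#                ∎
    sum-F (suc m) K m<K = unit-cancel (unit-1-aQ m) (begin
      (1# - a * v) * (S′ * (a * a ^ m * (P * (1# - Q * v))))
        ≈⟨ solve 6 (λ a v q s t p → (:1 :- a :* v) :* (s :* (a :* t :* (p :* (:1 :- q :* v)))) := a :* (:1 :- a :* v) :* (:1 :- q :* v) :* s :* (t :* p)) refl a v Q S′ (a ^ m) P ⟩
      c₁ m * S′ * (a ^ m * P)
        ≈⟨ *-congʳ (-≈0⇒≈ (trans (telescope m K) (trans (-‿cong (trans (*-congˡ (C-vanishes m K m<K)) (zeroʳ _))) -0#≈0#))) ⟩
      c₂ m * S * (a ^ m * P)
        ≈⟨ *-assoc (c₂ m) S _ ⟩
      c₂ m * (S * (a ^ m * P))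
        ≈⟨ *-congˡ (sum-F m K (ℕₚ.<⇒≤ m<K)) ⟩
      c₂ m * ((1# - a * v) * N)
        ≈⟨ solve 4 (λ a v q n → (:1 :- a :* v :* q) :* (:1 :- a :* a :* v) :* ((:1 :- a :* v) :* n) := (:1 :- a :* v) :* ((:1 :- a :* (q :* v)) :* (n :* (:1 :- a :* a :* v)))) refl a v Q N ⟩
      (1# - a * v) * ((1# - a * (Q * v)) * (N * (1# - a * a * v))) ∎)
      where
      v = Q ^ m
      S′ = sum (suc K) (F (suc m))
      S = sum (suc K) (F m)
      P = prod m (λ j → 1# - Q ^ suc j)
      N = prod m (λ j → 1# - a * a * Q ^ j)

-- The summand at a root of unity

module Summand (R : Ring₀) (q x : CommutativeRing.Carrier R) where
  open RingTheory R
  open import Relation.Binary.Reasoning.Setoid setoid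

  sq : Carrier → Carrier
  sq y = y * y

  Q : Carrier
  Q = q ^ 4

  -- The last bracket is x(1 - w/x). The extra x occurs in `num` and in `den` alike, so the term
  -- ratio is unchanged and no inverse of x enters.
  factor : Carrier → Carrier
  factor w = sq (1# - w) * ((1# - x * w) * (x - w))

  num den : ℕ → Carrier
  num j = q ^ 2 * factor (q * Q ^ j)
  den j = factor (Q ^ suc j)

  -- The inverses are a parameter because their supply differs: in the fraction field every `den j`
  -- is invertible, at a root of unity of order d only those with j + 1 < d.
  module _ (den⁻¹ : ℕ → Carrier) where

    β α : ℕ → Carrier
    β k = prod k (λ j → num j * den⁻¹ j)
    α k = [ 8 ℕ.* k ℕ.+ 1 ] q * β k

  Q^ : ∀ j → Q ^ j ≈ q ^ (4 ℕ.* j)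
  Q^ j = ^-assocʳ q 4 j

  q*Q^ : ∀ j → q * Q ^ j ≈ q ^ (4 ℕ.* j ℕ.+ 1)
  q*Q^ j = trans (*-congˡ (Q^ j)) (^-≡ q (≡.sym (ℕₚ.+-comm (4 ℕ.* j) 1)))

  factor-cong : ∀ {w w′} → w ≈ w′ → factor w ≈ factor w′
  factor-cong p = *-cong (*-cong e e) (*-cong (+-congˡ (-‿cong (*-congˡ p))) (+-congˡ (-‿cong p)))
    where e = +-congˡ (-‿cong p)

  -- Up to the factor 1 - q this q-integer is the very-well-poised factor 1 - aQ^(2k) for a = q.
  [8k+1] : ∀ k → (1# - q) * [ 8 ℕ.* k ℕ.+ 1 ] q ≈ 1# - q * Q ^ k * Q ^ k
  [8k+1] k = trans (geometric q (8 ℕ.* k ℕ.+ 1)) (+-congˡ (-‿cong (sym (begin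
    q * Q ^ k * Q ^ k                      ≈⟨ *-cong (q*Q^ k) (Q^ k) ⟩
    q ^ (4 ℕ.* k ℕ.+ 1) * q ^ (4 ℕ.* k)    ≈⟨ ^-homo-* q (4 ℕ.* k ℕ.+ 1) (4 ℕ.* k) ⟨
    q ^ (4 ℕ.* k ℕ.+ 1 ℕ.+ 4 ℕ.* k)        ≈⟨ ^-≡ q (ℕS.solve 1 (λ k → ℕS.con 4 ℕS.:* k ℕS.:+ ℕS.con 1 ℕS.:+ ℕS.con 4 ℕS.:* k ℕS.:= ℕS.con 8 ℕS.:* k ℕS.:+ ℕS.con 1) ≡.refl k) ⟩
    q ^ (8 ℕ.* k ℕ.+ 1)                    ∎))))

-- Antisymmetry of the summand at a primitive root of unity

module AtRootOfUnity (R : Ring₀) where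
  open RingTheory R

  module Sums (q x : Carrier) (m : ℕ)
    (0<m : 0 ℕ.< m)
    (q^d≈1 : q ^ suc (4 ℕ.* m) ≈ 1#)
    (unit-1-q^ : ∀ i → suc i ℕ.< suc (4 ℕ.* m) → Unit (1# - q ^ suc i))
    (unit-1-x^d : Unit (1# - x ^ suc (4 ℕ.* m)))
    (unit-2 : Unit (1# + 1#)) where

    private
      d : ℕ
      d = suc (4 ℕ.* m)

    open import Relation.Binary.Reasoning.Setoid setoid
    open Summand R q x

    unit-q : Unit q
    unit-q = _ , q^d≈1

    reduce : ∀ A c → q ^ (A ℕ.+ d ℕ.* c) ≈ q ^ A
    reduce A c = begin
      q ^ (A ℕ.+ d ℕ.* c)      ≈⟨ ^-homo-* q A (d ℕ.* c) ⟩
      q ^ A * q ^ (d ℕ.* c)    ≈⟨ *-congˡ (^-assocʳ q d c) ⟨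
      q ^ A * (q ^ d) ^ c      ≈⟨ *-congˡ (trans (^-congˡ c q^d≈1) (1^ c)) ⟩
      q ^ A * 1#               ≈⟨ *-identityʳ _ ⟩
      q ^ A                    ∎

    qQ^m≈1 : q * Q ^ m ≈ 1#
    qQ^m≈1 = trans (q*Q^ m) (trans (^-≡ q (ℕₚ.+-comm (4 ℕ.* m) 1)) q^d≈1)

    Q^^d : ∀ j → (Q ^ j) ^ d ≈ 1#
    Q^^d j = begin
      (Q ^ j) ^ d               ≈⟨ ^-congˡ d (Q^ j) ⟩
      (q ^ (4 ℕ.* j)) ^ d       ≈⟨ ^-assocʳ q (4 ℕ.* j) d ⟩
      q ^ (4 ℕ.* j ℕ.* d)       ≈⟨ ^-≡ q (ℕₚ.*-comm (4 ℕ.* j) d) ⟩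
      q ^ (d ℕ.* (4 ℕ.* j))     ≈⟨ reduce 0 (4 ℕ.* j) ⟩
      1#                        ∎

    -- 4(3m+1) = 3d+1, so 1 - q^i is a multiple of 1 - q^(4i).
    unit-1-Q^ : ∀ j → suc j ℕ.< d → Unit (1# - Q ^ suc j)
    unit-1-Q^ j j<d = unit-∣ (1-y∣1-y^ (Q ^ suc j) (3 ℕ.* m ℕ.+ 1)) (unit-cong (+-congˡ (-‿cong (sym (begin
      (Q ^ suc j) ^ (3 ℕ.* m ℕ.+ 1)                ≈⟨ ^-congˡ (3 ℕ.* m ℕ.+ 1) (Q^ (suc j)) ⟩
      (q ^ (4 ℕ.* suc j)) ^ (3 ℕ.* m ℕ.+ 1)        ≈⟨ ^-assocʳ q (4 ℕ.* suc j) (3 ℕ.* m ℕ.+ 1) ⟩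
      q ^ (4 ℕ.* suc j ℕ.* (3 ℕ.* m ℕ.+ 1))        ≈⟨ ^-≡ q (ℕS.solve 2 (λ j m → ℕS.con 4 ℕS.:* j ℕS.:* (ℕS.con 3 ℕS.:* m ℕS.:+ ℕS.con 1)
                                                        ℕS.:= j ℕS.:+ (ℕS.con 1 ℕS.:+ ℕS.con 4 ℕS.:* m) ℕS.:* (ℕS.con 3 ℕS.:* j)) ≡.refl (suc j) m) ⟩
      q ^ (suc j ℕ.+ d ℕ.* (3 ℕ.* suc j))          ≈⟨ reduce (suc j) (3 ℕ.* suc j) ⟩
      q ^ suc j                                    ∎)))) (unit-1-q^ j j<d))

    -- 1 - xW divides 1 - (xW)^d, which is the unit 1 - x^d.
    unit-1-xW : ∀ {W} → W ^ d ≈ 1# → Unit (1# - x * W)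
    unit-1-xW {W} W^d≈1 = unit-∣ (1-y∣1-y^ (x * W) d) (unit-cong (+-congˡ (-‿cong (sym
      (trans (^-distrib-* x W d) (trans (*-congˡ W^d≈1) (*-identityʳ _)))))) unit-1-x^d)

    unit-x-W : ∀ {W} → W ^ d ≈ 1# → Unit (x - W)
    unit-x-W {W} W^d≈1 = unit-cong (begin
      - W * (1# - x * W′)        ≈⟨ solve 3 (λ w x w′ → :- w :* (:1 :- x :* w′) := x :* (w :* w′) :- w) refl W x W′ ⟩
      x * (W * W′) - W           ≈⟨ +-congʳ (trans (*-congˡ W^d≈1) (*-identityʳ x)) ⟩
      x - W                      ∎) (unit-* (unit-neg (W′ , W^d≈1)) (unit-1-xW W′^d≈1))
      where
      -- The exponent is d - 1, so this is the inverse of W, and x - W = -W (1 - x W′).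
      W′ = W ^ (4 ℕ.* m)
      W′^d≈1 : W′ ^ d ≈ 1#
      W′^d≈1 = begin
        W′ ^ d                     ≈⟨ ^-assocʳ W (4 ℕ.* m) d ⟩
        W ^ (4 ℕ.* m ℕ.* d)        ≈⟨ ^-≡ W (ℕₚ.*-comm (4 ℕ.* m) d) ⟩
        W ^ (d ℕ.* (4 ℕ.* m))      ≈⟨ ^-assocʳ W d (4 ℕ.* m) ⟨
        (W ^ d) ^ (4 ℕ.* m)        ≈⟨ trans (^-congˡ (4 ℕ.* m) W^d≈1) (1^ (4 ℕ.* m)) ⟩
        1#                         ∎

    unit-den : ∀ j → suc j ℕ.< d → Unit (den j)
    unit-den j j<d = unit-* (unit-* u u) (unit-* (unit-1-xW (Q^^d (suc j))) (unit-x-W (Q^^d (suc j))))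
      where u = unit-1-Q^ j j<d

    unit-1-q : Unit (1# - q)
    unit-1-q = unit-cong (+-congˡ (-‿cong (*-identityʳ q))) (unit-1-q^ 0 (ℕ.s≤s (ℕₚ.*-mono-≤ {1} {4} (ℕ.s≤s ℕ.z≤n) 0<m)))

    num-m≈0 : num m ≈ 0#
    num-m≈0 = trans (*-congˡ (trans (*-congʳ (trans (*-congʳ (≈⇒-≈0 (sym qQ^m≈1))) (zeroˡ _))) (zeroˡ _))) (zeroʳ _)

    module _ (den⁻¹ : ℕ → Carrier) (inverse : ∀ j → suc j ℕ.< d → den j * den⁻¹ j ≈ 1#) where

      β-vanishes : ∀ k → m ℕ.< k → β den⁻¹ k ≈ 0#
      β-vanishes (suc k) m<1+k with ℕₚ.m≤n⇒m<n∨m≡n (ℕₚ.≤-pred m<1+k)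
      ... | inj₁ m<k = trans (*-congʳ (β-vanishes k m<k)) (zeroˡ _)
      ... | inj₂ ≡.refl = trans (*-congˡ (trans (*-congʳ num-m≈0) (zeroˡ _))) (zeroʳ _)

      private
        -- The reflection w ↔ 1/w turns `num j` into `den (m-1-j)` times a power of q. Hence β(k) =
        -- ψ(k) H(m) / (H(k) H(m-k)), where ψ collects the powers of q and the denominator is
        -- symmetric under k ↔ m-k.
        H P ψ : ℕ → Carrier
        H k = prod k den
        P k = prod k num
        ψ k = prod k (λ j → q ^ 2 * (q * Q ^ j) ^ 4)

        m<d : m ℕ.< d
        m<d = ℕ.s≤s (ℕₚ.m≤n*m m 4)

        unit-H : ∀ k → k ℕ.≤ m → Unit (H k)
        unit-H k k≤m = prod-unit k (λ i i<k → unit-den i (ℕₚ.≤-<-trans i<k (ℕₚ.≤-<-trans k≤m m<d)))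

        β-H : ∀ k → k ℕ.≤ m → β den⁻¹ k * H k ≈ P k
        β-H k k≤m = trans (sym (prod-* k _ den)) (prod-cong k (λ j j<k → begin
          num j * den⁻¹ j * den j      ≈⟨ solve 3 (λ n i d → n :* i :* d := n :* (d :* i)) refl _ _ _ ⟩
          num j * (den j * den⁻¹ j)    ≈⟨ *-congˡ (inverse j (ℕₚ.≤-<-trans j<k (ℕₚ.≤-<-trans k≤m m<d))) ⟩
          num j * 1#                   ≈⟨ *-identityʳ _ ⟩
          num j                        ∎))

        -- As a polynomial of degree 4 in w, `factor` is palindromic. In the proof each 1 is
        -- replaced by wW so that w can be taken out of every bracket.
        factor-reflect : ∀ {w W} → w * W ≈ 1# → factor w ≈ w ^ 4 * factor W
        factor-reflect {w} {W} wW≈1 = begin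
          factor w
            ≈⟨ solve 2 (λ w x → (:1 :- w) :* (:1 :- w) :* ((:1 :- x :* w) :* (x :- w)) := (w :- :1) :* (w :- :1) :* ((w :- x :* :1) :* (x :* w :- :1))) refl w x ⟩
          (w - 1#) * (w - 1#) * ((w - x * 1#) * (x * w - 1#))
            ≈⟨ *-cong (*-cong w-1 w-1) (*-cong (+-congˡ (-‿cong (*-congˡ (sym wW≈1)))) (+-congˡ (-‿cong (sym wW≈1)))) ⟩
          (w - w * W) * (w - w * W) * ((w - x * (w * W)) * (x * w - w * W))
            ≈⟨ solve 3 (λ w x W → (w :- w :* W) :* (w :- w :* W) :* ((w :- x :* (w :* W)) :* (x :* w :- w :* W)) := w :^ 4 :* ((:1 :- W) :* (:1 :- W) :* ((:1 :- x :* W) :* (x :- W)))) refl w x W ⟩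
          w ^ 4 * factor W ∎
          where
          w-1 : w - 1# ≈ w - w * W
          w-1 = +-congˡ (-‿cong (sym wW≈1))

        num-den : ∀ j r → j ℕ.+ suc r ≡ m → num j ≈ q ^ 2 * (q * Q ^ j) ^ 4 * den r
        num-den j r e = trans (*-congˡ (factor-reflect wW≈1)) (sym (*-assoc _ _ _))
          where
          wW≈1 : q * Q ^ j * Q ^ suc r ≈ 1#
          wW≈1 = trans (*-assoc _ _ _) (trans (*-congˡ (trans (sym (^-homo-* Q j (suc r))) (^-≡ Q e))) qQ^m≈1)

        P-H : ∀ k r → k ℕ.+ r ≡ m → P k * H r ≈ ψ k * H m
        P-H zero r ≡.refl = refl
        P-H (suc k) r e = begin
          P k * num k * H r                                      ≈⟨ *-congʳ (*-congˡ (num-den k r e′)) ⟩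
          P k * (q ^ 2 * (q * Q ^ k) ^ 4 * den r) * H r          ≈⟨ solve 4 (λ p s d h → p :* (s :* d) :* h := p :* (h :* d) :* s) refl (P k) _ (den r) (H r) ⟩
          P k * H (suc r) * (q ^ 2 * (q * Q ^ k) ^ 4)            ≈⟨ *-congʳ (P-H k (suc r) e′) ⟩
          ψ k * H m * (q ^ 2 * (q * Q ^ k) ^ 4)                  ≈⟨ solve 3 (λ p h s → p :* h :* s := p :* s :* h) refl (ψ k) (H m) _ ⟩
          ψ k * (q ^ 2 * (q * Q ^ k) ^ 4) * H m                  ∎
          where
          e′ : k ℕ.+ suc r ≡ m
          e′ = ≡.trans (ℕₚ.+-suc k r) e

        -- The exponent of q in ψ(k) is the sum of 16j + 6 over j < k, that is 8k² - 2k; the factor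
        -- q^(2k) avoids the subtraction.
        ψ-q : ∀ k → ψ k * q ^ (2 ℕ.* k) ≈ q ^ (8 ℕ.* (k ℕ.* k))
        ψ-q zero = *-identityʳ 1#
        ψ-q (suc k) = begin
          ψ k * (q ^ 2 * (q * Q ^ k) ^ 4) * q ^ (2 ℕ.* suc k)
            ≈⟨ *-cong (*-congˡ (*-congˡ (trans (^-congˡ 4 (q*Q^ k)) (^-assocʳ q (4 ℕ.* k ℕ.+ 1) 4)))) (^-≡ q (≡.trans (ℕₚ.*-comm 2 (suc k)) (≡.cong (2 ℕ.+_) (ℕₚ.*-comm k 2)))) ⟩
          ψ k * (q ^ 2 * q ^ ((4 ℕ.* k ℕ.+ 1) ℕ.* 4)) * q ^ (2 ℕ.+ 2 ℕ.* k)
            ≈⟨ *-cong (*-congˡ (sym (^-homo-* q 2 ((4 ℕ.* k ℕ.+ 1) ℕ.* 4)))) (^-homo-* q 2 (2 ℕ.* k)) ⟩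
          ψ k * q ^ (2 ℕ.+ (4 ℕ.* k ℕ.+ 1) ℕ.* 4) * (q ^ 2 * q ^ (2 ℕ.* k))
            ≈⟨ solve 4 (λ p s t r → p :* s :* (t :* r) := p :* r :* (t :* s)) refl _ _ _ _ ⟩
          ψ k * q ^ (2 ℕ.* k) * (q ^ 2 * q ^ (2 ℕ.+ (4 ℕ.* k ℕ.+ 1) ℕ.* 4))
            ≈⟨ *-cong (ψ-q k) (sym (^-homo-* q 2 (2 ℕ.+ (4 ℕ.* k ℕ.+ 1) ℕ.* 4))) ⟩
          q ^ (8 ℕ.* (k ℕ.* k)) * q ^ (2 ℕ.+ (2 ℕ.+ (4 ℕ.* k ℕ.+ 1) ℕ.* 4))
            ≈⟨ ^-homo-* q (8 ℕ.* (k ℕ.* k)) _ ⟨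
          q ^ (8 ℕ.* (k ℕ.* k) ℕ.+ (2 ℕ.+ (2 ℕ.+ (4 ℕ.* k ℕ.+ 1) ℕ.* 4)))
            ≈⟨ ^-≡ q (ℕS.solve 1 (λ k → ℕS.con 8 ℕS.:* (k ℕS.:* k) ℕS.:+ (ℕS.con 2 ℕS.:+ (ℕS.con 2 ℕS.:+ (ℕS.con 4 ℕS.:* k ℕS.:+ ℕS.con 1) ℕS.:* ℕS.con 4))
                 ℕS.:= ℕS.con 8 ℕS.:* ((ℕS.con 1 ℕS.:+ k) ℕS.:* (ℕS.con 1 ℕS.:+ k))) ≡.refl k) ⟩
          q ^ (8 ℕ.* (suc k ℕ.* suc k)) ∎

        -- Since 4m is -1 modulo d, the exponents 8r² - 2r and (8k² - 2k) + (8k + 1) are congruent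
        -- modulo d for r = m - k.
        ψ-reflect : ∀ k r → k ℕ.+ r ≡ m → ψ r ≈ ψ k * q ^ (8 ℕ.* k ℕ.+ 1)
        ψ-reflect k r e = unit-cancel (unit-* (unit-^ (2 ℕ.* k) unit-q) (unit-^ (2 ℕ.* r) unit-q)) (begin
          q ^ (2 ℕ.* k) * q ^ (2 ℕ.* r) * ψ r
            ≈⟨ solve 3 (λ a b c → a :* b :* c := c :* b :* a) refl _ _ _ ⟩
          ψ r * q ^ (2 ℕ.* r) * q ^ (2 ℕ.* k)
            ≈⟨ trans (*-congʳ (ψ-q r)) (sym (^-homo-* q (8 ℕ.* (r ℕ.* r)) (2 ℕ.* k))) ⟩
          q ^ (8 ℕ.* (r ℕ.* r) ℕ.+ 2 ℕ.* k)
            -- Adding 2k + 1 and 2r multiples of d to the two exponents makes them equal as natural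
            -- numbers.
            ≈⟨ reduce (8 ℕ.* (r ℕ.* r) ℕ.+ 2 ℕ.* k) (2 ℕ.* k ℕ.+ 1) ⟨
          q ^ (8 ℕ.* (r ℕ.* r) ℕ.+ 2 ℕ.* k ℕ.+ d ℕ.* (2 ℕ.* k ℕ.+ 1))
            ≈⟨ ^-≡ q exponents ⟩
          q ^ (8 ℕ.* (k ℕ.* k) ℕ.+ (8 ℕ.* k ℕ.+ 1 ℕ.+ 2 ℕ.* r) ℕ.+ d ℕ.* (2 ℕ.* r))
            ≈⟨ reduce (8 ℕ.* (k ℕ.* k) ℕ.+ (8 ℕ.* k ℕ.+ 1 ℕ.+ 2 ℕ.* r)) (2 ℕ.* r) ⟩
          q ^ (8 ℕ.* (k ℕ.* k) ℕ.+ (8 ℕ.* k ℕ.+ 1 ℕ.+ 2 ℕ.* r))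
            ≈⟨ trans (^-homo-* q (8 ℕ.* (k ℕ.* k)) _) (*-cong (sym (ψ-q k)) (^-homo-* q (8 ℕ.* k ℕ.+ 1) (2 ℕ.* r))) ⟩
          ψ k * q ^ (2 ℕ.* k) * (q ^ (8 ℕ.* k ℕ.+ 1) * q ^ (2 ℕ.* r))
            ≈⟨ solve 4 (λ a b c d → a :* b :* (c :* d) := b :* d :* (a :* c)) refl _ _ _ _ ⟩
          q ^ (2 ℕ.* k) * q ^ (2 ℕ.* r) * (ψ k * q ^ (8 ℕ.* k ℕ.+ 1)) ∎)
          where
          exponents : 8 ℕ.* (r ℕ.* r) ℕ.+ 2 ℕ.* k ℕ.+ d ℕ.* (2 ℕ.* k ℕ.+ 1) ≡ 8 ℕ.* (k ℕ.* k) ℕ.+ (8 ℕ.* k ℕ.+ 1 ℕ.+ 2 ℕ.* r) ℕ.+ d ℕ.* (2 ℕ.* r)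
          exponents rewrite ≡.sym e = ℕS.solve 2 (λ k r → let d = ℕS.con 1 ℕS.:+ ℕS.con 4 ℕS.:* (k ℕS.:+ r) in
            ℕS.con 8 ℕS.:* (r ℕS.:* r) ℕS.:+ ℕS.con 2 ℕS.:* k ℕS.:+ d ℕS.:* (ℕS.con 2 ℕS.:* k ℕS.:+ ℕS.con 1)
            ℕS.:= ℕS.con 8 ℕS.:* (k ℕS.:* k) ℕS.:+ (ℕS.con 8 ℕS.:* k ℕS.:+ ℕS.con 1 ℕS.:+ ℕS.con 2 ℕS.:* r) ℕS.:+ d ℕS.:* (ℕS.con 2 ℕS.:* r)) ≡.refl k r

        -- The q-integer provides 1 - q^(8k+1), and ψ(k) q^(8k+1) = ψ(r). Exchanging k and r now
        -- visibly changes the sign on the right and nothing on the left except the argument of α.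
        α-normal : ∀ k r → k ℕ.+ r ≡ m → (1# - q) * (H k * H r) * α den⁻¹ k ≈ (ψ k - ψ r) * H m
        α-normal k r e = begin
          (1# - q) * (H k * H r) * ([ 8 ℕ.* k ℕ.+ 1 ] q * β den⁻¹ k)
            ≈⟨ solve 5 (λ c h i t b → c :* (h :* i) :* (t :* b) := c :* t :* (b :* h :* i)) refl (1# - q) (H k) (H r) _ _ ⟩
          (1# - q) * [ 8 ℕ.* k ℕ.+ 1 ] q * (β den⁻¹ k * H k * H r)
            ≈⟨ *-cong (geometric q (8 ℕ.* k ℕ.+ 1)) (trans (*-congʳ (β-H k (≡.subst (k ℕ.≤_) e (ℕₚ.m≤m+n k r)))) (P-H k r e)) ⟩
          (1# - q ^ (8 ℕ.* k ℕ.+ 1)) * (ψ k * H m)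
            ≈⟨ solve 3 (λ t p h → (:1 :- t) :* (p :* h) := (p :- p :* t) :* h) refl _ (ψ k) (H m) ⟩
          (ψ k - ψ k * q ^ (8 ℕ.* k ℕ.+ 1)) * H m
            ≈⟨ *-congʳ (+-congˡ (-‿cong (ψ-reflect k r e))) ⟨
          (ψ k - ψ r) * H m ∎

      α-antisymmetric : ∀ k r → k ℕ.+ r ≡ m → α den⁻¹ k ≈ - α den⁻¹ r
      α-antisymmetric k r e = unit-cancel (unit-* unit-1-q (unit-* (unit-H k (≡.subst (k ℕ.≤_) e (ℕₚ.m≤m+n k r))) (unit-H r (≡.subst (r ℕ.≤_) e (ℕₚ.m≤n+m r k))))) (begin
        (1# - q) * (H k * H r) * α den⁻¹ k       ≈⟨ α-normal k r e ⟩
        (ψ k - ψ r) * H m                        ≈⟨ solve 3 (λ a b h → (a :- b) :* h := :- ((b :- a) :* h)) refl (ψ k) (ψ r) (H m) ⟩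
        - ((ψ r - ψ k) * H m)                    ≈⟨ -‿cong (α-normal r k (≡.trans (ℕₚ.+-comm r k) e)) ⟨
        - ((1# - q) * (H r * H k) * α den⁻¹ r)   ≈⟨ solve 4 (λ c h i a → :- (c :* (h :* i) :* a) := c :* (i :* h) :* :- a) refl (1# - q) (H r) (H k) _ ⟩
        (1# - q) * (H k * H r) * - α den⁻¹ r     ∎)

      -- Reversing the order of summation changes the sign of the sum, and 2 is a unit.
      sum-α : sum (suc m) (α den⁻¹) ≈ 0#
      sum-α = unit⇒regular unit-2 _ (begin
        (1# + 1#) * S      ≈⟨ solve 1 (λ s → (:1 :+ :1) :* s := s :+ s) refl S ⟩
        S + S              ≈⟨ +-congʳ (sum-reverse (suc m) (α den⁻¹) (λ j → - α den⁻¹ j) (λ i j e → α-antisymmetric i j (ℕₚ.suc-injective e))) ⟩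
        sum (suc m) (λ j → - α den⁻¹ j) + S   ≈⟨ sum-+ (suc m) (λ j → - α den⁻¹ j) (α den⁻¹) ⟨
        sum (suc m) (λ j → - α den⁻¹ j + α den⁻¹ j)   ≈⟨ sum-zero (suc m) (λ i _ → -‿inverseˡ _) ⟩
        0#                 ∎)
        where S = sum (suc m) (α den⁻¹)

      sum-α-d : sum d (α den⁻¹) ≈ 0#
      sum-α-d = trans (sum-append (suc m) (3 ℕ.* m) (α den⁻¹)) (trans (+-cong sum-α
        (sum-zero (3 ℕ.* m) (λ i _ → trans (*-congˡ (β-vanishes (suc m ℕ.+ i) (ℕ.s≤s (ℕₚ.m≤m+n m i)))) (zeroʳ _)))) (+-identityˡ 0#))

-- Specialisation of fractions

4a≢4b+1 : ∀ a b → 4 ℕ.* a ≢ 4 ℕ.* b ℕ.+ 1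
4a≢4b+1 a b e with ≡.trans (≡.sym (≡.trans (≡.cong (ℕ._% 4) (ℕₚ.*-comm 4 a)) (ℕ.m*n%n≡0 a 4)))
  (≡.trans (≡.cong (ℕ._% 4) (≡.trans e (≡.trans (ℕₚ.+-comm (4 ℕ.* b) 1) (≡.cong suc (ℕₚ.*-comm 4 b))))) (ℕ.[m+kn]%n≡m%n 1 b 4))
... | ()

-- The sum of α at x = q^n and at x = q^(-n)

module AtPower (R : Ring₀) where
  open RingTheory R

  -- The last hypothesis covers both cases: for x = q^n take y = x and κ = 1; for x = q^(-n) take y
  -- = q^n = 1/x and κ = x², because (1 - xw)(x - w) is invariant under x ↔ 1/x up to x².
  module Sums (q x y κ : Carrier) (m : ℕ)
    (unit-q : Unit q)
    (unit-1-q^ : ∀ i → Unit (1# - q ^ suc i))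
    (unit-κ : Unit κ)
    (y-power : y ≈ q * (q ^ 4) ^ m)
    (x-y : ∀ w → (1# - x * w) * (x - w) ≈ κ * ((1# - y * w) * (y - w))) where

    open Summand R q x

    open import Relation.Binary.Reasoning.Setoid setoid

    private
      unit-difference : ∀ i j → i ≢ j → Unit (q ^ i - q ^ j)
      unit-difference i j i≢j with ℕₚ.<-cmp i j
      ... | tri< i<j _ _ = below i j i<j
        where
        below : ∀ i j → i ℕ.< j → Unit (q ^ i - q ^ j)
        below i j i<j = let k = j ∸ suc i ; e = ≡.trans (ℕₚ.+-suc i k) (ℕₚ.m+[n∸m]≡n i<j) in
          unit-cong (trans (solve 2 (λ a b → a :* (:1 :- b) := a :- a :* b) refl (q ^ i) (q ^ suc k))
            (+-congˡ (-‿cong (trans (sym (^-homo-* q i (suc k))) (^-≡ q e)))))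
            (unit-* (unit-^ i unit-q) (unit-1-q^ k))
      ... | tri≈ _ i≡j _ = ⊥-elim (i≢j i≡j)
      ... | tri> _ _ j<i = let k = i ∸ suc j ; e = ≡.trans (ℕₚ.+-suc j k) (ℕₚ.m+[n∸m]≡n j<i) in
        unit-swap (unit-cong (trans (solve 2 (λ a b → a :* (:1 :- b) := a :- a :* b) refl (q ^ j) (q ^ suc k))
            (+-congˡ (-‿cong (trans (sym (^-homo-* q j (suc k))) (^-≡ q e)))))
            (unit-* (unit-^ j unit-q) (unit-1-q^ k)))

      unit-1-Q : ∀ k → Unit (1# - Q ^ suc k)
      unit-1-Q k = unit-cong (+-congˡ (-‿cong (trans (^-≡ q (≡.sym (ℕₚ.*-suc 4 k))) (sym (Q^ (suc k)))))) (unit-1-q^ (3 ℕ.+ 4 ℕ.* k))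

      unit-1-aQ : ∀ k → Unit (1# - q * Q ^ k)
      unit-1-aQ k = unit-cong (+-congˡ (-‿cong (*-congˡ (sym (Q^ k))))) (unit-1-q^ (4 ℕ.* k))

      unit-Q-aQ : ∀ j l → Unit (Q ^ suc j - q * Q ^ l)
      unit-Q-aQ j l = unit-cong (+-cong (sym (Q^ (suc j))) (-‿cong (sym (q*Q^ l)))) (unit-difference _ _ (4a≢4b+1 (suc j) l))

    open WellPoised.Sums R q Q unit-q unit-1-Q unit-1-aQ unit-Q-aQ using (sum-F; F; numerator; denominator; unit-denominator)
      renaming (β to β′; β-vanishes to β′-vanishes)

    private
      x-v : ∀ w → (1# - x * w) * (x - w) ≈ κ * ((1# - q * Q ^ m * w) * (q * Q ^ m - w))
      x-v w = trans (x-y w) (*-congˡ (*-cong (+-congˡ (-‿cong (*-congʳ y-power))) (+-congʳ y-power)))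

    unit-den : ∀ j → Unit (den j)
    unit-den j = unit-* (unit-* (unit-1-Q j) (unit-1-Q j)) (unit-cong (sym (x-v (Q ^ suc j))) (unit-* unit-κ
      (unit-* (unit-cong (+-congˡ (-‿cong (trans (*-congˡ (^-homo-* Q m (suc j))) (sym (*-assoc q _ _))))) (unit-1-aQ (m ℕ.+ suc j))) (unit-swap (unit-Q-aQ j m)))))

    module _ (den⁻¹ : ℕ → Carrier) (inverse : ∀ j → den j * den⁻¹ j ≈ 1#) where

      private
        quotients : ∀ {a b a′ b′ c d} → b * c ≈ 1# → b′ * d ≈ 1# → a * b′ ≈ a′ * b → a * c ≈ a′ * d
        quotients {a} {b} {a′} {b′} {c} {d} p r s = begin
          a * c                 ≈⟨ trans (*-congˡ r) (*-identityʳ _) ⟨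
          a * c * (b′ * d)      ≈⟨ solve 4 (λ a c b d → a :* c :* (b :* d) := a :* b :* (c :* d)) refl a c b′ d ⟩
          a * b′ * (c * d)      ≈⟨ *-congʳ s ⟩
          a′ * b * (c * d)      ≈⟨ solve 4 (λ a b c d → a :* b :* (c :* d) := a :* d :* (b :* c)) refl a′ b c d ⟩
          a′ * d * (b * c)      ≈⟨ trans (*-congˡ p) (*-identityʳ _) ⟩
          a′ * d                ∎

        -- Replacing x by y multiplies numerator and denominator of the term ratio by the same κ.
        -- With y = qQ^m the ratio is that of the ₆φ₅ series for a = q, up to signs that cancel.
        β-β′ : ∀ k → β den⁻¹ k ≈ β′ m k
        β-β′ k = prod-cong k (λ j _ → quotients (inverse j) (proj₂ (unit-denominator m j)) (begin
          num j * denominator m j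
            ≈⟨ *-congʳ (*-congˡ (*-congˡ (x-v (q * Q ^ j)))) ⟩
          q ^ 2 * (sq (1# - q * Q ^ j) * (κ * ((1# - q * Q ^ m * (q * Q ^ j)) * (q * Q ^ m - q * Q ^ j)))) * denominator m j
            ≈⟨ solve 7 (λ q v t W κ s s′ →
                 q :^ 2 :* (s :* (κ :* ((:1 :- q :* v :* (q :* t)) :* (q :* v :- q :* t)))) :* (q :* (s′ :* ((:1 :- q :* v :* W) :* (W :- q :* v))))
                 := q :^ 4 :* (s :* ((:1 :- q :* q :* v :* t) :* (t :- v))) :* (s′ :* (κ :* ((:1 :- q :* v :* W) :* (q :* v :- W)))))
                 refl q (Q ^ m) (Q ^ j) (Q ^ suc j) κ (sq (1# - q * Q ^ j)) (sq (1# - Q ^ suc j)) ⟩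
          numerator m j * (sq (1# - Q ^ suc j) * (κ * ((1# - q * Q ^ m * Q ^ suc j) * (q * Q ^ m - Q ^ suc j))))
            ≈⟨ *-congˡ (*-congˡ (x-v (Q ^ suc j))) ⟨
          numerator m j * den j ∎))

        α-F : ∀ k → (1# - q) * α den⁻¹ k ≈ F m k
        α-F k = trans (sym (*-assoc _ _ _)) (*-cong ([8k+1] k) (β-β′ k))

      α-vanishes : ∀ k → m ℕ.< k → α den⁻¹ k ≈ 0#
      α-vanishes k m<k = trans (*-congˡ (trans (β-β′ k) (β′-vanishes m k m<k))) (zeroʳ _)

      -- The ₆φ₅ evaluation for a = q. Its factor 1 - aQ^m is 1 - q^n = (1 - q)[n], and this 1 - q
      -- cancels the one relating α to `F`.
      sum-α : sum (suc m) (α den⁻¹) * (q ^ m * prod m (λ j → 1# - Q ^ suc j)) ≈ [ suc (4 ℕ.* m) ] q * prod m (λ j → 1# - q ^ 2 * Q ^ j)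
      sum-α = unit-cancel unit-1-q (begin
        (1# - q) * (sum (suc m) (α den⁻¹) * X)      ≈⟨ *-assoc _ _ _ ⟨
        (1# - q) * sum (suc m) (α den⁻¹) * X        ≈⟨ *-congʳ (trans (sym (sum-*ˡ (suc m) (1# - q) (α den⁻¹))) (sum-cong (suc m) (λ k _ → α-F k))) ⟩
        sum (suc m) (F m) * X                       ≈⟨ sum-F m m ℕₚ.≤-refl ⟩
        (1# - q * Q ^ m) * prod m (λ j → 1# - q * q * Q ^ j)
          ≈⟨ *-cong (trans (+-congˡ (-‿cong (*-congˡ (Q^ m)))) (sym (geometric q (suc (4 ℕ.* m)))))
                    (prod-cong m (λ j _ → +-congˡ (-‿cong (*-congʳ (*-congˡ (sym (*-identityʳ q))))))) ⟩
        (1# - q) * [ suc (4 ℕ.* m) ] q * prod m (λ j → 1# - q ^ 2 * Q ^ j)      ≈⟨ *-assoc _ _ _ ⟩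
        (1# - q) * ([ suc (4 ℕ.* m) ] q * prod m (λ j → 1# - q ^ 2 * Q ^ j))    ∎)
        where
        X = q ^ m * prod m (λ j → 1# - Q ^ suc j)
        unit-1-q : Unit (1# - q)
        unit-1-q = unit-cong (+-congˡ (-‿cong (*-identityʳ q))) (unit-1-q^ 0)

-- Throughout, z counts as a value of N/D in S when z ψ(D) = ψ(N). The rules hold before any
-- denominator is known to be invertible.
module Values {P S : Ring₀} (ψ : Hom P S) where
  private module P = RingTheory P
  open RingTheory S
  open HomTheory {P} {S} ψ
  open import Relation.Binary.Reasoning.Setoid setoid

  value-+ : ∀ {z w N D N′ D′} → z * ⟦ D ⟧ ≈ ⟦ N ⟧ → w * ⟦ D′ ⟧ ≈ ⟦ N′ ⟧ → (z + w) * ⟦ D P.* D′ ⟧ ≈ ⟦ N P.* D′ P.+ N′ P.* D ⟧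
  value-+ {z} {w} {N} {D} {N′} {D′} p r = begin
    (z + w) * ⟦ D P.* D′ ⟧                     ≈⟨ *-congˡ (*-homo D D′) ⟩
    (z + w) * (⟦ D ⟧ * ⟦ D′ ⟧)                 ≈⟨ solve 4 (λ z w d e → (z :+ w) :* (d :* e) := z :* d :* e :+ w :* e :* d) refl z w _ _ ⟩
    z * ⟦ D ⟧ * ⟦ D′ ⟧ + w * ⟦ D′ ⟧ * ⟦ D ⟧    ≈⟨ +-cong (trans (*-congʳ p) (sym (*-homo N D′))) (trans (*-congʳ r) (sym (*-homo N′ D))) ⟩
    ⟦ N P.* D′ ⟧ + ⟦ N′ P.* D ⟧                ≈⟨ +-homo _ _ ⟨
    ⟦ N P.* D′ P.+ N′ P.* D ⟧                  ∎

  value-* : ∀ {z w N D N′ D′} → z * ⟦ D ⟧ ≈ ⟦ N ⟧ → w * ⟦ D′ ⟧ ≈ ⟦ N′ ⟧ → z * w * ⟦ D P.* D′ ⟧ ≈ ⟦ N P.* N′ ⟧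
  value-* {z} {w} {N} {D} {N′} {D′} p r = begin
    z * w * ⟦ D P.* D′ ⟧              ≈⟨ *-congˡ (*-homo D D′) ⟩
    z * w * (⟦ D ⟧ * ⟦ D′ ⟧)          ≈⟨ solve 4 (λ z w d e → z :* w :* (d :* e) := z :* d :* (w :* e)) refl z w _ _ ⟩
    z * ⟦ D ⟧ * (w * ⟦ D′ ⟧)          ≈⟨ *-cong p r ⟩
    ⟦ N ⟧ * ⟦ N′ ⟧                    ≈⟨ *-homo N N′ ⟨
    ⟦ N P.* N′ ⟧                      ∎

  value-neg : ∀ {z N D} → z * ⟦ D ⟧ ≈ ⟦ N ⟧ → - z * ⟦ D ⟧ ≈ ⟦ P.- N ⟧
  value-neg {z} {N} {D} p = begin
    - z * ⟦ D ⟧      ≈⟨ solve 2 (λ z d → :- z :* d := :- (z :* d)) refl z _ ⟩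
    - (z * ⟦ D ⟧)    ≈⟨ -‿cong p ⟩
    - ⟦ N ⟧          ≈⟨ -‿homo N ⟨
    ⟦ P.- N ⟧        ∎

  value-inverse : ∀ {z z′ N D} → z * z′ ≈ 1# → z * ⟦ D ⟧ ≈ ⟦ N ⟧ → z′ * ⟦ N ⟧ ≈ ⟦ D ⟧
  value-inverse {z} {z′} {N} {D} e p = begin
    z′ * ⟦ N ⟧            ≈⟨ *-congˡ p ⟨
    z′ * (z * ⟦ D ⟧)      ≈⟨ solve 3 (λ w z d → w :* (z :* d) := z :* w :* d) refl z′ z _ ⟩
    z * z′ * ⟦ D ⟧        ≈⟨ *-congʳ e ⟩
    1# * ⟦ D ⟧            ≈⟨ *-identityˡ _ ⟩
    ⟦ D ⟧                 ∎

  value-sub : ∀ {z w N D N′ D′} → z * ⟦ D ⟧ ≈ ⟦ N ⟧ → w * ⟦ D′ ⟧ ≈ ⟦ N′ ⟧ → (z - w) * ⟦ D P.* D′ ⟧ ≈ ⟦ N P.* D′ P.- N′ P.* D ⟧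
  value-sub {N′ = N′} {D′} p r = trans (value-+ p (value-neg r))
    (⟦⟧-cong (P.+-congˡ (P.solve 2 (λ n d → P.:- n P.:* d P.:= P.:- (n P.:* d)) P.refl N′ _)))

  value-/ : ∀ {z w w′ N D N′ D′} → w * w′ ≈ 1# → z * ⟦ D ⟧ ≈ ⟦ N ⟧ → w * ⟦ D′ ⟧ ≈ ⟦ N′ ⟧ → z * w′ * ⟦ D P.* N′ ⟧ ≈ ⟦ N P.* D′ ⟧
  value-/ e p r = value-* p (value-inverse e r)

module Specialisation {P K R : Ring₀} (ι : Hom P K) (φ : Hom P R) where
  private
    module P = RingTheory P
    module K = RingTheory K
    module R = RingTheory R
    module ι = HomTheory {P} {K} ι
    module φ = HomTheory {P} {R} φ

  infix 4 _⇝_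
  -- This is the graph of the evaluation K → R, defined only on fractions without a pole along φ. As
  -- a relation it asks for some good representation of z, whichever one z was given by.
  record _⇝_ (z : K.Carrier) (v : R.Carrier) : Set where
    constructor specialise
    field
      top bottom : P.Carrier
      unit-ι     : K.Unit ι.⟦ bottom ⟧
      unit-φ     : R.Unit φ.⟦ bottom ⟧
      source     : z K.* ι.⟦ bottom ⟧ K.≈ ι.⟦ top ⟧
      target     : v R.* φ.⟦ bottom ⟧ R.≈ φ.⟦ top ⟧

  ⇝-cong : ∀ {z z′ v v′} → z K.≈ z′ → v R.≈ v′ → z ⇝ v → z′ ⇝ v′
  ⇝-cong p r (specialise N D u u′ s t) = specialise N D u u′ (K.trans (K.*-congʳ (K.sym p)) s) (R.trans (R.*-congʳ (R.sym r)) t)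

  ⇝-ι : ∀ a → ι.⟦ a ⟧ ⇝ φ.⟦ a ⟧
  ⇝-ι a = specialise a P.1# (ι.homo-unit P.unit-1) (φ.homo-unit P.unit-1)
    (K.trans (K.*-congˡ ι.1#-homo) (K.*-identityʳ _)) (R.trans (R.*-congˡ φ.1#-homo) (R.*-identityʳ _))

  ⇝-1 : K.1# ⇝ R.1#
  ⇝-1 = ⇝-cong ι.1#-homo φ.1#-homo (⇝-ι P.1#)

  ⇝-0 : K.0# ⇝ R.0#
  ⇝-0 = ⇝-cong ι.0#-homo φ.0#-homo (⇝-ι P.0#)

  private
    module VK = Values {P} {K} ι
    module VR = Values {P} {R} φ

  ⇝-+ : ∀ {z w u v} → z ⇝ u → w ⇝ v → z K.+ w ⇝ u R.+ v
  ⇝-+ (specialise N D a b s t) (specialise N′ D′ a′ b′ s′ t′) = specialise _ _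
    (K.unit-cong (K.sym (ι.*-homo D D′)) (K.unit-* a a′)) (R.unit-cong (R.sym (φ.*-homo D D′)) (R.unit-* b b′))
    (VK.value-+ s s′) (VR.value-+ t t′)

  ⇝-* : ∀ {z w u v} → z ⇝ u → w ⇝ v → z K.* w ⇝ u R.* v
  ⇝-* (specialise N D a b s t) (specialise N′ D′ a′ b′ s′ t′) = specialise _ _
    (K.unit-cong (K.sym (ι.*-homo D D′)) (K.unit-* a a′)) (R.unit-cong (R.sym (φ.*-homo D D′)) (R.unit-* b b′))
    (VK.value-* s s′) (VR.value-* t t′)

  ⇝-neg : ∀ {z v} → z ⇝ v → K.- z ⇝ R.- v
  ⇝-neg (specialise N D a b s t) = specialise (P.- N) D a b (VK.value-neg s) (VR.value-neg t)

  ⇝-- : ∀ {z w u v} → z ⇝ u → w ⇝ v → z K.- w ⇝ u R.- v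
  ⇝-- p r = ⇝-+ p (⇝-neg r)

  ⇝-inverse : ∀ {z z′ v v′} → z K.* z′ K.≈ K.1# → v R.* v′ R.≈ R.1# → z ⇝ v → z′ ⇝ v′
  ⇝-inverse {z} {z′} {v} {v′} e e′ (specialise N D a b s t) = specialise D N
    (K.unit-cong s (K.unit-* (z′ , e) a)) (R.unit-cong t (R.unit-* (v′ , e′) b))
    (VK.value-inverse e s) (VR.value-inverse e′ t)

  ⇝-^ : ∀ k {z v} → z ⇝ v → z K.^ k ⇝ v R.^ k
  ⇝-^ zero p = ⇝-1
  ⇝-^ (suc k) p = ⇝-* p (⇝-^ k p)

  ⇝-sum : ∀ k {f g} → (∀ i → i ℕ.< k → f i ⇝ g i) → K.sum k f ⇝ R.sum k g
  ⇝-sum zero p = ⇝-0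
  ⇝-sum (suc k) p = ⇝-+ (⇝-sum k (λ i i<k → p i (ℕₚ.m<n⇒m<1+n i<k))) (p k ℕₚ.≤-refl)

  ⇝-prod : ∀ k {f g} → (∀ i → i ℕ.< k → f i ⇝ g i) → K.prod k f ⇝ R.prod k g
  ⇝-prod zero p = ⇝-1
  ⇝-prod (suc k) p = ⇝-* (⇝-prod k (λ i i<k → p i (ℕₚ.m<n⇒m<1+n i<k))) (p k ℕₚ.≤-refl)

  ⇝-[] : ∀ k {z v} → z ⇝ v → K.[ k ] z ⇝ R.[ k ] v
  ⇝-[] k p = ⇝-sum k (λ i _ → ⇝-^ i p)

  module TK = TruncatedPowers K
  module TR = TruncatedPowers R

  module _ {f : ℕ → K.Carrier} {g : ℕ → R.Carrier} (p : ∀ k → f k ⇝ g k) where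
    ⇝-conv : ∀ o k → TK.conv o f k ⇝ TR.conv o g k
    ⇝-conv two k = ⇝-sum (suc k) λ j _ → ⇝-* (p j) (p _)
    ⇝-conv three k = ⇝-sum (suc k) λ j _ → ⇝-sum (suc (k ∸ j)) λ i _ → ⇝-* (⇝-* (p j) (p i)) (p _)
    ⇝-conv four k = ⇝-sum (suc k) λ j _ → ⇝-sum (suc (k ∸ j)) λ i _ → ⇝-sum (suc (k ∸ j ∸ i)) λ h _ → ⇝-* (⇝-* (⇝-* (p j) (p i)) (p h)) (p _)

  -- The representation a/b of z may be a bad one, with φ(b) a zero divisor. Against a good one,
  -- N/D, injectivity gives Da = Nb in P, where φ(N) = 0 and φ(D) is a unit; so φ(a) = 0 whatever b
  -- is.
  ⇝0⇒φ≈0 : (∀ {a b} → ι.⟦ a ⟧ K.≈ ι.⟦ b ⟧ → a P.≈ b) →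
    ∀ {z a b} → z ⇝ R.0# → z K.* ι.⟦ b ⟧ K.≈ ι.⟦ a ⟧ → φ.⟦ a ⟧ R.≈ R.0#
  ⇝0⇒φ≈0 ι-injective {z} {a} {b} (specialise N D u u′ s t) p = R.unit⇒regular u′ _ (begin
    φ.⟦ D ⟧ R.* φ.⟦ a ⟧         ≈⟨ φ.*-homo D a ⟨
    φ.⟦ D P.* a ⟧               ≈⟨ φ.⟦⟧-cong (ι-injective Da≈Nb) ⟩
    φ.⟦ N P.* b ⟧               ≈⟨ φ.*-homo N b ⟩
    φ.⟦ N ⟧ R.* φ.⟦ b ⟧         ≈⟨ R.*-congʳ t ⟨
    R.0# R.* φ.⟦ D ⟧ R.* φ.⟦ b ⟧  ≈⟨ R.trans (R.*-congʳ (R.zeroˡ _)) (R.zeroˡ _) ⟩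
    R.0#                        ∎)
    where
    open import Relation.Binary.Reasoning.Setoid R.setoid
    Da≈Nb : ι.⟦ D P.* a ⟧ K.≈ ι.⟦ N P.* b ⟧
    Da≈Nb = K.trans (ι.*-homo D a) (K.trans (K.*-congˡ (K.sym p)) (K.trans
      (K.solve 3 (λ d z b → d K.:* (z K.:* b) K.:= z K.:* d K.:* b) K.refl ι.⟦ D ⟧ z ι.⟦ b ⟧)
      (K.trans (K.*-congʳ s) (K.sym (ι.*-homo N b)))))

  module _ (q x : P.Carrier) where
    private
      module SK = Summand K ι.⟦ q ⟧ ι.⟦ x ⟧
      module SR = Summand R φ.⟦ q ⟧ φ.⟦ x ⟧

    ⇝-factor : ∀ {w v} → w ⇝ v → SK.factor w ⇝ SR.factor v
    ⇝-factor p = ⇝-* (⇝-* 1-w 1-w) (⇝-* (⇝-- ⇝-1 (⇝-* (⇝-ι x) p)) (⇝-- (⇝-ι x) p))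
      where 1-w = ⇝-- ⇝-1 p

    ⇝-Q^ : ∀ j → SK.Q K.^ j ⇝ SR.Q R.^ j
    ⇝-Q^ j = ⇝-^ j (⇝-^ 4 (⇝-ι q))

    ⇝-num : ∀ j → SK.num j ⇝ SR.num j
    ⇝-num j = ⇝-* (⇝-^ 2 (⇝-ι q)) (⇝-factor (⇝-* (⇝-ι q) (⇝-Q^ j)))

    ⇝-den : ∀ j → SK.den j ⇝ SR.den j
    ⇝-den j = ⇝-factor (⇝-Q^ (suc j))

-- Blocks of length d

module Blocks {P K R : Ring₀} (ι : Hom P K) (φ : Hom P R) where
  private
    module K = RingTheory K
    module R = RingTheory R
  open HomTheory {P} {K} ι using () renaming (⟦_⟧ to ιₖ)
  open HomTheory {P} {R} φ using () renaming (⟦_⟧ to φᵣ)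

  module Sums (q x : CommutativeRing.Carrier P) (m : ℕ)
    (den⁻¹ : ℕ → K.Carrier)
    (inverse : ∀ j → Summand.den K (ιₖ q) (ιₖ x) j K.* den⁻¹ j K.≈ K.1#)
    (unit-1-qK^ : ∀ i → K.Unit (K.1# K.- ιₖ q K.^ suc i))
    (0<m : 0 ℕ.< m)
    (q^d≈1 : φᵣ q R.^ suc (4 ℕ.* m) R.≈ R.1#)
    (unit-1-q^ : ∀ i → suc i ℕ.< suc (4 ℕ.* m) → R.Unit (R.1# R.- φᵣ q R.^ suc i))
    (unit-1-x^d : R.Unit (R.1# R.- φᵣ x R.^ suc (4 ℕ.* m)))
    (unit-ℕ : ∀ k → R.Unit (R.sum (suc k) (λ _ → R.1#))) where

    private
      d : ℕ
      d = suc (4 ℕ.* m)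

    open Specialisation {P} {K} {R} ι φ

    private
      module SK = Summand K (ιₖ q) (ιₖ x)
      module SR = Summand R (φᵣ q) (φᵣ x)

      unit-2 : R.Unit (R.1# R.+ R.1#)
      unit-2 = R.unit-cong (R.+-congʳ (R.+-identityˡ R.1#)) (unit-ℕ 1)

    open AtRootOfUnity.Sums R (φᵣ q) (φᵣ x) m 0<m q^d≈1 unit-1-q^ unit-1-x^d unit-2

    private
      den⁻¹R : ℕ → R.Carrier
      den⁻¹R j with suc j ℕ.<? d
      ... | yes p = proj₁ (unit-den j p)
      -- For j + 1 = d the factor 1 - Q^(j+1) vanishes in R. The value 0 is a placeholder: wherever
      -- an inverse is required, j + 1 < d.
      ... | no _  = R.0#

      inverseR : ∀ j → suc j ℕ.< d → SR.den j R.* den⁻¹R j R.≈ R.1#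
      inverseR j j<d with suc j ℕ.<? d
      ... | yes p = proj₂ (unit-den j p)
      ... | no ¬p with () ← ¬p j<d

      βK : ℕ → K.Carrier
      βK = SK.β den⁻¹
      αK : ℕ → K.Carrier
      αK = SK.α den⁻¹
      βR : ℕ → R.Carrier
      βR = SR.β den⁻¹R
      αR : ℕ → R.Carrier
      αR = SR.α den⁻¹R

      ρ : ℕ → K.Carrier
      ρ j = SK.num j K.* den⁻¹ j

      Q-block : ∀ a b → SR.Q R.^ (a ℕ.* d ℕ.+ b) R.≈ SR.Q R.^ b
      Q-block a b = begin
        SR.Q R.^ (a ℕ.* d ℕ.+ b)             ≈⟨ SR.Q^ (a ℕ.* d ℕ.+ b) ⟩
        φᵣ q R.^ (4 ℕ.* (a ℕ.* d ℕ.+ b))     ≈⟨ R.^-≡ (φᵣ q) (ℕS.solve 3 (λ a d b → ℕS.con 4 ℕS.:* (a ℕS.:* d ℕS.:+ b) ℕS.:= ℕS.con 4 ℕS.:* b ℕS.:+ d ℕS.:* (ℕS.con 4 ℕS.:* a)) ≡.refl a d b) ⟩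
        φᵣ q R.^ (4 ℕ.* b ℕ.+ d ℕ.* (4 ℕ.* a))  ≈⟨ reduce (4 ℕ.* b) (4 ℕ.* a) ⟩
        φᵣ q R.^ (4 ℕ.* b)                   ≈⟨ SR.Q^ b ⟨
        SR.Q R.^ b                           ∎
        where open import Relation.Binary.Reasoning.Setoid R.setoid

      num-block : ∀ a b → SK.num (a ℕ.* d ℕ.+ b) ⇝ SR.num b
      num-block a b = ⇝-cong K.refl (R.*-congˡ (SR.factor-cong (R.*-congˡ (Q-block a b)))) (⇝-num q x (a ℕ.* d ℕ.+ b))

      den⁻¹-block : ∀ a b → suc b ℕ.< d → den⁻¹ (a ℕ.* d ℕ.+ b) ⇝ den⁻¹R b
      den⁻¹-block a b b<d = ⇝-inverse (inverse _) (inverseR b b<d)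
        (⇝-cong K.refl (SR.factor-cong (R.*-congˡ (Q-block a b))) (⇝-den q x (a ℕ.* d ℕ.+ b)))

      γ : ℕ → ℕ → K.Carrier
      γ a b = K.prod b (λ j → ρ (a ℕ.* d ℕ.+ j))

      γ⇝β : ∀ a b → b ℕ.≤ 4 ℕ.* m → γ a b ⇝ βR b
      γ⇝β a b b≤4m = ⇝-prod b λ j j<b → ⇝-* (num-block a j) (den⁻¹-block a j (ℕ.s≤s (ℕₚ.≤-trans j<b b≤4m)))

      -- In num (ad+m) / den (ad+4m) the squares of 1 - q^(d(4a+1)) and of 1 - q^(d(4a+4)) vanish in R,
      -- but their common factor (1 - q^d)² cancels in K.
      D : K.Carrier
      D = ιₖ q K.^ d

      D⇝1 : D ⇝ R.1#
      D⇝1 = ⇝-cong K.refl q^d≈1 (⇝-^ d (⇝-ι q))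

      xD : K.Carrier → K.Carrier
      xD w = (K.1# K.- ιₖ x K.* w) K.* (ιₖ x K.- w)

      xD⇝ : ∀ k → xD (D K.^ k) ⇝ (R.1# R.- φᵣ x R.* R.1#) R.* (φᵣ x R.- R.1#)
      xD⇝ k = ⇝-* (⇝-- ⇝-1 (⇝-* (⇝-ι x) D^k)) (⇝-- (⇝-ι x) D^k)
        where
        D^k : D K.^ k ⇝ R.1#
        D^k = ⇝-cong K.refl (R.1^ k) (⇝-^ k D⇝1)

      reduced : ℕ → K.Carrier
      reduced k = SK.sq (K.[ k ] D) K.* xD (D K.^ k)

      reducedR : ℕ → R.Carrier
      reducedR k = SR.sq (R.[ k ] R.1#) R.* ((R.1# R.- φᵣ x R.* R.1#) R.* (φᵣ x R.- R.1#))

      reduced⇝ : ∀ k → reduced k ⇝ reducedR k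
      reduced⇝ k = ⇝-* (⇝-* [k] [k]) (xD⇝ k)
        where [k] = ⇝-[] k D⇝1

      unit-reducedR : ∀ k → R.Unit (reducedR (suc k))
      unit-reducedR k = R.unit-* (R.unit-* [k] [k]) (R.unit-* (unit-1-xW (R.1^ d)) (unit-x-W (R.1^ d)))
        where [k] = R.unit-cong (R.sym (R.[]-1 (suc k))) (unit-ℕ k)

      factor-reduced : ∀ {w} k → w K.≈ D K.^ k → SK.factor w K.≈ SK.sq (K.1# K.- D) K.* reduced k
      factor-reduced {w} k p = begin
        SK.factor w
          ≈⟨ SK.factor-cong p ⟩
        SK.sq (K.1# K.- D K.^ k) K.* xD (D K.^ k)
          ≈⟨ K.*-congʳ (K.*-cong (K.geometric D k) (K.geometric D k)) ⟨
        SK.sq ((K.1# K.- D) K.* K.[ k ] D) K.* xD (D K.^ k)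
          ≈⟨ K.solve 3 (λ u t z → u K.:* t K.:* (u K.:* t) K.:* z K.:= u K.:* u K.:* (t K.:* t K.:* z)) K.refl (K.1# K.- D) (K.[ k ] D) _ ⟩
        SK.sq (K.1# K.- D) K.* reduced k ∎
        where open import Relation.Binary.Reasoning.Setoid K.setoid

      ratio⇝ : ∀ a → ∃ λ v → SK.num (a ℕ.* d ℕ.+ m) K.* den⁻¹ (a ℕ.* d ℕ.+ 4 ℕ.* m) ⇝ v
      ratio⇝ a = _ , ⇝-cong (K.sym ratio) R.refl (⇝-* (⇝-^ 2 (⇝-ι q)) (⇝-* (reduced⇝ e₁)
          -- `a + 3 * suc a` is one less than 4(a+1), so the q-integer [4(a+1)] becomes a positive
          -- integer in R, hence a unit.
          (⇝-inverse (proj₂ unit-reduced) (proj₂ (unit-reducedR (a ℕ.+ 3 ℕ.* suc a))) (reduced⇝ e₄))))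
        where
        open import Relation.Binary.Reasoning.Setoid K.setoid
        e₁ = 4 ℕ.* a ℕ.+ 1
        e₄ = 4 ℕ.* suc a
        j₁ = a ℕ.* d ℕ.+ m
        j₄ = a ℕ.* d ℕ.+ 4 ℕ.* m
        u = SK.sq (K.1# K.- D)
        w₁ : ιₖ q K.* SK.Q K.^ j₁ K.≈ D K.^ e₁
        w₁ = K.trans (SK.q*Q^ j₁) (K.trans (K.^-≡ (ιₖ q) (ℕS.solve 2 (λ a m → let d = ℕS.con 1 ℕS.:+ ℕS.con 4 ℕS.:* m in
          ℕS.con 4 ℕS.:* (a ℕS.:* d ℕS.:+ m) ℕS.:+ ℕS.con 1 ℕS.:= d ℕS.:* (ℕS.con 4 ℕS.:* a ℕS.:+ ℕS.con 1)) ≡.refl a m)) (K.sym (K.^-assocʳ (ιₖ q) d e₁)))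
        w₄ : SK.Q K.^ suc j₄ K.≈ D K.^ e₄
        w₄ = K.trans (SK.Q^ (suc j₄)) (K.trans (K.^-≡ (ιₖ q) (ℕS.solve 2 (λ a m → let d = ℕS.con 1 ℕS.:+ ℕS.con 4 ℕS.:* m in
          ℕS.con 4 ℕS.:* (ℕS.con 1 ℕS.:+ (a ℕS.:* d ℕS.:+ ℕS.con 4 ℕS.:* m)) ℕS.:= d ℕS.:* (ℕS.con 4 ℕS.:* (ℕS.con 1 ℕS.:+ a))) ≡.refl a m)) (K.sym (K.^-assocʳ (ιₖ q) d e₄)))
        unit-u : K.Unit u
        unit-u = K.unit-* (unit-1-qK^ (4 ℕ.* m)) (unit-1-qK^ (4 ℕ.* m))
        unit-reduced : K.Unit (reduced e₄)
        unit-reduced = K.unit-∣ (u , K.trans (K.*-comm _ u) (K.sym (factor-reduced e₄ w₄))) (den⁻¹ j₄ , inverse j₄)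
        r⁻¹ = proj₁ unit-reduced
        ratio : SK.num j₁ K.* den⁻¹ j₄ K.≈ ιₖ q K.^ 2 K.* (reduced e₁ K.* r⁻¹)
        ratio = K.unit-cancel (K.unit-* unit-u unit-reduced) (begin
          u K.* reduced e₄ K.* (SK.num j₁ K.* den⁻¹ j₄)
            ≈⟨ K.*-cong (K.sym (factor-reduced e₄ w₄)) (K.*-congʳ (K.*-congˡ (factor-reduced e₁ w₁))) ⟩
          SK.den j₄ K.* (ιₖ q K.^ 2 K.* (u K.* reduced e₁) K.* den⁻¹ j₄)
            ≈⟨ K.solve 5 (λ d s u r i → d K.:* (s K.:* (u K.:* r) K.:* i) K.:= d K.:* i K.:* (u K.:* (s K.:* r))) K.refl (SK.den j₄) _ u _ (den⁻¹ j₄) ⟩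
          SK.den j₄ K.* den⁻¹ j₄ K.* (u K.* (ιₖ q K.^ 2 K.* reduced e₁))
            ≈⟨ K.*-congʳ (K.trans (inverse j₄) (K.sym (proj₂ unit-reduced))) ⟩
          reduced e₄ K.* r⁻¹ K.* (u K.* (ιₖ q K.^ 2 K.* reduced e₁))
            ≈⟨ K.solve 5 (λ r i u s t → r K.:* i K.:* (u K.:* (s K.:* t)) K.:= u K.:* r K.:* (s K.:* (t K.:* i))) K.refl (reduced e₄) r⁻¹ u _ _ ⟩
          u K.* reduced e₄ K.* (ιₖ q K.^ 2 K.* (reduced e₁ K.* r⁻¹)) ∎)

      -- The last denominator of the block, at 4m, vanishes in R. It is paired with the numerator at
      -- m; every other factor specialises by itself.
      γ-full : ∀ a → ∃ λ v → γ a d ⇝ v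
      γ-full a = _ , ⇝-cong (K.sym rearrange) R.refl (⇝-* (proj₂ (ratio⇝ a)) (⇝-* (⇝-* (⇝-prod m λ j _ → num-block a j) (⇝-prod (3 ℕ.* m) λ j _ → num-block a (suc m ℕ.+ j)))
          (⇝-prod (4 ℕ.* m) λ j j<4m → den⁻¹-block a j (ℕ.s≤s j<4m))))
        where
        open import Relation.Binary.Reasoning.Setoid K.setoid
        n i : ℕ → K.Carrier
        n j = SK.num (a ℕ.* d ℕ.+ j)
        i j = den⁻¹ (a ℕ.* d ℕ.+ j)
        rearrange : γ a d K.≈ n m K.* i (4 ℕ.* m) K.* (K.prod m n K.* K.prod (3 ℕ.* m) (λ j → n (suc m ℕ.+ j)) K.* K.prod (4 ℕ.* m) i)
        rearrange = begin
          γ a d                                 ≈⟨ K.prod-* d n i ⟩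
          K.prod d n K.* K.prod d i             ≈⟨ K.*-congʳ (K.prod-append (suc m) (3 ℕ.* m) n) ⟩
          K.prod m n K.* n m K.* K.prod (3 ℕ.* m) (λ j → n (suc m ℕ.+ j)) K.* (K.prod (4 ℕ.* m) i K.* i (4 ℕ.* m))
            ≈⟨ K.solve 5 (λ p s r t u → p K.:* s K.:* r K.:* (t K.:* u) K.:= s K.:* u K.:* (p K.:* r K.:* t)) K.refl _ _ _ _ _ ⟩
          n m K.* i (4 ℕ.* m) K.* (K.prod m n K.* K.prod (3 ℕ.* m) (λ j → n (suc m ℕ.+ j)) K.* K.prod (4 ℕ.* m) i) ∎

      -- Only the existence of these constants matters: each multiplies a block sum that is 0.
      c : ∀ a → ∃ λ v → βK (a ℕ.* d) ⇝ v
      c zero = R.1# , ⇝-1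
      c (suc a) = proj₁ (c a) R.* proj₁ (γ-full a) , ≡.subst (λ k → βK k ⇝ proj₁ (c a) R.* proj₁ (γ-full a)) (ℕₚ.+-comm (a ℕ.* d) d)
        (⇝-cong (K.sym (K.prod-append (a ℕ.* d) d ρ)) R.refl (⇝-* (proj₂ (c a)) (proj₂ (γ-full a))))

      [8k+1]-block : ∀ a b → R.[ 8 ℕ.* (a ℕ.* d ℕ.+ b) ℕ.+ 1 ] (φᵣ q) R.≈ R.[ 8 ℕ.* b ℕ.+ 1 ] (φᵣ q)
      [8k+1]-block a b = R.unit-cancel unit-1-q (R.trans (SR.[8k+1] (a ℕ.* d ℕ.+ b)) (R.trans
        (R.+-congˡ (R.-‿cong (R.*-cong (R.*-congˡ (Q-block a b)) (Q-block a b)))) (R.sym (SR.[8k+1] b))))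

      α-block : ∀ a b → b ℕ.< d → αK (a ℕ.* d ℕ.+ b) ⇝ proj₁ (c a) R.* αR b
      α-block a b b<d = ⇝-cong (K.sym (K.*-congˡ (K.prod-append (a ℕ.* d) b ρ)))
        (R.trans (R.*-congʳ ([8k+1]-block a b)) (R.solve 3 (λ t c b → t R.:* (c R.:* b) R.:= c R.:* (t R.:* b)) R.refl _ (proj₁ (c a)) _))
        (⇝-* (⇝-[] (8 ℕ.* (a ℕ.* d ℕ.+ b) ℕ.+ 1) (⇝-ι q)) (⇝-* (proj₂ (c a)) (γ⇝β a b (ℕₚ.≤-pred b<d))))

      -- The values of α in R, assembled from quotient and remainder by d, since beyond the first
      -- block the product formula for α has denominators that vanish in R.
      f : ℕ → R.Carrier
      f k = proj₁ (c (k ℕ./ d)) R.* αR (k ℕ.% d)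

      f-block : ∀ a b → b ℕ.< d → f (a ℕ.* d ℕ.+ b) R.≈ proj₁ (c a) R.* αR b
      f-block a b b<d = R.reflexive (≡.cong₂ (λ i j → proj₁ (c i) R.* αR j)
        (≡.trans (ℕ.+-distrib-/-∣ˡ b (ℕ.divides a ≡.refl)) (≡.trans (≡.cong₂ ℕ._+_ (ℕ.m*n/n≡m a d) (ℕ.m<n⇒m/n≡0 b<d)) (ℕₚ.+-identityʳ a)))
        (≡.trans (≡.cong (ℕ._% d) (ℕₚ.+-comm (a ℕ.* d) b)) (≡.trans (ℕ.[m+kn]%n≡m%n b a d) (ℕ.m<n⇒m%n≡m b<d))))

      α⇝f : ∀ k → αK k ⇝ f k
      α⇝f k = ≡.subst (λ j → αK j ⇝ f k) (≡.sym (≡.trans (ℕ.m≡m%n+[m/n]*n k d) (ℕₚ.+-comm (k ℕ.% d) _))) (α-block (k ℕ./ d) (k ℕ.% d) (ℕ.m%n<n k d))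

      truncated≈0 : ∀ r N → suc r ℕ.≤ 4 → TR.truncated f (suc r) (N ℕ.* d) R.≈ R.0#
      truncated≈0 r N r<4 = TR.truncated-periodic d m f (λ a → proj₁ (c a)) αR f-block
        (λ b m<b _ → R.trans (R.*-congˡ (β-vanishes den⁻¹R inverseR b m<b)) (R.zeroʳ _))
        (sum-α-d den⁻¹R inverseR) r N 0 (ℕ.s≤s (ℕₚ.*-monoˡ-≤ m r<4))

    sum-conv⇝0 : ∀ o N → K.sum (N ℕ.* d) (TK.conv o αK) ⇝ R.0#
    sum-conv⇝0 o N = ⇝-cong K.refl (R.trans (TR.sum-conv o f (N ℕ.* d)) (truncated≈0 (pred-order o) N (order≤4 o)))
      (⇝-sum (N ℕ.* d) λ k _ → ⇝-conv α⇝f o k)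

-- Splitting at roots of unity and the central binomial

product%4≡1 : ∀ ps → All (λ p → p ℕ.% 4 ≡ 1) ps → product ps ℕ.% 4 ≡ 1
product%4≡1 [] [] = ≡.refl
product%4≡1 (p ∷ ps) (e ∷ es) = ≡.trans (ℕ.%-distribˡ-* p (product ps) 4) (≡.cong₂ (λ a b → (a ℕ.* b) ℕ.% 4) e (product%4≡1 ps es))

divisor%4≡1 : ∀ {n} → (∀ p → Prime p → p ℕ.∣ n → p ℕ.% 4 ≡ 1) → ∀ d → .{{ℕ.NonZero d}} → d ℕ.∣ n → d ℕ.% 4 ≡ 1
divisor%4≡1 {n} h d d∣n = ≡.trans (≡.cong (ℕ._% 4) isFactorisation) (product%4≡1 factors (go factors factorsPrime (≡.subst (ℕ._∣ n) isFactorisation d∣n)))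
  where
  open PrimeFactorisation (factorise d)
  go : ∀ ps → All Prime ps → product ps ℕ.∣ n → All (λ p → p ℕ.% 4 ≡ 1) ps
  go [] [] _ = []
  go (p ∷ ps) (pr ∷ prs) r = h p pr (ℕ.m*n∣⇒m∣ p (product ps) r) ∷ go ps prs (ℕ.m*n∣⇒n∣ p (product ps) r)

-- With Y = q^j and e the mean of the powers of Y, the idempotents e and 1-e split R into
-- a factor where q^j = 1 and one where 1-q^j is invertible.
module Splitting (n : ℕ) (0<n : 0 ℕ.< n) where

  Primitive : (S : Ring₀) → CommutativeRing.Carrier S → ℕ → Set
  Primitive S q d = q ^ d ≈ 1# × (∀ i → suc i ℕ.< d → Unit (1# - q ^ suc i))
    where open RingTheory S

  private
    -- At stage j all 1 - q^i with 0 < i < j are units, so the factor ring with q^j = 1 is one where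
    -- q is primitive of order j; the other factor passes to stage j + 1, and at j = n the relation
    -- q^n = 1 is given. Orders j that do not divide n are kept; such rings turn out to be trivial.
    -- As A is a multiple of both e and 1-e, it is killed by e(1-e) = 0.
    go : ∀ k j → j ℕ.+ k ≡ n → 0 ℕ.< j → (R : Ring₀) (let open RingTheory R) (q A : Carrier) →
      Unit (sum n (λ _ → 1#)) → q ^ n ≈ 1# → (∀ i → suc i ℕ.< j → Unit (1# - q ^ suc i)) →
      ((S : Ring₀) (ψ : Hom R S) (d : ℕ) → 0 ℕ.< d → (let open HomTheory {R} {S} ψ using (⟦_⟧)) →
        Primitive S ⟦ q ⟧ d → CommutativeRing._≈_ S ⟦ A ⟧ (CommutativeRing.0# S)) →
      A ≈ 0#
    go zero j j≡n 0<j R q A un q^n units h rewrite ≡.trans (≡.sym (ℕₚ.+-identityʳ j)) j≡n =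
      h R (mkHom {R} {R} (λ a → a) (λ p → p) (λ _ _ → refl) (λ _ _ → refl) refl) n 0<j (q^n , units)
      where open RingTheory R
    go (suc k) j j+k 0<j R q A un q^n units h = begin
      A                        ≈⟨ solve 2 (λ e a → a := e :* a :+ (:1 :- e) :* a) refl e A ⟩
      e * A + (1# - e) * A     ≈⟨ +-cong (*-congˡ (sym (proj₂ 1-e∣A))) (*-congˡ (sym (proj₂ e∣A))) ⟩
      e * ((1# - e) * proj₁ 1-e∣A) + (1# - e) * (e * proj₁ e∣A)
                               ≈⟨ solve 3 (λ e w w′ → e :* ((:1 :- e) :* w) :+ (:1 :- e) :* (e :* w′) := e :* (:1 :- e) :* (w :+ w′)) refl e _ _ ⟩
      e * (1# - e) * _         ≈⟨ trans (*-congʳ e[1-e]) (zeroˡ _) ⟩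
      0#                       ∎
      where
      open RingTheory R
      open import Relation.Binary.Reasoning.Setoid setoid
      n⁻¹ = proj₁ un
      Y = q ^ j
      y = 1# - Y
      e = n⁻¹ * [ n ] Y
      -- Averaging 1 - Y^i = (1 - Y)[i] over i < n gives yz = 1 - e, so z inverts y modulo e.
      z = n⁻¹ * sum n (λ i → [ i ] Y)
      ye : y * e ≈ 0#
      ye = begin
        y * (n⁻¹ * [ n ] Y)      ≈⟨ solve 3 (λ y a b → y :* (a :* b) := a :* (y :* b)) refl y n⁻¹ _ ⟩
        n⁻¹ * (y * [ n ] Y)      ≈⟨ *-congˡ (trans (geometric Y n) (≈⇒-≈0 (sym Y^n))) ⟩
        n⁻¹ * 0#                 ≈⟨ zeroʳ _ ⟩
        0#                       ∎
        where
        Y^n : Y ^ n ≈ 1#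
        Y^n = trans (^-assocʳ q j n) (trans (^-≡ q (ℕₚ.*-comm j n)) (trans (sym (^-assocʳ q n j)) (trans (^-congˡ j q^n) (1^ j))))
      yz : y * z ≈ 1# - e
      yz = begin
        y * (n⁻¹ * sum n (λ i → [ i ] Y))               ≈⟨ solve 3 (λ y a b → y :* (a :* b) := a :* (y :* b)) refl y n⁻¹ _ ⟩
        n⁻¹ * (y * sum n (λ i → [ i ] Y))               ≈⟨ *-congˡ (sum-*ˡ n y _) ⟨
        n⁻¹ * sum n (λ i → y * [ i ] Y)                 ≈⟨ *-congˡ (sum-cong n (λ i _ → trans (geometric Y i) (+-congˡ (solve 1 (λ a → :- a := :- :1 :* a) refl (Y ^ i))))) ⟩
        n⁻¹ * sum n (λ i → 1# + - 1# * Y ^ i)           ≈⟨ *-congˡ (trans (sum-+ n _ _) (+-congˡ (sum-*ˡ n (- 1#) (Y ^_)))) ⟩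
        n⁻¹ * (sum n (λ _ → 1#) + - 1# * [ n ] Y)       ≈⟨ solve 3 (λ a s t → a :* (s :+ :- :1 :* t) := s :* a :- a :* t) refl n⁻¹ _ _ ⟩
        sum n (λ _ → 1#) * n⁻¹ - e                      ≈⟨ +-congʳ (proj₂ un) ⟩
        1# - e                                          ∎
      e[1-e] : e * (1# - e) ≈ 0#
      e[1-e] = begin
        e * (1# - e)     ≈⟨ *-congˡ yz ⟨
        e * (y * z)      ≈⟨ solve 3 (λ e y z → e :* (y :* z) := y :* e :* z) refl e y z ⟩
        y * e * z        ≈⟨ trans (*-congʳ ye) (zeroˡ z) ⟩
        0#               ∎
      module Q₁ = Quotient R (1# - e)
      module Q₂ = Quotient R e
      module R₁ = RingTheory Q₁.quotient
      module R₂ = RingTheory Q₂.quotient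
      module π₁ = HomTheory {R} {Q₁.quotient} Q₁.π
      module π₂ = HomTheory {R} {Q₂.quotient} Q₂.π
      1-e∣A : 1# - e ∣ A
      1-e∣A = Q₁.≈0⇒∣ (h Q₁.quotient Q₁.π j 0<j
        ( R₁.trans (R₁.sym (π₁.homo-^ q j)) (R₁.sym (R₁.-≈0⇒≈ (Q₁.∣⇒≈0 (y , [1-e]y))))
        , λ i i<j → R₁.unit-cong (R₁.trans (π₁.homo-1- (q ^ suc i)) (R₁.+-congˡ (R₁.-‿cong (π₁.homo-^ q (suc i))))) (π₁.homo-unit (units i i<j))))
        where
        [1-e]y : (1# - e) * y ≈ 1# - Y
        [1-e]y = trans (solve 2 (λ e y → (:1 :- e) :* y := y :- y :* e) refl e y) (trans (+-congˡ (trans (-‿cong ye) -0#≈0#)) (+-identityʳ y))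
      e∣A : e ∣ A
      e∣A = Q₂.≈0⇒∣ (go k (suc j) (≡.trans (≡.sym (ℕₚ.+-suc j k)) j+k) (ℕ.s≤s ℕ.z≤n) Q₂.quotient q A
        (R₂.unit-cong (π₂.homo-sum n (λ _ → 1#)) (π₂.homo-unit un))
        (R₂.trans (R₂.sym (π₂.homo-^ q n)) (π₂.⟦⟧-cong q^n))
        units′
        (λ S ψ d 0<d prim → h S (_∘ʰ_ {R} {Q₂.quotient} {S} ψ Q₂.π) d 0<d prim))
        where
        units′ : ∀ i → suc i ℕ.< suc j → R₂.Unit (R₂.1# R₂.- q R₂.^ suc i)
        units′ i i<j with ℕₚ.m≤n⇒m<n∨m≡n (ℕₚ.≤-pred i<j)
        ... | inj₁ i<j′ = R₂.unit-cong (R₂.+-congˡ (R₂.-‿cong (π₂.homo-^ q (suc i)))) (π₂.homo-unit (units i i<j′))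
        ... | inj₂ ≡.refl = R₂.unit-cong (R₂.+-congˡ (R₂.-‿cong (π₂.homo-^ q j)))
          (z , R₂.trans (Q₂.≈⇒≋ yz) (R₂.trans (R₂.+-congˡ (R₂.trans (R₂.-‿cong (Q₂.∣⇒≈0 (1# , *-identityʳ e))) R₂.-0#≈0#)) (R₂.+-identityʳ _)))

  vanishes-if-at-primitive-roots : (R : Ring₀) (let open RingTheory R) (q A : Carrier) →
    Unit (sum n (λ _ → 1#)) → q ^ n ≈ 1# →
    ((S : Ring₀) (ψ : Hom R S) (d : ℕ) → 0 ℕ.< d → (let open HomTheory {R} {S} ψ using (⟦_⟧)) →
      Primitive S ⟦ q ⟧ d → CommutativeRing._≈_ S ⟦ A ⟧ (CommutativeRing.0# S)) →
    A ≈ 0#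
  vanishes-if-at-primitive-roots R q A un q^n h =
    go (n ∸ 1) 1 (ℕₚ.m+[n∸m]≡n 0<n) (ℕ.s≤s ℕ.z≤n) R q A un q^n (λ { i (ℕ.s≤s ()) }) h

-- Gaussian binomial coefficients

module CentralBinomial (R : Ring₀) where
  open RingTheory R
  open import Relation.Binary.Reasoning.Setoid setoid

  module _ (p : Carrier) where
    poch⁻ poch⁺ : ℕ → Carrier
    poch⁻ k = prod k (λ j → 1# - p ^ suc j)
    poch⁺ k = prod k (λ j → 1# + p ^ suc j)

    -- The q-Pascal rule builds the Gaussian binomial without division, which matters because the
    -- products `poch⁻` may be zero divisors.
    binomial : ∀ a b → Σ Carrier λ B → poch⁻ (a ℕ.+ b) ≈ B * (poch⁻ a * poch⁻ b)
    binomial zero b = 1# , solve 1 (λ x → x := :1 :* (:1 :* x)) refl _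
    binomial (suc a) zero rewrite ℕₚ.+-identityʳ a = 1# , solve 1 (λ x → x := :1 :* (x :* :1)) refl _
    binomial (suc a) (suc b) = B₁ + p ^ suc a * B₂ , (begin
      poch⁻ (a ℕ.+ suc b) * (1# - p ^ suc (a ℕ.+ suc b))
        ≈⟨ *-congˡ (+-congˡ (-‿cong (^-homo-* p (suc a) (suc b)))) ⟩
      poch⁻ (a ℕ.+ suc b) * (1# - s * t)
        ≈⟨ solve 3 (λ w s t → w :* (:1 :- s :* t) := (:1 :- s) :* w :+ s :* (:1 :- t) :* w) refl _ s t ⟩
      (1# - s) * poch⁻ (a ℕ.+ suc b) + s * (1# - t) * poch⁻ (a ℕ.+ suc b)
        ≈⟨ +-cong (*-congˡ e₁) (*-congˡ (trans (reflexive (≡.cong poch⁻ (ℕₚ.+-suc a b))) e₂)) ⟩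
      (1# - s) * (B₁ * (poch⁻ a * poch⁻ (suc b))) + s * (1# - t) * (B₂ * (poch⁻ (suc a) * poch⁻ b))
        ≈⟨ solve 6 (λ s t x y u v → (:1 :- s) :* (u :* (x :* (y :* (:1 :- t)))) :+ s :* (:1 :- t) :* (v :* (x :* (:1 :- s) :* y))
             := (u :+ s :* v) :* (x :* (:1 :- s) :* (y :* (:1 :- t)))) refl s t (poch⁻ a) (poch⁻ b) B₁ B₂ ⟩
      (B₁ + s * B₂) * (poch⁻ (suc a) * poch⁻ (suc b)) ∎)
      where
      s = p ^ suc a
      t = p ^ suc b
      B₁ = proj₁ (binomial a (suc b))
      e₁ = proj₂ (binomial a (suc b))
      B₂ = proj₁ (binomial (suc a) b)
      e₂ = proj₂ (binomial (suc a) b)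

  module _ (q : Carrier) where
    private
      p = q ^ 2
      Q = q ^ 4

      Q^ : ∀ j → Q ^ j ≈ p ^ j * p ^ j
      Q^ j = trans (^-congˡ j (solve 1 (λ q → q :^ 4 := q :^ 2 :* q :^ 2) refl q)) (^-distrib-* p p j)

    tops bottoms : ℕ → Carrier
    tops m = prod m (λ j → 1# - p * Q ^ j)
    bottoms m = prod m (λ j → 1# - Q ^ suc j)

    bottoms-split : ∀ m → bottoms m ≈ poch⁻ p m * poch⁺ p m
    bottoms-split m = trans (prod-cong m (λ j _ → trans (+-congˡ (-‿cong (Q^ (suc j))))
      (solve 1 (λ a → :1 :- a :* a := (:1 :- a) :* (:1 :+ a)) refl (p ^ suc j)))) (prod-* m _ _)

    tops-bottoms : ∀ m → tops m * bottoms m ≈ poch⁻ p (m ℕ.+ m)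
    tops-bottoms zero = *-identityˡ 1#
    tops-bottoms (suc m) = begin
      tops m * (1# - p * Q ^ m) * (bottoms m * (1# - Q ^ suc m))
        ≈⟨ solve 4 (λ a b c d → a :* b :* (c :* d) := a :* c :* b :* d) refl _ _ _ _ ⟩
      tops m * bottoms m * (1# - p * Q ^ m) * (1# - Q ^ suc m)
        ≈⟨ *-cong (*-cong (tops-bottoms m) (+-congˡ (-‿cong (*-congˡ (trans (Q^ m) (sym (^-homo-* p m m)))))))
                  (+-congˡ (-‿cong (trans (Q^ (suc m)) (trans (sym (^-homo-* p (suc m) (suc m))) (^-≡ p (≡.cong suc (ℕₚ.+-suc m m))))))) ⟩
      poch⁻ p (suc (suc (m ℕ.+ m)))
        ≡⟨ ≡.cong (λ k → poch⁻ p (suc k)) (ℕₚ.+-suc m m) ⟨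
      poch⁻ p (suc m ℕ.+ suc m) ∎

    -- In fractions: (q²;q⁴)_m / (q⁴;q⁴)_m is the central Gaussian binomial in base q² divided by
    -- (-q²;q²)_m². Thus its only possible poles are zeros of 1 + q^(2j), and these avoid roots of
    -- unity of odd order.
    central : ∀ m → Σ Carrier λ B → tops m * bottoms m * (poch⁺ p m * poch⁺ p m) ≈ B * (bottoms m * bottoms m)
    central m = proj₁ (binomial p m m) , (begin
      tops m * bottoms m * (poch⁺ p m * poch⁺ p m)
        ≈⟨ *-congʳ (trans (tops-bottoms m) (proj₂ (binomial p m m))) ⟩
      B * (poch⁻ p m * poch⁻ p m) * (poch⁺ p m * poch⁺ p m)
        ≈⟨ solve 3 (λ b x y → b :* (x :* x) :* (y :* y) := b :* (x :* y :* (x :* y))) refl B _ _ ⟩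
      B * (poch⁻ p m * poch⁺ p m * (poch⁻ p m * poch⁺ p m))
        ≈⟨ *-congˡ (*-cong (bottoms-split m) (bottoms-split m)) ⟨
      B * (bottoms m * bottoms m) ∎)
      where B = proj₁ (binomial p m m)

-- The divisibility of the numerator

module Congruence (P : Ring₀) where
  open RingTheory P

  module Numerator (q x : Carrier) (m : ℕ)
    (primes : ∀ p → Prime p → p ℕ.∣ suc (4 ℕ.* m) → p ℕ.% 4 ≡ 1)
    (unit-ℕ : ∀ k → Unit (sum (suc k) (λ _ → 1#)))
    (regular-q : Regular q)
    (regular-1-q^ : ∀ i → Regular (1# - q ^ suc i))
    (regular-1+q^ : ∀ i → Regular (1# + q ^ suc i))
    (regular-1-xq^ : ∀ i → Regular (1# - x * q ^ suc i))
    (regular-x-q^ : ∀ i → Regular (x - q ^ suc i))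
    (regular-1-x^mod₁ : ∀ j → RingTheory.Regular (Quotient.quotient P ([ suc (4 ℕ.* m) ] q)) (1# - x ^ suc j))
    (regular-1-x^mod₂ : ∀ j → RingTheory.Regular (Quotient.quotient P (x - q ^ suc (4 ℕ.* m))) (1# - x ^ suc j))
    (regular-1-x^mod₃ : ∀ j → RingTheory.Regular (Quotient.quotient P (1# - x * q ^ suc (4 ℕ.* m))) (1# - x ^ suc j))
    (regular-q-mod₂ : RingTheory.Regular (Quotient.quotient P (x - q ^ suc (4 ℕ.* m))) q) where

    private
      n : ℕ
      n = suc (4 ℕ.* m)

    open TotalQuotient P using (regular⇒unit; ι-injective; unit⇒regular-ι) renaming (fractions to K; ι to ιʰ)
    module K = RingTheory K
    module ι = HomTheory {P} {K} ιʰ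
    module SK = Summand K ι.⟦ q ⟧ ι.⟦ x ⟧
    module TK = TruncatedPowers K
    module BK = CentralBinomial K
    module BP = CentralBinomial P

    private
      n-1≡2[2m] : n ≡ suc (2 ℕ.* m ℕ.+ 2 ℕ.* m)
      n-1≡2[2m] = ≡.cong suc (ℕS.solve 1 (λ m → ℕS.con 4 ℕS.:* m ℕS.:= ℕS.con 2 ℕS.:* m ℕS.:+ ℕS.con 2 ℕS.:* m) ≡.refl m)

      [Q^]-exponent : ∀ j → 4 ℕ.* suc j ≡ suc (3 ℕ.+ 4 ℕ.* j)
      [Q^]-exponent j = ℕₚ.*-suc 4 j

    module Image {S : Ring₀} (φ : Hom P S) where
      private module S = RingTheory S
      open HomTheory {P} {S} φ
      1-q^ : ∀ i → ⟦ 1# - q ^ i ⟧ S.≈ S.1# S.- ⟦ q ⟧ S.^ i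
      1-q^ i = S.trans (homo-1- (q ^ i)) (S.+-congˡ (S.-‿cong (homo-^ q i)))
      1-xq^ : ∀ i → ⟦ 1# - x * q ^ i ⟧ S.≈ S.1# S.- ⟦ x ⟧ S.* ⟦ q ⟧ S.^ i
      1-xq^ i = S.trans (homo-1- _) (S.+-congˡ (S.-‿cong (S.trans (*-homo x _) (S.*-congˡ (homo-^ q i)))))
      x-q^ : ∀ i → ⟦ x - q ^ i ⟧ S.≈ ⟦ x ⟧ S.- ⟦ q ⟧ S.^ i
      x-q^ i = S.trans (homo-- x _) (S.+-congˡ (S.-‿cong (homo-^ q i)))
      1-x^ : ∀ i → ⟦ 1# - x ^ i ⟧ S.≈ S.1# S.- ⟦ x ⟧ S.^ i
      1-x^ i = S.trans (homo-1- (x ^ i)) (S.+-congˡ (S.-‿cong (homo-^ x i)))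

    private module IK = Image {K} ιʰ

    unit-qK : K.Unit ι.⟦ q ⟧
    unit-qK = regular⇒unit regular-q

    unit-1-qK^ : ∀ i → K.Unit (K.1# K.- ι.⟦ q ⟧ K.^ suc i)
    unit-1-qK^ i = K.unit-cong (IK.1-q^ (suc i)) (regular⇒unit (regular-1-q^ i))

    private
      Q^suc : ∀ j → SK.Q K.^ suc j K.≈ ι.⟦ q ⟧ K.^ suc (3 ℕ.+ 4 ℕ.* j)
      Q^suc j = K.trans (SK.Q^ (suc j)) (K.^-≡ ι.⟦ q ⟧ ([Q^]-exponent j))

      unit-1-QK : ∀ j → K.Unit (K.1# K.- SK.Q K.^ suc j)
      unit-1-QK j = K.unit-cong (K.+-congˡ (K.-‿cong (K.sym (Q^suc j)))) (unit-1-qK^ (3 ℕ.+ 4 ℕ.* j))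

    unit-1-xQ : ∀ j → K.Unit (K.1# K.- ι.⟦ x ⟧ K.* SK.Q K.^ suc j)
    unit-1-xQ j = K.unit-cong (K.trans (IK.1-xq^ (suc (3 ℕ.+ 4 ℕ.* j))) (K.+-congˡ (K.-‿cong (K.*-congˡ (K.sym (Q^suc j))))))
      (regular⇒unit (regular-1-xq^ (3 ℕ.+ 4 ℕ.* j)))

    unit-x-Q : ∀ j → K.Unit (ι.⟦ x ⟧ K.- SK.Q K.^ suc j)
    unit-x-Q j = K.unit-cong (K.trans (IK.x-q^ (suc (3 ℕ.+ 4 ℕ.* j))) (K.+-congˡ (K.-‿cong (K.sym (Q^suc j)))))
      (regular⇒unit (regular-x-q^ (3 ℕ.+ 4 ℕ.* j)))

    unit-denK : ∀ j → K.Unit (SK.den j)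
    unit-denK j = K.unit-* (K.unit-* (unit-1-QK j) (unit-1-QK j)) (K.unit-* (unit-1-xQ j) (unit-x-Q j))

    den⁻¹ : ℕ → K.Carrier
    den⁻¹ j = proj₁ (unit-denK j)

    α : ℕ → K.Carrier
    α = SK.α den⁻¹

    unit-bottoms : K.Unit (BK.bottoms ι.⟦ q ⟧ m)
    unit-bottoms = K.prod-unit m (λ j _ → unit-1-QK j)

    ratio : K.Carrier
    ratio = BK.tops ι.⟦ q ⟧ m K.* proj₁ unit-bottoms

    q⁻¹^ : ℕ → K.Carrier
    q⁻¹^ k = proj₁ (K.unit-^ k unit-qK)

    rhs : Order → K.Carrier
    rhs o = (K.[ n ] ι.⟦ q ⟧) K.^ order o K.* ratio K.^ order o K.* q⁻¹^ (order o ℕ.* m)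

    difference : Order → K.Carrier
    difference o = K.sum n (TK.conv o α) K.- rhs o

    -- Divisibility of the numerator is proved for every representation A₁/A₂ of the difference;
    -- lowest terms are chosen afterwards.
    module _ (o : Order) (A₁ A₂ : Carrier) (cleared : difference o K.* ι.⟦ A₂ ⟧ K.≈ ι.⟦ A₁ ⟧) where

      module Primitive {S : Ring₀} (φ : Hom P S) where
        private module S = RingTheory S
        open HomTheory {P} {S} φ using (⟦_⟧)

        module At
          ([n]≈0 : S.[ n ] ⟦ q ⟧ S.≈ S.0#)
          (unit-1-x^n : S.Unit (S.1# S.- ⟦ x ⟧ S.^ n))
          (d : ℕ) (0<d : 0 ℕ.< d)
          (q^d≈1 : ⟦ q ⟧ S.^ d S.≈ S.1#)
          (unit-1-q^ : ∀ i → suc i ℕ.< d → S.Unit (S.1# S.- ⟦ q ⟧ S.^ suc i)) where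

          private
            module φ = HomTheory {P} {S} φ
            module SS = Summand S ⟦ q ⟧ ⟦ x ⟧
            open Specialisation {P} {K} {S} ιʰ φ hiding (module TK)

            q^n≈1 : ⟦ q ⟧ S.^ n S.≈ S.1#
            q^n≈1 = S.sym (S.-≈0⇒≈ (S.trans (S.sym (S.geometric ⟦ q ⟧ n)) (S.trans (S.*-congˡ [n]≈0) (S.zeroʳ _))))

            unit-ℕS : ∀ k → S.Unit (S.sum (suc k) (λ _ → S.1#))
            unit-ℕS k = S.unit-cong (S.trans (φ.homo-sum (suc k) _) (S.sum-cong (suc k) (λ _ _ → φ.1#-homo))) (φ.homo-unit (unit-ℕ k))

            collapse : ∀ {a} → S.Unit a → a S.≈ S.0# → ∀ b → b S.≈ S.0#
            collapse {a} (b , e) a≈0 = S.trivial (S.trans (S.sym e) (S.trans (S.*-congʳ a≈0) (S.zeroˡ b)))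

          -- With q = 1 the element [n] = 0 is the integer n, a unit, so the ring is trivial.
          collapse-1 : d ≡ 1 → ⟦ A₁ ⟧ S.≈ S.0#
          collapse-1 ≡.refl = collapse (unit-ℕS (4 ℕ.* m)) (S.trans (S.sym (S.[]-1 n)) (S.trans (S.[]-cong n (S.trans (S.sym q^d≈1) (S.*-identityʳ _))) [n]≈0)) _

          q^remainder : .{{_ : ℕ.NonZero d}} → ⟦ q ⟧ S.^ (n ℕ.% d) S.≈ S.1#
          q^remainder = begin
            ⟦ q ⟧ S.^ (n ℕ.% d)                                      ≈⟨ S.*-identityʳ _ ⟨
            ⟦ q ⟧ S.^ (n ℕ.% d) S.* S.1#                             ≈⟨ S.*-congˡ (S.trans (S.^-congˡ (n ℕ./ d) q^d≈1) (S.1^ (n ℕ./ d))) ⟨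
            ⟦ q ⟧ S.^ (n ℕ.% d) S.* (⟦ q ⟧ S.^ d) S.^ (n ℕ./ d)      ≈⟨ S.*-congˡ (S.trans (S.^-assocʳ ⟦ q ⟧ d (n ℕ./ d)) (S.^-≡ ⟦ q ⟧ (ℕₚ.*-comm d (n ℕ./ d)))) ⟩
            ⟦ q ⟧ S.^ (n ℕ.% d) S.* ⟦ q ⟧ S.^ (n ℕ./ d ℕ.* d)        ≈⟨ S.^-homo-* ⟦ q ⟧ (n ℕ.% d) (n ℕ./ d ℕ.* d) ⟨
            ⟦ q ⟧ S.^ (n ℕ.% d ℕ.+ n ℕ./ d ℕ.* d)                    ≈⟨ S.^-≡ ⟦ q ⟧ (ℕ.m≡m%n+[m/n]*n n d) ⟨
            ⟦ q ⟧ S.^ n                                              ≈⟨ q^n≈1 ⟩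
            S.1#                                                     ∎
            where open import Relation.Binary.Reasoning.Setoid S.setoid

          -- The remainder of n modulo d is an exponent r with 0 < r < d and q^r = 1, although 1 -
          -- q^r is a unit: again a trivial ring.
          collapse-∤ : .{{_ : ℕ.NonZero d}} → ¬ (d ℕ.∣ n) → ⟦ A₁ ⟧ S.≈ S.0#
          collapse-∤ d∤n = go (n ℕ.% d) q^remainder (λ e → d∤n (ℕ.m%n≡0⇒n∣m n d e)) (ℕ.m%n<n n d)
            where
            go : ∀ r → ⟦ q ⟧ S.^ r S.≈ S.1# → r ≢ 0 → r ℕ.< d → ⟦ A₁ ⟧ S.≈ S.0#
            go zero _ ne _ = ⊥-elim (ne ≡.refl)
            go (suc r) e _ r<d = collapse (unit-1-q^ r r<d) (S.≈⇒-≈0 (S.sym e)) _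

          -- The factor [n] is 0 in S; the work lies in showing that the other factors have no pole
          -- there.
          rhs⇝0 : rhs o ⇝ S.0#
          rhs⇝0 = ⇝-cong K.refl (S.trans (S.*-congʳ (S.trans (S.*-congʳ (S.trans (S.*-congʳ [n]≈0) (S.zeroˡ _))) (S.zeroˡ _))) (S.zeroˡ _))
            (⇝-* (⇝-* (⇝-^ (order o) (⇝-[] n (⇝-ι q))) (⇝-^ (order o) ratio⇝)) (⇝-inverse (proj₂ (K.unit-^ r unit-qK)) (proj₂ (S.unit-^ r unit-q)) (⇝-^ r (⇝-ι q))))
            where
            r = order o ℕ.* m
            unit-q : S.Unit ⟦ q ⟧
            unit-q = _ , q^n≈1
            p = q ^ 2
            unit-2 : S.Unit (S.1# S.+ S.1#)
            unit-2 = S.unit-cong (S.+-congʳ (S.+-identityˡ S.1#)) (unit-ℕS 1)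
            p^ : ∀ j → p ^ suc j ≈ q ^ suc (suc (2 ℕ.* j))
            p^ j = trans (^-assocʳ q 2 (suc j)) (^-≡ q (≡.trans (ℕₚ.*-comm 2 (suc j)) (≡.cong (2 ℕ.+_) (ℕₚ.*-comm j 2))))
            homo-prod : ∀ {T : Ring₀} (ψ : Hom P T) k (f : ℕ → Carrier) →
              (∀ j → RingTheory.Unit T (HomTheory.⟦_⟧ {P} {T} ψ (f j))) → RingTheory.Unit T (HomTheory.⟦_⟧ {P} {T} ψ (prod k f))
            homo-prod {T} ψ zero f h = HomTheory.homo-unit {P} {T} ψ unit-1
            homo-prod {T} ψ (suc k) f h = RingTheory.unit-cong T (RingTheory.sym T (HomTheory.*-homo {P} {T} ψ _ _)) (RingTheory.unit-* T (homo-prod {T} ψ k f h) (h k))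
            unit-K : K.Unit ι.⟦ BP.poch⁺ p m ⟧
            unit-K = homo-prod {K} ιʰ m _ (λ j → regular⇒unit (λ b e → regular-1+q^ (suc (2 ℕ.* j)) b (trans (*-congʳ (+-congˡ (sym (p^ j)))) e)))
            unit-S : S.Unit ⟦ BP.poch⁺ p m ⟧
            -- Each y = q^(2j+2) satisfies y^n = 1 with n odd, so 1 + y divides the unit 2.
            unit-S = homo-prod {S} φ m _ (λ j → S.unit-cong (S.sym (S.trans (φ.+-homo 1# (p ^ suc j)) (S.+-congʳ φ.1#-homo)))
              (S.unit-∣ (S.1+y∣2 ⟦ p ^ suc j ⟧ (2 ℕ.* m) (root j)) unit-2))
              where
              root : ∀ j → ⟦ p ^ suc j ⟧ S.^ suc (2 ℕ.* m ℕ.+ 2 ℕ.* m) S.≈ S.1#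
              root j = begin
                ⟦ p ^ suc j ⟧ S.^ suc (2 ℕ.* m ℕ.+ 2 ℕ.* m)     ≈⟨ S.^-≡ _ (≡.sym n-1≡2[2m]) ⟩
                ⟦ p ^ suc j ⟧ S.^ n                             ≈⟨ S.^-congˡ n (S.trans (φ.⟦⟧-cong (p^ j)) (φ.homo-^ q k)) ⟩
                (⟦ q ⟧ S.^ k) S.^ n                             ≈⟨ S.trans (S.^-assocʳ ⟦ q ⟧ k n) (S.trans (S.^-≡ ⟦ q ⟧ (ℕₚ.*-comm k n)) (S.sym (S.^-assocʳ ⟦ q ⟧ n k))) ⟩
                (⟦ q ⟧ S.^ n) S.^ k                             ≈⟨ S.trans (S.^-congˡ k q^n≈1) (S.1^ k) ⟩
                S.1#                                            ∎
                where
                open import Relation.Binary.Reasoning.Setoid S.setoid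
                k = suc (suc (2 ℕ.* j))
            square-unit : ∀ {T : Ring₀} (ψ : Hom P T) {a} → RingTheory.Unit T (HomTheory.⟦_⟧ {P} {T} ψ a) → RingTheory.Unit T (HomTheory.⟦_⟧ {P} {T} ψ (a * a))
            square-unit {T} ψ u = RingTheory.unit-cong T (RingTheory.sym T (HomTheory.*-homo {P} {T} ψ _ _)) (RingTheory.unit-* T u u)
            homo-prodK : ∀ k f → ι.⟦ prod k f ⟧ K.≈ K.prod k (λ j → ι.⟦ f j ⟧)
            homo-prodK zero f = ι.1#-homo
            homo-prodK (suc k) f = K.trans (ι.*-homo _ _) (K.*-congʳ (homo-prodK k f))
            tops-ι : ι.⟦ BP.tops q m ⟧ K.≈ BK.tops ι.⟦ q ⟧ m
            tops-ι = K.trans (homo-prodK m _) (K.prod-cong m (λ j _ → K.trans (ι.homo-1- _) (K.+-congˡ (K.-‿cong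
              (K.trans (ι.*-homo _ _) (K.*-cong (ι.homo-^ q 2) (K.trans (ι.homo-^ _ j) (K.^-congˡ j (ι.homo-^ q 4)))))))))
            bottoms-ι : ι.⟦ BP.bottoms q m ⟧ K.≈ BK.bottoms ι.⟦ q ⟧ m
            bottoms-ι = K.trans (homo-prodK m _) (K.prod-cong m (λ j _ → K.trans (ι.homo-1- _) (K.+-congˡ (K.-‿cong
              (K.trans (ι.homo-^ _ (suc j)) (K.^-congˡ (suc j) (ι.homo-^ q 4)))))))
            B = proj₁ (BP.central q m)
            w = BP.poch⁺ p m
            ratio-value : ratio K.* ι.⟦ w * w ⟧ K.≈ ι.⟦ B ⟧
            ratio-value = K.unit-cancel (K.unit-* unit-bottoms unit-bottoms) (begin
              b K.* b K.* (a K.* b⁻¹ K.* ι.⟦ w * w ⟧)      ≈⟨ K.solve 4 (λ b a i c → b K.:* b K.:* (a K.:* i K.:* c) K.:= b K.:* i K.:* (a K.:* b K.:* c)) K.refl b a b⁻¹ _ ⟩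
              b K.* b⁻¹ K.* (a K.* b K.* ι.⟦ w * w ⟧)      ≈⟨ K.trans (K.*-congʳ (proj₂ unit-bottoms)) (K.*-identityˡ _) ⟩
              a K.* b K.* ι.⟦ w * w ⟧                      ≈⟨ K.*-congʳ (K.*-cong tops-ι bottoms-ι) ⟨
              ι.⟦ BP.tops q m ⟧ K.* ι.⟦ BP.bottoms q m ⟧ K.* ι.⟦ w * w ⟧   ≈⟨ K.trans (ι.*-homo _ _) (K.*-congʳ (ι.*-homo _ _)) ⟨
              ι.⟦ BP.tops q m * BP.bottoms q m * (w * w) ⟧  ≈⟨ ι.⟦⟧-cong (proj₂ (BP.central q m)) ⟩
              ι.⟦ B * (BP.bottoms q m * BP.bottoms q m) ⟧   ≈⟨ K.trans (ι.*-homo _ _) (K.*-congˡ (K.trans (ι.*-homo _ _) (K.*-cong bottoms-ι bottoms-ι))) ⟩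
              ι.⟦ B ⟧ K.* (b K.* b)                         ≈⟨ K.*-comm _ _ ⟩
              b K.* b K.* ι.⟦ B ⟧                           ∎)
              where
              open import Relation.Binary.Reasoning.Setoid K.setoid
              a = BK.tops ι.⟦ q ⟧ m
              b = BK.bottoms ι.⟦ q ⟧ m
              b⁻¹ = proj₁ unit-bottoms
            u-S = square-unit {S} φ unit-S
            ratio⇝ : ratio ⇝ ⟦ B ⟧ S.* proj₁ u-S
            ratio⇝ = specialise B (w * w) (square-unit {K} ιʰ unit-K) u-S ratio-value
              (S.trans (S.*-assoc _ _ _) (S.trans (S.*-congˡ (S.trans (S.*-comm _ _) (proj₂ u-S))) (S.*-identityʳ _)))

          divides-n : .{{_ : ℕ.NonZero d}} → d ≢ 1 → d ℕ.∣ n → ⟦ A₁ ⟧ S.≈ S.0#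
          divides-n d≢1 d∣n@(ℕ.divides N n≡Nd) = ⇝0⇒φ≈0 ι-injective (⇝-cong K.refl (S.-‿inverseʳ S.0#) (⇝-- (sum⇝0 d (d ℕ./ 4) d≡ d≢1 q^d≈1 unit-1-q^ n≡Nd) rhs⇝0)) cleared
            where
            d≡ : d ≡ suc (4 ℕ.* (d ℕ./ 4))
            d≡ = ≡.trans (ℕ.m≡m%n+[m/n]*n d 4) (≡.cong₂ ℕ._+_ (divisor%4≡1 primes d d∣n) (ℕₚ.*-comm (d ℕ./ 4) 4))
            sum⇝0 : ∀ d k → d ≡ suc (4 ℕ.* k) → d ≢ 1 → ⟦ q ⟧ S.^ d S.≈ S.1# → (∀ i → suc i ℕ.< d → S.Unit (S.1# S.- ⟦ q ⟧ S.^ suc i)) →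
              n ≡ N ℕ.* d → K.sum n (TK.conv o α) ⇝ S.0#
            sum⇝0 d k ≡.refl d≢1 e units n≡ = ≡.subst (λ i → K.sum i (TK.conv o α) ⇝ S.0#) (≡.sym n≡)
              (Blocks.Sums.sum-conv⇝0 {P} {K} {S} ιʰ φ q x k den⁻¹ (λ j → proj₂ (unit-denK j)) unit-1-qK^ (0<k k d≢1) e units
                (S.unit-∣ (S.1-y^∣1-y^ ⟦ x ⟧ N n≡) unit-1-x^n) unit-ℕS o N)
              where
              0<k : ∀ k → suc (4 ℕ.* k) ≢ 1 → 0 ℕ.< k
              0<k zero ne = ⊥-elim (ne ≡.refl)
              0<k (suc k) _ = ℕ.s≤s ℕ.z≤n

          vanishes : ⟦ A₁ ⟧ S.≈ S.0#
          vanishes with d ℕ.≟ 1 | d ℕ.∣? n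
          ... | yes d≡1 | _ = collapse-1 d≡1
          ... | no d≢1 | yes d∣n = divides-n {{ℕ.>-nonZero 0<d}} d≢1 d∣n
          ... | no _ | no d∤n = collapse-∤ {{ℕ.>-nonZero 0<d}} d∤n

      module Power {S : Ring₀} (φ : Hom P S) where
        private module S = RingTheory S
        open HomTheory {P} {S} φ using (⟦_⟧)

        module At
          (unit-q : S.Unit ⟦ q ⟧)
          (unit-1-q^ : ∀ i → S.Unit (S.1# S.- ⟦ q ⟧ S.^ suc i))
          (y κ : S.Carrier)
          (unit-κ : S.Unit κ)
          (y-power : y S.≈ ⟦ q ⟧ S.^ n)
          (x-y : ∀ w → (S.1# S.- ⟦ x ⟧ S.* w) S.* (⟦ x ⟧ S.- w) S.≈ κ S.* ((S.1# S.- y S.* w) S.* (y S.- w))) where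

          private
            module SS = Summand S ⟦ q ⟧ ⟦ x ⟧
            module BS = CentralBinomial S
            open Specialisation {P} {K} {S} ιʰ φ hiding (module TK)
            open AtPower.Sums S ⟦ q ⟧ ⟦ x ⟧ y κ m unit-q unit-1-q^ unit-κ (S.trans y-power (S.*-congˡ (S.sym (SS.Q^ m)))) x-y

            den⁻¹S : ℕ → S.Carrier
            den⁻¹S j = proj₁ (unit-den j)

            αS : ℕ → S.Carrier
            αS = SS.α den⁻¹S

            inverseS : ∀ j → SS.den j S.* den⁻¹S j S.≈ S.1#
            inverseS j = proj₂ (unit-den j)

            α⇝ : ∀ k → α k ⇝ αS k
            α⇝ k = ⇝-* (⇝-[] (8 ℕ.* k ℕ.+ 1) (⇝-ι q)) (⇝-prod k λ j _ → ⇝-* (⇝-num q x j) (⇝-inverse (proj₂ (unit-denK j)) (inverseS j) (⇝-den q x j)))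

            total : S.Carrier
            total = S.sum (suc m) αS

            r : ℕ
            r = order o

            sum⇝ : K.sum n (TK.conv o α) ⇝ total S.^ r
            sum⇝ = ⇝-cong K.refl (S.trans (TR.sum-conv o αS n) (TR.truncated-finite αS m (α-vanishes den⁻¹S inverseS) r n (ℕ.s≤s (ℕₚ.*-monoˡ-≤ m (order≤4 o)))))
              (⇝-sum n λ k _ → ⇝-conv α⇝ o k)

            unit-bottomsS : S.Unit (BS.bottoms ⟦ q ⟧ m)
            unit-bottomsS = S.prod-unit m (λ j _ → S.unit-cong (S.+-congˡ (S.-‿cong (S.sym (S.trans (SS.Q^ (suc j)) (S.^-≡ ⟦ q ⟧ ([Q^]-exponent j)))))) (unit-1-q^ (3 ℕ.+ 4 ℕ.* j)))

            b b⁻¹ a : S.Carrier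
            b = BS.bottoms ⟦ q ⟧ m
            b⁻¹ = proj₁ unit-bottomsS
            a = BS.tops ⟦ q ⟧ m

            unit-q^rm : S.Unit (⟦ q ⟧ S.^ (r ℕ.* m))
            unit-q^rm = S.unit-^ (r ℕ.* m) unit-q

            rhsS : S.Carrier
            rhsS = (S.[ n ] ⟦ q ⟧) S.^ r S.* (a S.* b⁻¹) S.^ r S.* proj₁ unit-q^rm

            rhs⇝ : rhs o ⇝ rhsS
            rhs⇝ = ⇝-* (⇝-* (⇝-^ r (⇝-[] n (⇝-ι q))) (⇝-^ r (⇝-* (⇝-prod m λ j _ → ⇝-- ⇝-1 (⇝-* (⇝-^ 2 (⇝-ι q)) (⇝-Q^ q x j)))
              (⇝-inverse (proj₂ unit-bottoms) (proj₂ unit-bottomsS) (⇝-prod m λ j _ → ⇝-- ⇝-1 (⇝-Q^ q x (suc j)))))))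
              (⇝-inverse (proj₂ (K.unit-^ (r ℕ.* m) unit-qK)) (proj₂ unit-q^rm) (⇝-^ (r ℕ.* m) (⇝-ι q)))

            total-q^m : ⟦ q ⟧ S.^ m S.* total S.≈ S.[ n ] ⟦ q ⟧ S.* (a S.* b⁻¹)
            total-q^m = S.unit-cancel unit-bottomsS (begin
              b S.* (⟦ q ⟧ S.^ m S.* total)                ≈⟨ S.solve 3 (λ b u t → b S.:* (u S.:* t) S.:= t S.:* (u S.:* b)) S.refl b (⟦ q ⟧ S.^ m) total ⟩
              total S.* (⟦ q ⟧ S.^ m S.* b)                ≈⟨ sum-α den⁻¹S inverseS ⟩
              S.[ n ] ⟦ q ⟧ S.* a                          ≈⟨ S.trans (S.*-congˡ (proj₂ unit-bottomsS)) (S.*-identityʳ _) ⟨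
              S.[ n ] ⟦ q ⟧ S.* a S.* (b S.* b⁻¹)          ≈⟨ S.solve 4 (λ t a b i → t S.:* a S.:* (b S.:* i) S.:= b S.:* (t S.:* (a S.:* i))) S.refl _ a b b⁻¹ ⟩
              b S.* (S.[ n ] ⟦ q ⟧ S.* (a S.* b⁻¹))        ∎)
              where open import Relation.Binary.Reasoning.Setoid S.setoid

            total-rhs : total S.^ r S.≈ rhsS
            total-rhs = S.unit-cancel unit-q^rm (begin
              ⟦ q ⟧ S.^ (r ℕ.* m) S.* total S.^ r                           ≈⟨ S.*-congʳ (S.trans (S.^-≡ ⟦ q ⟧ (ℕₚ.*-comm r m)) (S.sym (S.^-assocʳ ⟦ q ⟧ m r))) ⟩
              (⟦ q ⟧ S.^ m) S.^ r S.* total S.^ r                           ≈⟨ S.^-distrib-* (⟦ q ⟧ S.^ m) total r ⟨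
              (⟦ q ⟧ S.^ m S.* total) S.^ r                                 ≈⟨ S.^-congˡ r total-q^m ⟩
              (S.[ n ] ⟦ q ⟧ S.* (a S.* b⁻¹)) S.^ r                         ≈⟨ S.^-distrib-* _ _ r ⟩
              X                                                             ≈⟨ S.trans (S.*-congˡ (proj₂ unit-q^rm)) (S.*-identityʳ _) ⟨
              X S.* (⟦ q ⟧ S.^ (r ℕ.* m) S.* proj₁ unit-q^rm)               ≈⟨ S.solve 3 (λ x u i → x S.:* (u S.:* i) S.:= u S.:* (x S.:* i)) S.refl X _ _ ⟩
              ⟦ q ⟧ S.^ (r ℕ.* m) S.* rhsS                                  ∎)
              where
              open import Relation.Binary.Reasoning.Setoid S.setoid
              X = (S.[ n ] ⟦ q ⟧) S.^ r S.* (a S.* b⁻¹) S.^ r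

          vanishes : ⟦ A₁ ⟧ S.≈ S.0#
          vanishes = ⇝0⇒φ≈0 ι-injective (⇝-cong K.refl (S.≈⇒-≈0 total-rhs) (⇝-- sum⇝ rhs⇝)) cleared

      -- P/(p) followed by its total quotient ring. Elements regular modulo p, such as the 1 - x^j,
      -- become units, while vanishing in `S` still means divisibility by p.
      module Local (p : Carrier) where
        open Quotient P p public using (quotient; π; ∣⇒≈0; ≈0⇒∣)
        open TotalQuotient quotient public using () renaming (fractions to S; regular⇒unit to regular⇒unitS)
        private module F = TotalQuotient quotient
        φ : Hom P S
        φ = _∘ʰ_ {P} {quotient} {S} F.ι π
        module S = RingTheory S
        module φ = HomTheory {P} {S} φ
        module Iφ = Image {S} φ

        p≈0 : φ.⟦ p ⟧ S.≈ S.0#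
        p≈0 = S.trans (F-cong (∣⇒≈0 (1# , *-identityʳ p))) F-0
          where open HomTheory {quotient} {S} F.ι renaming (⟦⟧-cong to F-cong; 0#-homo to F-0)

        ≈0⇒p∣ : ∀ {a} → φ.⟦ a ⟧ S.≈ S.0# → p ∣ a
        ≈0⇒p∣ e = ≈0⇒∣ (F.ι-injective (S.trans e (S.sym F-0)))
          where open HomTheory {quotient} {S} F.ι renaming (0#-homo to F-0)

        -- The form in which the pairwise coprimality of the three factors of the modulus is used.
        cancel-unit : ∀ {u a} → S.Unit φ.⟦ u ⟧ → p ∣ u * a → p ∣ a
        cancel-unit {u} {a} w d = ≈0⇒p∣ (S.unit⇒regular w φ.⟦ a ⟧ (S.trans (S.sym (φ.*-homo u a)) (S.trans (F-cong (∣⇒≈0 d)) F-0)))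
          where open HomTheory {quotient} {S} F.ι renaming (⟦⟧-cong to F-cong; 0#-homo to F-0)

        unit-1-x^ : (∀ j → RingTheory.Regular quotient (1# - x ^ suc j)) → ∀ j → S.Unit (S.1# S.- φ.⟦ x ⟧ S.^ suc j)
        unit-1-x^ h j = S.unit-cong (Iφ.1-x^ (suc j)) (regular⇒unitS (h j))

        unit-[n] : (∀ i → S.Unit (S.1# S.- φ.⟦ q ⟧ S.^ suc i)) → S.Unit φ.⟦ [ n ] q ⟧
        unit-[n] h = S.unit-cong (S.sym (φ.homo-[] n q)) (S.unit-∣ (_ , S.trans (S.*-comm _ _) (S.geometric φ.⟦ q ⟧ n)) (h (4 ℕ.* m)))

      private
        module L₁ = Local ([ n ] q)
        module L₂ = Local (x - q ^ n)
        module L₃ = Local (1# - x * q ^ n)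

      -- The splitting is applied after 1 - x^n has been inverted modulo [n], so this unit is
      -- inherited by every ring produced by the idempotents.
      [n]∣A₁ : [ n ] q ∣ A₁
      [n]∣A₁ = L₁.≈0⇒p∣ (Splitting.vanishes-if-at-primitive-roots n (ℕ.s≤s ℕ.z≤n) S φ.⟦ q ⟧ φ.⟦ A₁ ⟧
        (S.unit-cong (S.trans (φ.homo-sum n _) (S.sum-cong n (λ _ _ → φ.1#-homo))) (φ.homo-unit (unit-ℕ (4 ℕ.* m))))
        (S.sym (S.-≈0⇒≈ (S.trans (S.sym (S.geometric φ.⟦ q ⟧ n)) (S.trans (S.*-congˡ [n]≈0) (S.zeroʳ _)))))
        λ T ψ d 0<d (e , units) → let module ψ = HomTheory {S} {T} ψ
                                      module T = RingTheory T
                                  in Primitive.At.vanishes {T} (_∘ʰ_ {P} {S} {T} ψ φ′)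
            (T.trans (T.sym (ψ.homo-[] n φ.⟦ q ⟧)) (T.trans (ψ.⟦⟧-cong [n]≈0) ψ.0#-homo))
            (T.unit-cong (T.trans (ψ.homo-1- _) (T.+-congˡ (T.-‿cong (ψ.homo-^ φ.⟦ x ⟧ n)))) (ψ.homo-unit (L₁.unit-1-x^ regular-1-x^mod₁ (4 ℕ.* m))))
            d 0<d e units)
        where
        open L₁ using (S; module S; module φ) renaming (φ to φ′)
        [n]≈0 : S.[ n ] φ.⟦ q ⟧ S.≈ S.0#
        [n]≈0 = S.trans (S.sym (φ.homo-[] n q)) L₁.p≈0

      private
        module At-x≈q^n where
          open L₂ public

          x≈q^n : φ.⟦ x ⟧ S.≈ φ.⟦ q ⟧ S.^ n
          x≈q^n = S.-≈0⇒≈ (S.trans (S.sym (Iφ.x-q^ n)) p≈0)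

          -- Since x = q^n, the element 1 - q^i divides 1 - q^(ni) = 1 - x^i. That q is no root of
          -- unity is thus inherited from x.
          unit-1-q^ : ∀ i → S.Unit (S.1# S.- φ.⟦ q ⟧ S.^ suc i)
          unit-1-q^ i = S.unit-∣ (S.1-y^∣1-y^ φ.⟦ q ⟧ {suc i} n ≡.refl) (S.unit-cong
            (S.+-congˡ (S.-‿cong (S.trans (S.^-congˡ (suc i) x≈q^n) (S.^-assocʳ φ.⟦ q ⟧ n (suc i))))) (unit-1-x^ regular-1-x^mod₂ i))

          divides : x - q ^ n ∣ A₁
          divides = ≈0⇒p∣ (Power.At.vanishes {S} φ (regular⇒unitS regular-q-mod₂) unit-1-q^ φ.⟦ x ⟧ S.1# S.unit-1 x≈q^n (λ w → S.sym (S.*-identityˡ _)))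

          unit-1-xq^n : S.Unit φ.⟦ 1# - x * q ^ n ⟧
          unit-1-xq^n = S.unit-cong (S.sym (S.trans (Iφ.1-xq^ n) (S.+-congˡ (S.-‿cong (S.trans (S.*-congʳ x≈q^n) (S.sym (S.^-homo-* φ.⟦ q ⟧ n n)))))))
            (unit-1-q^ (4 ℕ.* m ℕ.+ n))

        module At-xq^n≈1 where
          open L₃ public

          xq^n≈1 : φ.⟦ x ⟧ S.* φ.⟦ q ⟧ S.^ n S.≈ S.1#
          xq^n≈1 = S.sym (S.-≈0⇒≈ (S.trans (S.sym (Iφ.1-xq^ n)) p≈0))

          unit-x : S.Unit φ.⟦ x ⟧
          unit-x = _ , xq^n≈1

          unit-q : S.Unit φ.⟦ q ⟧
          unit-q = φ.⟦ q ⟧ S.^ (4 ℕ.* m) S.* φ.⟦ x ⟧ , S.trans (S.sym (S.*-assoc _ _ _)) (S.trans (S.*-comm _ _) xq^n≈1)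

          -- Now q^(ni) is the inverse of x^i, so 1 - q^(ni) agrees with 1 - x^i up to a unit.
          unit-1-q^ : ∀ i → S.Unit (S.1# S.- φ.⟦ q ⟧ S.^ suc i)
          unit-1-q^ i = S.unit-∣ (S.1-y^∣1-y^ φ.⟦ q ⟧ {suc i} n ≡.refl) (S.unit-∣ (X , e) (S.unit-neg (unit-1-x^ regular-1-x^mod₃ i)))
            where
            open import Relation.Binary.Reasoning.Setoid S.setoid
            X = φ.⟦ x ⟧ S.^ suc i
            Y = φ.⟦ q ⟧ S.^ (n ℕ.* suc i)
            e : (S.1# S.- Y) S.* X S.≈ S.- (S.1# S.- X)
            e = begin
              (S.1# S.- Y) S.* X             ≈⟨ S.solve 2 (λ y x → (S.:1 S.:- y) S.:* x S.:= x S.:- x S.:* y) S.refl Y X ⟩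
              X S.- X S.* Y                  ≈⟨ S.+-congˡ (S.-‿cong (S.trans (S.*-congˡ (S.sym (S.^-assocʳ φ.⟦ q ⟧ n (suc i))))
                                                  (S.trans (S.sym (S.^-distrib-* φ.⟦ x ⟧ _ (suc i))) (S.trans (S.^-congˡ (suc i) xq^n≈1) (S.1^ (suc i)))))) ⟩
              X S.- S.1#                     ≈⟨ S.solve 1 (λ x → x S.:- S.:1 S.:= S.:- (S.:1 S.:- x)) S.refl X ⟩
              S.- (S.1# S.- X)               ∎

          divides : 1# - x * q ^ n ∣ A₁
          divides = ≈0⇒p∣ (Power.At.vanishes {S} φ unit-q unit-1-q^ y (φ.⟦ x ⟧ S.* φ.⟦ x ⟧) (S.unit-* unit-x unit-x) S.refl x-y)
            where
            open import Relation.Binary.Reasoning.Setoid S.setoid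
            y = φ.⟦ q ⟧ S.^ n
            x-y : ∀ w → (S.1# S.- φ.⟦ x ⟧ S.* w) S.* (φ.⟦ x ⟧ S.- w) S.≈ φ.⟦ x ⟧ S.* φ.⟦ x ⟧ S.* ((S.1# S.- y S.* w) S.* (y S.- w))
            x-y w = begin
              (S.1# S.- X S.* w) S.* (X S.- w)
                ≈⟨ S.solve 2 (λ x w → (S.:1 S.:- x S.:* w) S.:* (x S.:- w) S.:= (x S.:* S.:1 S.:- S.:1 S.:* w) S.:* (S.:1 S.:- x S.:* w)) S.refl X w ⟩
              (X S.* S.1# S.- S.1# S.* w) S.* (S.1# S.- X S.* w)
                ≈⟨ S.*-cong (S.+-congˡ (S.-‿cong (S.*-congʳ (S.sym xq^n≈1)))) (S.+-congʳ (S.sym xq^n≈1)) ⟩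
              (X S.* S.1# S.- X S.* y S.* w) S.* (X S.* y S.- X S.* w)
                ≈⟨ S.solve 3 (λ x y w → (x S.:* S.:1 S.:- x S.:* y S.:* w) S.:* (x S.:* y S.:- x S.:* w) S.:= x S.:* x S.:* ((S.:1 S.:- y S.:* w) S.:* (y S.:- w))) S.refl X y w ⟩
              X S.* X S.* ((S.1# S.- y S.* w) S.* (y S.- w)) ∎
              where X = φ.⟦ x ⟧

      -- The factors are divided out in turn. The ones already removed stay invertible at the next:
      -- [n] divides 1 - q^n, a unit at both remaining factors, and 1 - xq^n becomes 1 - q^(2n)
      -- where x = q^n.
      modulus∣A₁ : [ n ] q * (1# - x * q ^ n) * (x - q ^ n) ∣ A₁
      modulus∣A₁ = c₃ , trans (*-assoc _ _ c₃) (trans (*-assoc _ _ _) (trans (*-congˡ (trans (*-congˡ e₃) e₂)) e₁))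
        where
        c₁ = proj₁ [n]∣A₁
        e₁ = proj₂ [n]∣A₁
        ∣-resp : ∀ {p a b} → a ≈ b → p ∣ a → p ∣ b
        ∣-resp e (c , f) = c , trans f e
        second : 1# - x * q ^ n ∣ c₁
        second = At-xq^n≈1.cancel-unit (At-xq^n≈1.unit-[n] At-xq^n≈1.unit-1-q^) (∣-resp (sym e₁) At-xq^n≈1.divides)
        c₂ = proj₁ second
        e₂ = proj₂ second
        third : x - q ^ n ∣ c₂
        third = At-x≈q^n.cancel-unit At-x≈q^n.unit-1-xq^n (At-x≈q^n.cancel-unit (At-x≈q^n.unit-[n] At-x≈q^n.unit-1-q^)
          (∣-resp (trans (sym e₁) (*-congˡ (sym e₂))) At-x≈q^n.divides))
        c₃ = proj₁ third
        e₃ = proj₂ third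

-- The summand as a quotient of Pochhammer symbols

module SummandForm (R : Ring₀) (q x x⁻¹ : CommutativeRing.Carrier R)
  (xx⁻¹≈1 : CommutativeRing._≈_ R (CommutativeRing._*_ R x x⁻¹) (CommutativeRing.1# R)) where
  open RingTheory R
  open Summand R q x
  open import Relation.Binary.Reasoning.Setoid setoid

  -- The four Pochhammer symbols of `α`: c = q gives the numerator, c = Q the denominator.
  quadruple : Carrier → ℕ → Carrier
  quadruple c k = prod k (λ j → 1# - c * Q ^ j) ^ 2 * prod k (λ j → 1# - x * c * Q ^ j) * prod k (λ j → 1# - c * x⁻¹ * Q ^ j)

  -- One x for each index turns 1 - (c/x)Q^j into x - cQ^j, the form used in `factor`.
  quadruple-factor : ∀ c k → quadruple c k * x ^ k ≈ prod k (λ j → factor (c * Q ^ j))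
  quadruple-factor c zero = solve 0 (:1 :* (:1 :* :1) :* :1 :* :1 :* :1 := :1) refl
  quadruple-factor c (suc k) = begin
    (A * a) ^ 2 * (B * (1# - x * c * t)) * (C * (1# - c * x⁻¹ * t)) * (x * x ^ k)
      ≈⟨ solve 9 (λ A B C X c x i t a →
           (A :* a) :^ 2 :* (B :* (:1 :- x :* c :* t)) :* (C :* (:1 :- c :* i :* t)) :* (x :* X)
           := A :^ 2 :* B :* C :* X :* (a :* a :* ((:1 :- x :* (c :* t)) :* (x :- x :* i :* (c :* t))))) refl A B C (x ^ k) c x x⁻¹ t a ⟩
    quadruple c k * x ^ k * (a * a * ((1# - x * (c * t)) * (x - x * x⁻¹ * (c * t))))
      ≈⟨ *-cong (quadruple-factor c k) (*-congˡ (*-congˡ (+-congˡ (-‿cong (trans (*-congʳ xx⁻¹≈1) (*-identityˡ _)))))) ⟩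
    prod k (λ j → factor (c * Q ^ j)) * factor (c * Q ^ k) ∎
    where
    t = Q ^ k
    a = 1# - c * t
    A = prod k (λ j → 1# - c * Q ^ j)
    B = prod k (λ j → 1# - x * c * Q ^ j)
    C = prod k (λ j → 1# - c * x⁻¹ * Q ^ j)

  prod-const : ∀ a k → prod k (λ _ → a) ≈ a ^ k
  prod-const a zero = refl
  prod-const a (suc k) = trans (*-congʳ (prod-const a k)) (*-comm _ a)

  module _ (den⁻¹ : ℕ → Carrier) (inverse : ∀ j → den j * den⁻¹ j ≈ 1#) where

    unit-quadruple : ∀ k → Unit (quadruple Q k)
    unit-quadruple k = unit-∣ (x ^ k , quadruple-factor Q k) (prod-unit k (λ j _ → den⁻¹ j , inverse j))

    α-form : ∀ k → q ^ (2 ℕ.* k) * [ 8 ℕ.* k ℕ.+ 1 ] q * (quadruple q k * proj₁ (unit-quadruple k)) ≈ α den⁻¹ k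
    α-form k = unit-cancel (unit-* (unit-quadruple k) unit-x^k) (begin
      D * X * (S * W * (N * D⁻¹))                     ≈⟨ solve 6 (λ D X S W N I → D :* X :* (S :* W :* (N :* I)) := D :* I :* (W :* (S :* (N :* X)))) refl D X S W N D⁻¹ ⟩
      D * D⁻¹ * (W * (S * (N * X)))                   ≈⟨ *-cong (proj₂ (unit-quadruple k)) (*-congˡ (*-cong S≈ (quadruple-factor q k))) ⟩
      1# * (W * (prod k (λ _ → q ^ 2) * prod k (λ j → factor (q * Q ^ j))))
                                                      ≈⟨ trans (*-identityˡ _) (*-congˡ (sym (prod-* k _ _))) ⟩
      W * prod k num                                  ≈⟨ *-congˡ (trans (prod-cong k (λ j _ → sym (cleared j))) (prod-* k _ den)) ⟩
      W * (β den⁻¹ k * prod k den)                    ≈⟨ *-congˡ (*-congˡ (quadruple-factor Q k)) ⟨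
      W * (β den⁻¹ k * (D * X))                       ≈⟨ solve 4 (λ W b D X → W :* (b :* (D :* X)) := D :* X :* (W :* b)) refl W (β den⁻¹ k) D X ⟩
      D * X * (W * β den⁻¹ k)                         ∎)
      where
      S = q ^ (2 ℕ.* k)
      W = [ 8 ℕ.* k ℕ.+ 1 ] q
      N = quadruple q k
      D = quadruple Q k
      D⁻¹ = proj₁ (unit-quadruple k)
      X = x ^ k
      unit-x^k : Unit X
      unit-x^k = unit-^ k (x⁻¹ , xx⁻¹≈1)
      S≈ : S ≈ prod k (λ _ → q ^ 2)
      S≈ = trans (sym (^-assocʳ q 2 k)) (sym (prod-const (q ^ 2) k))
      cleared : ∀ j → num j * den⁻¹ j * den j ≈ num j
      cleared j = trans (*-assoc _ _ _) (trans (*-congˡ (trans (*-comm _ _) (inverse j))) (*-identityʳ _))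

-- Polynomial rings

-- Addition and multiplication are parameters, so that the two levels of the
-- polynomials of Defs are instances.
module Polynomials (C : Ring₀)
  (_⊕_ _⊛_ : List (CommutativeRing.Carrier C) → List (CommutativeRing.Carrier C) → List (CommutativeRing.Carrier C))
  ([]⊕ : ∀ r → [] ⊕ r ≡ r)
  (∷⊕[] : ∀ a p → (a ∷ p) ⊕ [] ≡ a ∷ p)
  (∷⊕∷ : ∀ a p b r → (a ∷ p) ⊕ (b ∷ r) ≡ CommutativeRing._+_ C a b ∷ (p ⊕ r))
  ([]⊛ : ∀ r → [] ⊛ r ≡ [])
  (∷⊛ : ∀ a p r → (a ∷ p) ⊛ r ≡ map (CommutativeRing._*_ C a) r ⊕ (CommutativeRing.0# C ∷ (p ⊛ r))) where
  open RingTheory C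

  private
    L = List Carrier

  co : L → ℕ → Carrier
  co [] _ = 0#
  co (a ∷ p) zero = a
  co (a ∷ p) (suc i) = co p i

  infix 4 _≋_
  -- Coefficientwise, so that trailing zeros do not matter.
  record _≋_ (p r : L) : Set where
    constructor mk
    field at : ∀ i → co p i ≈ co r i
  open _≋_ public

  infixr 30 _·_
  _·_ : Carrier → L → L
  a · r = map (a *_) r

  X : L → L
  X p = 0# ∷ p

  ⊖ : L → L
  ⊖ = map (λ a → - a)

  co-⊕ : ∀ p r i → co (p ⊕ r) i ≈ co p i + co r i
  co-⊕ [] r i rewrite []⊕ r = sym (+-identityˡ _)
  co-⊕ (a ∷ p) [] i rewrite ∷⊕[] a p = sym (+-identityʳ _)
  co-⊕ (a ∷ p) (b ∷ r) zero rewrite ∷⊕∷ a p b r = refl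
  co-⊕ (a ∷ p) (b ∷ r) (suc i) rewrite ∷⊕∷ a p b r = co-⊕ p r i

  co-· : ∀ a r i → co (a · r) i ≈ a * co r i
  co-· a [] i = sym (zeroʳ a)
  co-· a (b ∷ r) zero = refl
  co-· a (b ∷ r) (suc i) = co-· a r i

  co-⊖ : ∀ r i → co (⊖ r) i ≈ - co r i
  co-⊖ [] i = sym -0#≈0#
  co-⊖ (b ∷ r) zero = refl
  co-⊖ (b ∷ r) (suc i) = co-⊖ r i

  ≋-refl : ∀ {p} → p ≋ p
  ≋-refl = mk λ i → refl

  ≋-sym : ∀ {p r} → p ≋ r → r ≋ p
  ≋-sym e = mk λ i → sym (at e i)

  ≋-trans : ∀ {p r s} → p ≋ r → r ≋ s → p ≋ s
  ≋-trans e f = mk λ i → trans (at e i) (at f i)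

  ≋-≡ : ∀ {p r} → p ≡ r → p ≋ r
  ≋-≡ ≡.refl = ≋-refl

  ∷-cong : ∀ {a b p r} → a ≈ b → p ≋ r → a ∷ p ≋ b ∷ r
  ∷-cong e f = mk λ { zero → e ; (suc i) → at f i }

  ∷-tail-[] : ∀ {a p} → a ∷ p ≋ [] → p ≋ []
  ∷-tail-[] e = mk λ i → at e (suc i)

  ∷≋[] : ∀ {a p} → a ≈ 0# → p ≋ [] → a ∷ p ≋ []
  ∷≋[] e f = mk λ { zero → e ; (suc i) → at f i }

  ⊕-cong : ∀ {p p′ r r′} → p ≋ p′ → r ≋ r′ → p ⊕ r ≋ p′ ⊕ r′
  ⊕-cong {p} {p′} {r} {r′} e f = mk λ i → trans (co-⊕ p r i) (trans (+-cong (at e i) (at f i)) (sym (co-⊕ p′ r′ i)))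

  ·-cong : ∀ {a b p r} → a ≈ b → p ≋ r → a · p ≋ b · r
  ·-cong {a} {b} {p} {r} e f = mk λ i → trans (co-· a p i) (trans (*-cong e (at f i)) (sym (co-· b r i)))

  ⊖-cong : ∀ {p r} → p ≋ r → ⊖ p ≋ ⊖ r
  ⊖-cong {p} {r} e = mk λ i → trans (co-⊖ p i) (trans (-‿cong (at e i)) (sym (co-⊖ r i)))

  ⊕-assoc : ∀ p r s → (p ⊕ r) ⊕ s ≋ p ⊕ (r ⊕ s)
  ⊕-assoc p r s = mk λ i → trans (co-⊕ (p ⊕ r) s i) (trans (+-congʳ (co-⊕ p r i)) (trans (+-assoc _ _ _)
    (sym (trans (co-⊕ p (r ⊕ s) i) (+-congˡ (co-⊕ r s i))))))

  ⊕-comm : ∀ p r → p ⊕ r ≋ r ⊕ p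
  ⊕-comm p r = mk λ i → trans (co-⊕ p r i) (trans (+-comm _ _) (sym (co-⊕ r p i)))

  ⊕-identityˡ : ∀ p → [] ⊕ p ≋ p
  ⊕-identityˡ p = ≋-≡ ([]⊕ p)

  ⊕-identityʳ : ∀ p → p ⊕ [] ≋ p
  ⊕-identityʳ p = ≋-trans (⊕-comm p []) (⊕-identityˡ p)

  ⊖-inverseˡ : ∀ p → ⊖ p ⊕ p ≋ []
  ⊖-inverseˡ p = mk λ i → trans (co-⊕ (⊖ p) p i) (trans (+-congʳ (co-⊖ p i)) (-‿inverseˡ _))

  ⊕-interchange : ∀ p r s t → (p ⊕ r) ⊕ (s ⊕ t) ≋ (p ⊕ s) ⊕ (r ⊕ t)
  ⊕-interchange p r s t = mk λ i → trans (trans (co-⊕ (p ⊕ r) (s ⊕ t) i) (+-cong (co-⊕ p r i) (co-⊕ s t i)))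
    (trans (solve 4 (λ a b c d → (a :+ b) :+ (c :+ d) := (a :+ c) :+ (b :+ d)) refl _ _ _ _)
    (sym (trans (co-⊕ (p ⊕ s) (r ⊕ t) i) (+-cong (co-⊕ p s i) (co-⊕ r t i)))))

  ·-⊕ : ∀ a p r → a · (p ⊕ r) ≋ a · p ⊕ a · r
  ·-⊕ a p r = mk λ i → trans (co-· a (p ⊕ r) i) (trans (*-congˡ (co-⊕ p r i)) (trans (distribˡ a _ _)
    (sym (trans (co-⊕ (a · p) (a · r) i) (+-cong (co-· a p i) (co-· a r i))))))

  X-⊕ : ∀ p r → X (p ⊕ r) ≋ X p ⊕ X r
  X-⊕ p r = mk λ { zero → sym (trans (co-⊕ (X p) (X r) 0) (+-identityˡ 0#)) ; (suc i) → trans (co-⊕ p r i) (sym (co-⊕ (X p) (X r) (suc i))) }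

  X-[] : X [] ≋ []
  X-[] = ∷≋[] refl ≋-refl

  ·-X : ∀ a p → a · X p ≋ X (a · p)
  ·-X a p = ∷-cong (zeroʳ a) ≋-refl

  ·-· : ∀ a b p → a · b · p ≋ (a * b) · p
  ·-· a b p = mk λ i → trans (co-· a (b · p) i) (trans (*-congˡ (co-· b p i)) (trans (sym (*-assoc a b _)) (sym (co-· (a * b) p i))))

  0· : ∀ p → 0# · p ≋ []
  0· p = mk λ i → trans (co-· 0# p i) (zeroˡ _)

  1· : ∀ p → 1# · p ≋ p
  1· p = mk λ i → trans (co-· 1# p i) (*-identityˡ _)

  ⊛-congˡ : ∀ p {r r′} → r ≋ r′ → p ⊛ r ≋ p ⊛ r′
  ⊛-congˡ [] {r} {r′} e rewrite []⊛ r | []⊛ r′ = ≋-refl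
  ⊛-congˡ (a ∷ p) {r} {r′} e rewrite ∷⊛ a p r | ∷⊛ a p r′ = ⊕-cong (·-cong refl e) (∷-cong refl (⊛-congˡ p e))

  ⊛-zeroʳ : ∀ p → p ⊛ [] ≋ []
  ⊛-zeroʳ [] rewrite []⊛ [] = ≋-refl
  ⊛-zeroʳ (a ∷ p) rewrite ∷⊛ a p [] = ≋-trans (⊕-identityˡ _) (≋-trans (∷-cong refl (⊛-zeroʳ p)) X-[])

  -- The defining recursion mirrored in the second argument; commutativity is the match of the two.
  ⊛-∷ : ∀ p b r → p ⊛ (b ∷ r) ≋ b · p ⊕ X (p ⊛ r)
  ⊛-∷ [] b r rewrite []⊛ (b ∷ r) | []⊛ r = ≋-sym (≋-trans (⊕-identityˡ _) X-[])
  ⊛-∷ (a ∷ p) b r rewrite ∷⊛ a p (b ∷ r) | ∷⊛ a p r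
    | ∷⊕∷ (a * b) (map (a *_) r) 0# (p ⊛ (b ∷ r)) | ∷⊕∷ (b * a) (map (b *_) p) 0# (map (a *_) r ⊕ (0# ∷ (p ⊛ r))) =
    ∷-cong (+-congʳ (*-comm a b)) (≋-trans (⊕-cong ≋-refl (⊛-∷ p b r)) (≋-trans (≋-sym (⊕-assoc (a · r) (b · p) _))
      (≋-trans (⊕-cong (⊕-comm (a · r) (b · p)) ≋-refl) (⊕-assoc (b · p) (a · r) _))))

  ⊛-comm : ∀ p r → p ⊛ r ≋ r ⊛ p
  ⊛-comm [] r rewrite []⊛ r = ≋-sym (⊛-zeroʳ r)
  ⊛-comm (a ∷ p) r = ≋-trans (≋-≡ (∷⊛ a p r)) (≋-trans (⊕-cong ≋-refl (∷-cong refl (⊛-comm p r))) (≋-sym (⊛-∷ r a p)))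

  -- Equal polynomials may be lists of different length, which blocks recursion on the left
  -- argument; commutativity moves it to the right.
  ⊛-cong : ∀ {p p′ r r′} → p ≋ p′ → r ≋ r′ → p ⊛ r ≋ p′ ⊛ r′
  ⊛-cong {p} {p′} {r} {r′} e f = ≋-trans (⊛-congˡ p f) (≋-trans (⊛-comm p r′) (≋-trans (⊛-congˡ r′ e) (⊛-comm r′ p′)))

  ⊛-distribˡ : ∀ p r s → p ⊛ (r ⊕ s) ≋ (p ⊛ r) ⊕ (p ⊛ s)
  ⊛-distribˡ [] r s rewrite []⊛ (r ⊕ s) | []⊛ r | []⊛ s = ≋-sym (⊕-identityˡ [])
  ⊛-distribˡ (a ∷ p) r s rewrite ∷⊛ a p (r ⊕ s) | ∷⊛ a p r | ∷⊛ a p s =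
    ≋-trans (⊕-cong (·-⊕ a r s) (≋-trans (∷-cong refl (⊛-distribˡ p r s)) (X-⊕ (p ⊛ r) (p ⊛ s)))) (⊕-interchange (a · r) (a · s) _ _)

  ⊛-distribʳ : ∀ p r s → (r ⊕ s) ⊛ p ≋ (r ⊛ p) ⊕ (s ⊛ p)
  ⊛-distribʳ p r s = ≋-trans (⊛-comm (r ⊕ s) p) (≋-trans (⊛-distribˡ p r s) (⊕-cong (⊛-comm p r) (⊛-comm p s)))

  X-⊛ : ∀ p r → X p ⊛ r ≋ X (p ⊛ r)
  X-⊛ p r = ≋-trans (≋-≡ (∷⊛ 0# p r)) (≋-trans (⊕-cong (0· r) ≋-refl) (⊕-identityˡ _))

  ·-⊛ : ∀ a p r → (a · p) ⊛ r ≋ a · (p ⊛ r)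
  ·-⊛ a [] r rewrite []⊛ r = ≋-refl
  ·-⊛ a (b ∷ p) r rewrite ∷⊛ (a * b) (a · p) r | ∷⊛ b p r =
    ≋-trans (⊕-cong (≋-sym (·-· a b r)) (≋-trans (∷-cong refl (·-⊛ a p r)) (≋-sym (·-X a (p ⊛ r))))) (≋-sym (·-⊕ a (b · r) _))

  ⊛-assoc : ∀ p r s → (p ⊛ r) ⊛ s ≋ p ⊛ (r ⊛ s)
  ⊛-assoc [] r s rewrite []⊛ r | []⊛ s | []⊛ (r ⊛ s) = ≋-refl
  ⊛-assoc (a ∷ p) r s rewrite ∷⊛ a p r | ∷⊛ a p (r ⊛ s) =
    ≋-trans (⊛-distribʳ s (a · r) _) (⊕-cong (·-⊛ a r s) (≋-trans (X-⊛ (p ⊛ r) s) (∷-cong refl (⊛-assoc p r s))))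

  ⊛-identityˡ : ∀ p → (1# ∷ []) ⊛ p ≋ p
  ⊛-identityˡ p rewrite ∷⊛ 1# [] p | []⊛ p = ≋-trans (⊕-cong (1· p) X-[]) (⊕-identityʳ p)

  polynomialRing : Ring₀
  polynomialRing = record
    { Carrier = L ; _≈_ = _≋_ ; _+_ = _⊕_ ; _*_ = _⊛_ ; -_ = ⊖ ; 0# = [] ; 1# = 1# ∷ []
    ; isCommutativeRing = record
      { isRing = record
        { +-isAbelianGroup = record
          { isGroup = record
            { isMonoid = record
              { isSemigroup = record
                { isMagma = record
                  { isEquivalence = record { refl = ≋-refl ; sym = ≋-sym ; trans = ≋-trans }
                  ; ∙-cong = ⊕-cong }
                ; assoc = ⊕-assoc }
              ; identity = ⊕-identityˡ , ⊕-identityʳ }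
            ; inverse = ⊖-inverseˡ , λ p → ≋-trans (⊕-comm p (⊖ p)) (⊖-inverseˡ p)
            ; ⁻¹-cong = ⊖-cong }
          ; comm = ⊕-comm }
        ; *-cong = ⊛-cong
        ; *-assoc = ⊛-assoc
        ; *-identity = ⊛-identityˡ , λ p → ≋-trans (⊛-comm p _) (⊛-identityˡ p)
        ; distrib = ⊛-distribˡ , ⊛-distribʳ }
      ; *-comm = ⊛-comm } }

  const-⊛ : ∀ a r → (a ∷ []) ⊛ r ≋ a · r
  const-⊛ a r rewrite ∷⊛ a [] r | []⊛ r = ≋-trans (⊕-cong ≋-refl X-[]) (⊕-identityʳ _)

  constant : Hom C polynomialRing
  constant = mkHom {C} {polynomialRing} (_∷ []) (λ e → ∷-cong e ≋-refl)
    (λ a b → ≋-≡ (≡.sym (≡.trans (∷⊕∷ a [] b []) (≡.cong ((a + b) ∷_) ([]⊕ [])))))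
    (λ a b → ≋-sym (const-⊛ a (b ∷ [])))
    ≋-refl

  co-⊛-0 : ∀ p r → co (p ⊛ r) 0 ≈ co p 0 * co r 0
  co-⊛-0 [] r rewrite []⊛ r = sym (zeroˡ _)
  co-⊛-0 (a ∷ p) r rewrite ∷⊛ a p r = trans (co-⊕ (a · r) _ 0) (trans (+-cong (co-· a r 0) refl) (+-identityʳ _))

  constantTerm : Hom polynomialRing C
  constantTerm = mkHom {polynomialRing} {C} (λ p → co p 0) (λ e → at e 0) (λ p r → co-⊕ p r 0) co-⊛-0 refl

  -- Zero divisors and degrees over an integral domain

  module _ (_≟0 : ∀ a → Dec (a ≈ 0#)) where

    _≟[] : ∀ p → Dec (p ≋ [])
    [] ≟[] = yes ≋-refl
    (a ∷ p) ≟[] with a ≟0 | p ≟[]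
    ... | yes e | yes f = yes (∷≋[] e f)
    ... | no ¬e | _     = no λ e → ¬e (at e 0)
    ... | yes _ | no ¬f = no λ e → ¬f (∷-tail-[] e)

    nonzero-coefficient : ∀ p → ¬ (p ≋ []) → ∃ λ i → ¬ (co p i ≈ 0#)
    nonzero-coefficient [] ne = ⊥-elim (ne ≋-refl)
    nonzero-coefficient (a ∷ p) ne with a ≟0
    ... | no ¬e = 0 , ¬e
    ... | yes e = let (i , h) = nonzero-coefficient p (λ f → ne (∷≋[] e f)) in suc i , h

    Degree : L → ℕ → Set
    Degree p k = ¬ (co p k ≈ 0#) × (∀ i → k ℕ.< i → co p i ≈ 0#)

    degree : ∀ p → p ≋ [] ⊎ ∃ (Degree p)
    degree [] = inj₁ ≋-refl
    degree (a ∷ p) with degree p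
    ... | inj₂ (k , ne , z) = inj₂ (suc k , ne , λ { (suc i) k<i → z i (ℕₚ.≤-pred k<i) })
    ... | inj₁ f with a ≟0
    ...   | yes e = inj₁ (∷≋[] e f)
    ...   | no ¬e = inj₂ (0 , ¬e , λ { (suc i) _ → at f i })

    module _ (zero-divisor : ∀ a b → a * b ≈ 0# → a ≈ 0# ⊎ b ≈ 0#) where

      -- One of the two constant terms must be 0; that factor is then a multiple of the variable,
      -- which can be cancelled, and its list gets shorter.
      ⊛-zero-divisor : ∀ p r → p ⊛ r ≋ [] → p ≋ [] ⊎ r ≋ []
      ⊛-zero-divisor [] r e = inj₁ ≋-refl
      ⊛-zero-divisor p [] e = inj₂ ≋-refl
      ⊛-zero-divisor (a ∷ p) (b ∷ r) e = [
        (λ a≈0 → map₁ (∷≋[] a≈0) (⊛-zero-divisor p (b ∷ r) (∷-tail-[] (≋-trans (≋-sym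
          (≋-trans (⊛-cong {r = b ∷ r} (∷-cong a≈0 ≋-refl) ≋-refl) (X-⊛ p (b ∷ r)))) e)))) ,
        (λ b≈0 → map₂ (∷≋[] b≈0) (⊛-zero-divisor (a ∷ p) r (∷-tail-[] (≋-trans (≋-sym
          (≋-trans (⊛-∷ (a ∷ p) b r) (≋-trans (⊕-cong (≋-trans (·-cong b≈0 ≋-refl) (0· (a ∷ p))) ≋-refl) (⊕-identityˡ _)))) e)))) ]′
        (zero-divisor a b (trans (sym (co-⊛-0 (a ∷ p) (b ∷ r))) (at e 0)))

      Degree-⊛ : ∀ p r {k l} → Degree p k → Degree r l → Degree (p ⊛ r) (k ℕ.+ l)
      Degree-⊛ [] r (ne , _) _ = ⊥-elim (ne refl)
      Degree-⊛ (a ∷ p) r {zero} {l} (a≉0 , z) (ne , z′) =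
        (λ e → case (zero-divisor a (co r l) (trans (sym (coefficient l)) e)))
        , λ i l<i → trans (coefficient i) (trans (*-congˡ (z′ i l<i)) (zeroʳ a))
        where
        case : ¬ (a ≈ 0# ⊎ co r l ≈ 0#)
        case (inj₁ e) = a≉0 e
        case (inj₂ e) = ne e
        coefficient : ∀ i → co ((a ∷ p) ⊛ r) i ≈ a * co r i
        coefficient i = trans (at (⊛-cong {r = r} (∷-cong refl (mk λ j → z (suc j) (ℕ.s≤s ℕ.z≤n))) ≋-refl) i) (trans (at (const-⊛ a r) i) (co-· a r i))
      Degree-⊛ (a ∷ p) r {suc k} {l} (ne , z) dr@(_ , z′) =
        (λ e → proj₁ d (trans (sym (coefficient (k ℕ.+ l) (ℕₚ.m≤n+m l k))) e))
        , λ { (suc i) h → trans (coefficient i (ℕₚ.≤-trans (ℕₚ.m≤n+m l k) (ℕₚ.<⇒≤ (ℕₚ.≤-pred h)))) (proj₂ d i (ℕₚ.≤-pred h)) }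
        where
        d = Degree-⊛ p r (ne , λ i k<i → z (suc i) (ℕ.s≤s k<i)) dr
        coefficient : ∀ i → l ℕ.≤ i → co ((a ∷ p) ⊛ r) (suc i) ≈ co (p ⊛ r) i
        coefficient i l≤i rewrite ∷⊛ a p r = trans (co-⊕ (a · r) _ (suc i))
          (trans (+-congʳ (trans (co-· a r (suc i)) (trans (*-congˡ (z′ (suc i) (ℕ.s≤s l≤i))) (zeroʳ a)))) (+-identityˡ _))

      -- Degrees add over a domain. With e = 0 this keeps a cofactor within the bounds of the
      -- product; with e = 1 it lowers the bound.
      degree-bound : ∀ d c {e B} → (∃ λ i → e ℕ.≤ i × ¬ (co d i ≈ 0#)) →
        (∀ i → e ℕ.+ B ℕ.≤ i → co (d ⊛ c) i ≈ 0#) → ∀ i → B ℕ.≤ i → co c i ≈ 0#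
      degree-bound d c {e} {B} (j , e≤j , ne) z i B≤i with degree c
      ... | inj₁ c≈0 = at c≈0 i
      ... | inj₂ (l , dc) with degree d
      ...   | inj₁ d≈0 = ⊥-elim (ne (at d≈0 j))
      ...   | inj₂ (k , dd) with ℕₚ.<-≤-connex l B
      ...     | inj₁ l<B = proj₂ dc i (ℕₚ.<-≤-trans l<B B≤i)
      ...     | inj₂ B≤l = ⊥-elim (proj₁ (Degree-⊛ d c dd dc) (z (k ℕ.+ l) (ℕₚ.+-mono-≤ (ℕₚ.≤-trans e≤j j≤k) B≤l)))
        where
        j≤k : j ℕ.≤ k
        j≤k = ℕₚ.≮⇒≥ (λ k<j → ne (proj₂ dd j k<j))

  -- The constant term of p is a unit modulo r, so p can be divided out as a power series modulo r:
  -- the lowest coefficient of c is a multiple of r, and removing it leaves an equation of the same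
  -- kind for the tail.
  scalar-divides : ∀ r p {v s} → co p 0 * v ≈ 1# + r * s → ∀ c g → p ⊛ c ≋ r · g → ∃ λ h → c ≋ r · h
  scalar-divides r p e [] g f = [] , ≋-refl
  scalar-divides r p {v} {s} e (c₀ ∷ c) g f = let (h , f″) = scalar-divides r p {v} {s} e c _ f′ in (d₀ ∷ h) , ∷-cong c₀≈ f″
    where
    open import Relation.Binary.Reasoning.Setoid setoid
    p₀ = co p 0
    -- Read off from c₀ = (1 + rs)c₀ - rsc₀, where (1 + rs)c₀ = v p₀ c₀ and p₀ c₀ = r g₀.
    d₀ = v * co g 0 - s * c₀
    c₀≈ : c₀ ≈ r * d₀
    c₀≈ = begin
      c₀                                     ≈⟨ solve 3 (λ c r s → c := (:1 :+ r :* s) :* c :- r :* (s :* c)) refl c₀ r s ⟩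
      (1# + r * s) * c₀ - r * (s * c₀)       ≈⟨ +-congʳ (*-congʳ e) ⟨
      p₀ * v * c₀ - r * (s * c₀)             ≈⟨ +-congʳ (solve 3 (λ p v c → p :* v :* c := v :* (p :* c)) refl p₀ v c₀) ⟩
      v * (p₀ * c₀) - r * (s * c₀)           ≈⟨ +-congʳ (*-congˡ (trans (sym (co-⊛-0 p (c₀ ∷ c))) (trans (at f 0) (co-· r g 0)))) ⟩
      v * (r * co g 0) - r * (s * c₀)        ≈⟨ solve 5 (λ v r g s c → v :* (r :* g) :- r :* (s :* c) := r :* (v :* g :- s :* c)) refl v r (co g 0) s c₀ ⟩
      r * d₀                                 ∎
    tl : L → L
    tl [] = []
    tl (_ ∷ p) = p
    co-tl : ∀ p i → co (tl p) i ≈ co p (suc i)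
    co-tl [] i = refl
    co-tl (_ ∷ p) i = refl
    -- The new cofactor of r is (g - d₀ p) shifted down by one degree.
    f′ : p ⊛ c ≋ r · (tl g ⊕ ⊖ (d₀ · tl p))
    f′ = mk λ i → begin
      co (p ⊛ c) i
        ≈⟨ solve 2 (λ a b → b := a :+ b :- a) refl (c₀ * co p (suc i)) _ ⟩
      c₀ * co p (suc i) + co (p ⊛ c) i - c₀ * co p (suc i)
        ≈⟨ +-congʳ (trans (at (⊛-∷ p c₀ c) (suc i)) (trans (co-⊕ (c₀ · p) _ (suc i)) (+-congʳ (co-· c₀ p (suc i))))) ⟨
      co (p ⊛ (c₀ ∷ c)) (suc i) - c₀ * co p (suc i)
        ≈⟨ +-cong (trans (at f (suc i)) (co-· r g (suc i))) (-‿cong (*-congʳ c₀≈)) ⟩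
      r * co g (suc i) - r * d₀ * co p (suc i)
        ≈⟨ solve 4 (λ r g d p → r :* g :- r :* d :* p := r :* (g :- d :* p)) refl r _ d₀ _ ⟩
      r * (co g (suc i) - d₀ * co p (suc i))
        ≈⟨ *-congˡ (trans (co-⊕ (tl g) (⊖ (d₀ · tl p)) i) (+-cong (co-tl g i) (trans (co-⊖ (d₀ · tl p) i) (-‿cong (trans (co-· d₀ (tl p) i) (*-congˡ (co-tl p i))))))) ⟨
      r * co (tl g ⊕ ⊖ (d₀ · tl p)) i
        ≈⟨ co-· r (tl g ⊕ ⊖ (d₀ · tl p)) i ⟨
      co (r · (tl g ⊕ ⊖ (d₀ · tl p))) i ∎

open import Defs

-- The ring ℚ[x,q]

ℚ-ring : Ring₀
ℚ-ring = ℚₚ.+-*-commutativeRing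

-- `U` is ℚ[x], and `B` below is ℚ[x][q]. All recursion equations hold by `≡.refl`, so these rings
-- have the very operations of the theorem.
module U = Polynomials ℚ-ring _+₁_ _*₁_ (λ _ → ≡.refl) (λ _ _ → ≡.refl) (λ _ _ _ _ → ≡.refl) (λ _ → ≡.refl) (λ _ _ _ → ≡.refl)
module B = Polynomials U.polynomialRing _+ᴾ_ _*ᴾ_ (λ _ → ≡.refl) (λ _ _ → ≡.refl) (λ _ _ _ _ → ≡.refl) (λ _ → ≡.refl) (λ _ _ _ → ≡.refl)

P-ring : Ring₀
P-ring = B.polynomialRing

module P = RingTheory P-ring
private module ℚ′ = RingTheory ℚ-ring

entry : Poly → ℕ → ℕ → ℚ
entry p i j = U.co (B.co p i) j

coeff₁-co : ∀ a j → coeff₁ a j ≡ U.co a j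
coeff₁-co [] j = ≡.refl
coeff₁-co (_ ∷ a) zero = ≡.refl
coeff₁-co (_ ∷ a) (suc j) = coeff₁-co a j

coeff-entry : ∀ p i j → coeff p i j ≡ entry p i j
coeff-entry [] i j = ≡.refl
coeff-entry (a ∷ p) zero j = coeff₁-co a j
coeff-entry (a ∷ p) (suc i) j = coeff-entry p i j

entries⇒≈ : ∀ {p r} → (∀ i j → entry p i j ≡ entry r i j) → p P.≈ r
entries⇒≈ h = B.mk λ i → U.mk λ j → h i j

entry-cong : ∀ {p r} → p P.≈ r → ∀ i j → entry p i j ≡ entry r i j
entry-cong e i j = U.at (B.at e i) j

≈⇒≈ᴾ : ∀ {p r} → p P.≈ r → p ≈ᴾ r
≈⇒≈ᴾ {p} {r} e i j = ≡.trans (coeff-entry p i j) (≡.trans (entry-cong e i j) (≡.sym (coeff-entry r i j)))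

≈ᴾ⇒≈ : ∀ {p r} → p ≈ᴾ r → p P.≈ r
≈ᴾ⇒≈ {p} {r} e = entries⇒≈ λ i j → ≡.trans (≡.sym (coeff-entry p i j)) (≡.trans (e i j) (coeff-entry r i j))

ℚ-inverse : ∀ a → a ≢ 0ℚ → ∃ λ b → a ℚ.* b ≡ 1ℚ
ℚ-inverse a a≢0 = (ℚ.1/ a) {{nz}} , ℚₚ.*-inverseʳ a {{nz}}
  where nz = ℚ.≢-nonZero a≢0

ℚ-zero-divisor : ∀ a b → a ℚ.* b ≡ 0ℚ → a ≡ 0ℚ ⊎ b ≡ 0ℚ
ℚ-zero-divisor a b e with a ℚ.≟ 0ℚ
... | yes a≡0 = inj₁ a≡0
... | no a≢0 = inj₂ (ℚ′.unit⇒regular {a} (ℚ-inverse a a≢0) b e)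

ℚ-decide : ∀ a → Dec (a ≡ 0ℚ)
ℚ-decide a = a ℚ.≟ 0ℚ

P₁-decide : ∀ a → Dec (a U.≋ [])
P₁-decide = U._≟[] ℚ-decide

P-decide : ∀ p → Dec (p P.≈ P.0#)
P-decide = B._≟[] P₁-decide

P₁-zero-divisor : ∀ a b → (a *₁ b) U.≋ [] → a U.≋ [] ⊎ b U.≋ []
P₁-zero-divisor = U.⊛-zero-divisor ℚ-decide ℚ-zero-divisor

P-zero-divisor : ∀ p r → (p *ᴾ r) P.≈ P.0# → p P.≈ P.0# ⊎ r P.≈ P.0#
P-zero-divisor = B.⊛-zero-divisor P₁-decide P₁-zero-divisor

nonzero⇒regular : ∀ {p} → ¬ (p P.≈ P.0#) → P.Regular p
nonzero⇒regular {p} ne r e with P-zero-divisor p r e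
... | inj₁ f = ⊥-elim (ne f)
... | inj₂ f = f

κ : Hom ℚ-ring P-ring
κ = _∘ʰ_ {ℚ-ring} {U.polynomialRing} {P-ring} B.constant U.constant

module κ = HomTheory {ℚ-ring} {P-ring} κ

entry-+ : ∀ p r i j → entry (p +ᴾ r) i j ≡ entry p i j ℚ.+ entry r i j
entry-+ p r i j = ≡.trans (U.at (B.co-⊕ p r i) j) (U.co-⊕ (B.co p i) (B.co r i) j)

entry-neg : ∀ p i j → entry (-ᴾ p) i j ≡ ℚ.- entry p i j
entry-neg p i j = ≡.trans (U.at (B.co-⊖ p i) j) (U.co-⊖ (B.co p i) j)

entry-κ : ∀ c p i j → entry (κ.⟦ c ⟧ *ᴾ p) i j ≡ c ℚ.* entry p i j
entry-κ c p i j = ≡.trans (U.at (B.at (B.const-⊛ (c ∷ []) p) i) j)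
  (≡.trans (U.at (B.co-· (c ∷ []) p i) j) (≡.trans (U.at (U.const-⊛ c (B.co p i)) j) (U.co-· c (B.co p i) j)))

x*₁ : ∀ a → (0ℚ ∷ 1ℚ ∷ []) *₁ a U.≋ U.X a
x*₁ a = U.≋-trans (U.X-⊛ (1ℚ ∷ []) a) (U.∷-cong ≡.refl (U.⊛-identityˡ a))

co-x* : ∀ p i → B.co (xᴾ *ᴾ p) i U.≋ U.X (B.co p i)
co-x* p i = U.≋-trans (B.at (B.const-⊛ (0ℚ ∷ 1ℚ ∷ []) p) i) (U.≋-trans (B.co-· (0ℚ ∷ 1ℚ ∷ []) p i) (x*₁ (B.co p i)))

q*≈X : ∀ p → qᴾ *ᴾ p P.≈ B.X p
q*≈X p = P.trans (B.X-⊛ ((1ℚ ∷ []) ∷ []) p) (B.∷-cong U.≋-refl (B.⊛-identityˡ p))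

-- The exchange of the variables x and q

λᴾ : P₁ → Poly
λᴾ = map (_∷ [])

-- The automorphism x ↔ q: `λᴾ` rewrites a coefficient as a polynomial in q, and the outer variable
-- becomes x. The nesting makes only the degree in q accessible; the degree in x is that of `τ p` in
-- q.
τ : Poly → Poly
τ [] = []
τ (a ∷ p) = λᴾ a +ᴾ xᴾ *ᴾ τ p

private
  co-λ : ∀ a i → B.co (λᴾ a) i U.≋ U.co a i ∷ []
  co-λ [] i = U.≋-sym U.X-[]
  co-λ (c ∷ a) zero = U.≋-refl
  co-λ (c ∷ a) (suc i) = co-λ a i

entry-τ : ∀ p i j → entry (τ p) i j ≡ entry p j i
entry-τ [] i j = ≡.refl
entry-τ (a ∷ p) i j = ≡.trans (entry-+ (λᴾ a) (xᴾ *ᴾ τ p) i j) (≡.trans (≡.cong₂ ℚ._+_ (U.at (co-λ a i) j) (U.at (co-x* (τ p) i) j)) (lemma j))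
  where
  lemma : ∀ j → U.co (U.co a i ∷ []) j ℚ.+ U.co (U.X (B.co (τ p) i)) j ≡ entry (a ∷ p) j i
  lemma zero = ℚₚ.+-identityʳ _
  lemma (suc j) = ≡.trans (ℚₚ.+-identityˡ _) (entry-τ p i j)

private
  λ-+ : ∀ a b → λᴾ (a +₁ b) P.≈ λᴾ a +ᴾ λᴾ b
  λ-+ a b = B.mk λ i → U.≋-trans (co-λ (a +₁ b) i) (U.≋-trans (U.∷-cong (U.co-⊕ a b i) U.≋-refl)
    (U.≋-sym (U.≋-trans (B.co-⊕ (λᴾ a) (λᴾ b) i) (U.⊕-cong (co-λ a i) (co-λ b i)))))

  λ-· : ∀ c b → λᴾ (c U.· b) P.≈ (c ∷ []) B.· λᴾ b
  λ-· c b = B.mk λ i → U.≋-trans (co-λ (c U.· b) i) (U.≋-trans (U.∷-cong (U.co-· c b i) U.≋-refl)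
    (U.≋-sym (U.≋-trans (B.co-· (c ∷ []) (λᴾ b) i) (U.≋-trans (U.⊛-congˡ (c ∷ []) (co-λ b i)) (U.const-⊛ c _)))))

  λ-* : ∀ a b → λᴾ (a *₁ b) P.≈ λᴾ a *ᴾ λᴾ b
  λ-* [] b = P.refl
  λ-* (c ∷ a) b = P.trans (λ-+ (c U.· b) (U.X (a *₁ b))) (B.⊕-cong (λ-· c b)
    (B.∷-cong U.X-[] (λ-* a b)))

τ-cong : ∀ {p r} → p P.≈ r → τ p P.≈ τ r
τ-cong {p} {r} e = entries⇒≈ λ i j → ≡.trans (entry-τ p i j) (≡.trans (entry-cong e j i) (≡.sym (entry-τ r i j)))

τ-+ : ∀ p r → τ (p +ᴾ r) P.≈ τ p +ᴾ τ r
τ-+ p r = entries⇒≈ λ i j → ≡.trans (entry-τ (p +ᴾ r) i j) (≡.trans (entry-+ p r j i)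
  (≡.sym (≡.trans (entry-+ (τ p) (τ r) i j) (≡.cong₂ ℚ._+_ (entry-τ p i j) (entry-τ r i j)))))

τ-* : ∀ p r → τ (p *ᴾ r) P.≈ τ p *ᴾ τ r
τ-* [] r = P.refl
τ-* (a ∷ p) r = begin
  τ (a B.· r +ᴾ B.X (p *ᴾ r))                   ≈⟨ τ-+ (a B.· r) (B.X (p *ᴾ r)) ⟩
  τ (a B.· r) +ᴾ (xᴾ *ᴾ τ (p *ᴾ r))             ≈⟨ P.+-cong (scalar r) (P.trans (P.*-congˡ {xᴾ} (τ-* p r)) (P.sym (P.*-assoc xᴾ (τ p) (τ r)))) ⟩
  λᴾ a *ᴾ τ r +ᴾ xᴾ *ᴾ τ p *ᴾ τ r               ≈⟨ P.distribʳ (τ r) (λᴾ a) (xᴾ *ᴾ τ p) ⟨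
  (λᴾ a +ᴾ xᴾ *ᴾ τ p) *ᴾ τ r                    ∎
  where
  open import Relation.Binary.Reasoning.Setoid P.setoid
  scalar : ∀ r → τ (a B.· r) P.≈ λᴾ a *ᴾ τ r
  scalar [] = P.sym (P.zeroʳ (λᴾ a))
  scalar (b ∷ r) = begin
    λᴾ (a *₁ b) +ᴾ xᴾ *ᴾ τ (a B.· r)            ≈⟨ P.+-cong (λ-* a b) (P.*-congˡ {xᴾ} (scalar r)) ⟩
    λᴾ a *ᴾ λᴾ b +ᴾ xᴾ *ᴾ (λᴾ a *ᴾ τ r)         ≈⟨ P.+-congˡ {λᴾ a *ᴾ λᴾ b} (P.solve 3 (λ x a t → x P.:* (a P.:* t) P.:= a P.:* (x P.:* t)) P.refl xᴾ (λᴾ a) (τ r)) ⟩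
    λᴾ a *ᴾ λᴾ b +ᴾ λᴾ a *ᴾ (xᴾ *ᴾ τ r)         ≈⟨ P.distribˡ (λᴾ a) (λᴾ b) (xᴾ *ᴾ τ r) ⟨
    λᴾ a *ᴾ (λᴾ b +ᴾ xᴾ *ᴾ τ r)                 ∎

τ-τ : ∀ p → τ (τ p) P.≈ p
τ-τ p = entries⇒≈ λ i j → ≡.trans (entry-τ (τ p) i j) (entry-τ p j i)

-- Lowest terms

-- A ℚ-linear coordinate on R, with linearity in the form a - cb of an elimination step.
record Functional (R : Ring₀) (ν : Hom ℚ-ring R) : Set where
  open RingTheory R
  private module ν = HomTheory {ℚ-ring} {R} ν
  field
    value      : Carrier → ℚ
    value-cong : ∀ {a b} → a ≈ b → value a ≡ value b
    value-zero : value 0# ≡ 0ℚ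
    value-sub  : ∀ a c b → value (a - ν.⟦ c ⟧ * b) ≡ value a ℚ.- c ℚ.* value b

module Elimination (R : Ring₀) (ν : Hom ℚ-ring R)
  (detect : ∀ a → CommutativeRing._≈_ R a (CommutativeRing.0# R) ⊎ ∃ λ (π : Functional R ν) → Functional.value π a ≢ 0ℚ)
  (N D : CommutativeRing.Carrier R) where
  open RingTheory R

  private module ν = HomTheory {ℚ-ring} {R} ν

  V : Set
  V = Carrier × Carrier

  infix 4 _≃_
  _≃_ : V → V → Set
  (a , b) ≃ (c , d) = a ≈ c × b ≈ d

  0ⱽ : V
  0ⱽ = 0# , 0#

  infixl 6 _+ⱽ_ _-[_]_
  _+ⱽ_ : V → V → V
  (a , b) +ⱽ (c , d) = a + c , b + d

  _-[_]_ : V → ℚ → V → V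
  (a , b) -[ c ] (g , h) = a - ν.⟦ c ⟧ * g , b - ν.⟦ c ⟧ * h

  -- It vanishes when a/b represents N/D. Being ℚ-linear in the pair, it turns the search for
  -- representations of bounded degree into finite linear algebra.
  defect : V → Carrier
  defect (a , b) = N * b - a * D

  ≃-sym : ∀ {u v} → u ≃ v → v ≃ u
  ≃-sym (p , r) = sym p , sym r

  ≃-trans : ∀ {u v w} → u ≃ v → v ≃ w → u ≃ w
  ≃-trans (p , r) (s , t) = trans p s , trans r t

  -[]-cong : ∀ {u v g h} c → u ≃ v → g ≃ h → u -[ c ] g ≃ v -[ c ] h
  -[]-cong c (p , r) (s , t) = +-cong p (-‿cong (*-congˡ s)) , +-cong r (-‿cong (*-congˡ t))

  -[0] : ∀ w g → w -[ 0ℚ ] g ≃ w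
  -[0] (a , b) (g , h) = lemma a g , lemma b h
    where
    lemma : ∀ a g → a - ν.⟦ 0ℚ ⟧ * g ≈ a
    lemma a g = trans (+-congˡ (trans (-‿cong (trans (*-congʳ ν.0#-homo) (zeroˡ g))) -0#≈0#)) (+-identityʳ a)

  defect-cong : ∀ {u v} → u ≃ v → defect u ≈ defect v
  defect-cong (p , r) = +-cong (*-congˡ r) (-‿cong (*-congʳ p))

  defect-sub : ∀ w c g → defect (w -[ c ] g) ≈ defect w - ν.⟦ c ⟧ * defect g
  defect-sub (a , b) c (g , h) = solve 7 (λ n d a b c g h →
    n :* (b :- c :* h) :- (a :- c :* g) :* d := n :* b :- a :* d :- c :* (n :* h :- g :* d)) refl N D a b ν.⟦ c ⟧ g h

  Span : List V → V → Set
  Span [] w = w ≃ 0ⱽ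
  Span (g ∷ gs) w = Σ ℚ λ c → Span gs (w -[ c ] g)

  span-resp : ∀ gs {u v} → u ≃ v → Span gs u → Span gs v
  span-resp [] e s = ≃-trans (≃-sym e) s
  span-resp (g ∷ gs) e (c , s) = c , span-resp gs (-[]-cong c e (refl , refl)) s

  span-weaken : ∀ g gs {w} → Span gs w → Span (g ∷ gs) w
  span-weaken g gs {w} s = 0ℚ , span-resp gs (≃-sym (-[0] w g)) s

  span-zero : ∀ gs {w} → w ≃ 0ⱽ → Span gs w
  span-zero [] e = e
  span-zero (g ∷ gs) e = span-weaken g gs (span-zero gs e)

  span-++ : ∀ gs hs {u v} → Span gs u → Span hs v → Span (gs ++ hs) (u +ⱽ v)
  span-++ [] hs (p , r) t = span-resp hs (sym (trans (+-congʳ p) (+-identityˡ _)) , sym (trans (+-congʳ r) (+-identityˡ _))) t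
  span-++ (g ∷ gs) hs {u} {v} (c , s) t = c , span-resp (gs ++ hs) (lemma _ _ _ , lemma _ _ _) (span-++ gs hs s t)
    where
    lemma : ∀ a b g → a - ν.⟦ c ⟧ * g + b ≈ a + b - ν.⟦ c ⟧ * g
    lemma a b g = solve 3 (λ a b g → a :- g :+ b := a :+ b :- g) refl a b (ν.⟦ c ⟧ * g)

  data Pivot (gs : List V) : Set where
    found : ∀ w → Span gs w → defect w ≈ 0# → ¬ (w ≃ 0ⱽ) → Pivot gs
    none  : (∀ w → Span gs w → defect w ≈ 0# → w ≃ 0ⱽ) → Pivot gs

  private
    ν-1 : ∀ a → a - ν.⟦ 1ℚ ⟧ * a ≈ 0#
    ν-1 a = trans (+-congˡ (-‿cong (trans (*-congʳ ν.1#-homo) (*-identityˡ a)))) (-‿inverseʳ a)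

    functional-nonzero : ∀ {a} (π : Functional R ν) → Functional.value π a ≢ 0ℚ → ¬ (a ≈ 0#)
    functional-nonzero π ne e = ne (≡.trans (Functional.value-cong π e) (Functional.value-zero π))

    zero? : ∀ w → w ≃ 0ⱽ ⊎ ¬ (w ≃ 0ⱽ)
    zero? (a , b) with detect a | detect b
    ... | inj₁ p | inj₁ r = inj₁ (p , r)
    ... | inj₂ (π , ne) | _ = inj₂ λ (p , _) → functional-nonzero π ne p
    ... | inj₁ _ | inj₂ (π , ne) = inj₂ λ (_ , r) → functional-nonzero π ne r

    -- `T` is the projection along g onto the vectors whose defect is invisible to π. It kills g and
    -- fixes the kernel of `defect`, so kernel vectors in the span of g and gs lie in the span of
    -- `map T gs`: one generator fewer.
    module Eliminate (g : V) (π : Functional R ν) (r : ℚ) (inverse : Functional.value π (defect g) ℚ.* r ≡ 1ℚ) where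
      open Functional π

      slope : V → ℚ
      slope w = value (defect w) ℚ.* r

      slope-sub : ∀ w c h → slope (w -[ c ] h) ≡ slope w ℚ.- c ℚ.* slope h
      slope-sub w c h = ≡.trans (≡.cong (ℚ._* r) (≡.trans (value-cong (defect-sub w c h)) (value-sub (defect w) c (defect h))))
        (RingTheory.*-distribʳ-sub ℚ-ring (value (defect w)) (value (defect h)) c r)

      T : V → V
      T w = w -[ slope w ] g

      Tg≃0 : T g ≃ 0ⱽ
      Tg≃0 = ≡.subst (λ c → g -[ c ] g ≃ 0ⱽ) (≡.sym inverse) (ν-1 _ , ν-1 _)

      T-kernel : ∀ {w} → defect w ≈ 0# → T w ≃ w
      T-kernel {w} e = ≡.subst (λ c → w -[ c ] g ≃ w) (≡.sym (≡.trans (≡.cong (ℚ._* r) (≡.trans (value-cong e) value-zero)) (ℚₚ.*-zeroˡ r))) (-[0] w g)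

      T-sub : ∀ w c h → T (w -[ c ] h) ≃ T w -[ c ] T h
      T-sub w c h = ≡.subst (λ k → w -[ c ] h -[ k ] g ≃ T w -[ c ] T h) (≡.sym (slope-sub w c h)) (lemma _ _ _ , lemma _ _ _)
        where
        lemma : ∀ a b d → a - ν.⟦ c ⟧ * b - ν.⟦ slope w ℚ.- c ℚ.* slope h ⟧ * d ≈ a - ν.⟦ slope w ⟧ * d - ν.⟦ c ⟧ * (b - ν.⟦ slope h ⟧ * d)
        lemma a b d = trans (+-congˡ (-‿cong (*-congʳ (trans (ν.homo-- (slope w) (c ℚ.* slope h)) (+-congˡ (-‿cong (ν.*-homo c (slope h))))))))
          (solve 6 (λ a b d k s u → a :- k :* b :- (s :- k :* u) :* d := a :- s :* d :- k :* (b :- u :* d)) refl a b d ν.⟦ c ⟧ ν.⟦ slope w ⟧ ν.⟦ slope h ⟧)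

      T-zero : ∀ {w} → w ≃ 0ⱽ → T w ≃ 0ⱽ
      T-zero {w} e = ≃-trans (T-kernel (trans (defect-cong e) (solve 2 (λ n d → n :* con (ℤ.+ 0) :- con (ℤ.+ 0) :* d := con (ℤ.+ 0)) refl N D))) e

      span-T : ∀ gs {w} → Span gs w → Span (map T gs) (T w)
      span-T [] s = T-zero s
      span-T (h ∷ gs) {w} (c , s) = c , span-resp (map T gs) (T-sub w c h) (span-T gs s)

      span-T⁻¹ : ∀ gs {w} → Span (map T gs) w → Span (g ∷ gs) w
      span-T⁻¹ [] {w} s = 0ℚ , ≃-trans (-[0] w g) s
      span-T⁻¹ (h ∷ gs) {w} (c , s) = let (k , s′) = span-T⁻¹ gs s in
        k ℚ.- c ℚ.* slope h , c , span-resp gs (lemma k _ _ _ , lemma k _ _ _) s′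
        where
        lemma : ∀ k a b d → a - ν.⟦ c ⟧ * (b - ν.⟦ slope h ⟧ * d) - ν.⟦ k ⟧ * d ≈ a - ν.⟦ k ℚ.- c ℚ.* slope h ⟧ * d - ν.⟦ c ⟧ * b
        lemma k a b d = sym (trans (+-congʳ (+-congˡ (-‿cong (*-congʳ (trans (ν.homo-- k (c ℚ.* slope h)) (+-congˡ (-‿cong (ν.*-homo c (slope h)))))))))
          (solve 6 (λ a b d k s u → a :- (s :- k :* u) :* d :- k :* b := a :- k :* (b :- u :* d) :- s :* d) refl a b d ν.⟦ c ⟧ ν.⟦ k ⟧ ν.⟦ slope h ⟧))

  -- A generator of defect 0 is itself a solution or is 0 and dropped; any other serves as pivot.
  -- The recursion is on the length because the remaining generators are replaced by their
  -- projections.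
  kernel : ∀ n gs → length gs ≡ n → Pivot gs
  kernel _ [] _ = none λ w s _ → s
  kernel (suc n) (g ∷ gs) e with detect (defect g)
  kernel (suc n) (g ∷ gs) e | inj₁ Kg≈0 with zero? g
  ... | inj₂ g≄0 = found g (1ℚ , span-zero gs (ν-1 _ , ν-1 _)) Kg≈0 g≄0
  ... | inj₁ g≃0 with kernel n gs (ℕₚ.suc-injective e)
  ...   | found w s k ne = found w (span-weaken g gs s) k ne
  ...   | none h = none λ w (c , s) k → h w (span-resp gs (drop c _ (proj₁ g≃0) , drop c _ (proj₂ g≃0)) s) k
    where
    drop : ∀ c a {g} → g ≈ 0# → a - ν.⟦ c ⟧ * g ≈ a
    drop c a p = trans (+-congˡ (trans (-‿cong (trans (*-congˡ p) (zeroʳ _))) -0#≈0#)) (+-identityʳ a)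
  kernel (suc n) (g ∷ gs) e | inj₂ (π , ne) = eliminate (proj₁ (ℚ-inverse _ ne)) (proj₂ (ℚ-inverse _ ne))
    where
    drop : ∀ {c} a → a - ν.⟦ c ⟧ * 0# ≈ a
    drop a = trans (+-congˡ (trans (-‿cong (zeroʳ _)) -0#≈0#)) (+-identityʳ a)
    eliminate : (r : ℚ) → Functional.value π (defect g) ℚ.* r ≡ 1ℚ → Pivot (g ∷ gs)
    eliminate r inverse with kernel n (map (Eliminate.T g π r inverse) gs) (≡.trans (length-map _ gs) (ℕₚ.suc-injective e))
    ... | found w s k nz = found w (Eliminate.span-T⁻¹ g π r inverse gs s) k nz
    ... | none h = none λ w (c , s) k → h w (span-resp (map T gs)
        (≃-trans (T-sub w c g) (≃-trans (-[]-cong c (T-kernel k) Tg≃0) (drop _ , drop _))) (span-T gs s)) k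
      where open Eliminate g π r inverse

  -- Recovers the degree bounds of a solution that elimination delivers only as a combination of
  -- monomials.
  span-closed : (Good : V → Set) → (∀ {w} → w ≃ 0ⱽ → Good w) → (∀ {w} c g → Good g → Good (w -[ c ] g) → Good w) →
    ∀ gs → All Good gs → ∀ {w} → Span gs w → Good w
  span-closed Good z step [] [] s = z s
  span-closed Good z step (g ∷ gs) (p ∷ ps) (c , s) = step c g p (span-closed Good z step gs ps s)

-- Bounded bidegree in ℚ[x,q]

entryFunctional : ℕ → ℕ → Functional P-ring κ
entryFunctional i j = record
  { value = λ p → entry p i j
  ; value-cong = λ e → entry-cong e i j
  ; value-zero = ≡.refl
  ; value-sub = λ a c b → ≡.trans (entry-+ a (-ᴾ (κ.⟦ c ⟧ *ᴾ b)) i j) (≡.cong (entry a i j ℚ.+_)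
      (≡.trans (entry-neg (κ.⟦ c ⟧ *ᴾ b) i j) (≡.cong ℚ.-_ (entry-κ c b i j)))) }

detectEntry : ∀ p → p P.≈ P.0# ⊎ ∃ λ (π : Functional P-ring κ) → Functional.value π p ≢ 0ℚ
detectEntry p = cases (P-decide p)
  where
  cases : Dec (p P.≈ P.0#) → p P.≈ P.0# ⊎ ∃ λ (π : Functional P-ring κ) → Functional.value π p ≢ 0ℚ
  cases (yes e) = inj₁ e
  cases (no ne) = let (i , ne′) = B.nonzero-coefficient P₁-decide p ne
                      (j , ne″) = U.nonzero-coefficient ℚ-decide (B.co p i) ne′
                  in inj₂ (entryFunctional i j , ne″)

InBox : ℕ → ℕ → Poly → Set
InBox X Y p = (∀ i j → Y ℕ.≤ i → entry p i j ≡ 0ℚ) × (∀ i j → X ℕ.≤ j → entry p i j ≡ 0ℚ)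

bounds : ∀ p → ∃ λ X → ∃ λ Y → InBox X Y p
bounds p = width p , length p , height p , width-bound p
  where
  width : Poly → ℕ
  width [] = 0
  width (a ∷ p) = length a ℕ.⊔ width p
  beyond : ∀ (a : P₁) j → length a ℕ.≤ j → U.co a j ≡ 0ℚ
  beyond [] j _ = ≡.refl
  beyond (_ ∷ a) (suc j) h = beyond a j (ℕₚ.≤-pred h)
  height : ∀ p i j → length p ℕ.≤ i → entry p i j ≡ 0ℚ
  height [] i j _ = ≡.refl
  height (_ ∷ p) (suc i) j h = height p i j (ℕₚ.≤-pred h)
  width-bound : ∀ p i j → width p ℕ.≤ j → entry p i j ≡ 0ℚ
  width-bound [] i j _ = ≡.refl
  width-bound (a ∷ p) zero j h = beyond a j (ℕₚ.≤-trans (ℕₚ.m≤m⊔n (length a) (width p)) h)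
  width-bound (a ∷ p) (suc i) j h = width-bound p i j (ℕₚ.≤-trans (ℕₚ.m≤n⊔m (length a) (width p)) h)

box-empty : ∀ {X Y p} → X ≡ 0 ⊎ Y ≡ 0 → InBox X Y p → p P.≈ P.0#
box-empty (inj₁ ≡.refl) (_ , h) = entries⇒≈ λ i j → h i j ℕ.z≤n
box-empty (inj₂ ≡.refl) (h , _) = entries⇒≈ λ i j → h i j ℕ.z≤n

degree-q : ∀ d c A e {B} → d *ᴾ c P.≈ A → (∃ λ i → e ℕ.≤ i × ¬ (B.co d i U.≋ [])) →
  (∀ i j → e ℕ.+ B ℕ.≤ i → entry A i j ≡ 0ℚ) → ∀ i j → B ℕ.≤ i → entry c i j ≡ 0ℚ
degree-q d c A e p ne h i j B≤i = U.at (B.degree-bound P₁-decide P₁-zero-divisor d c ne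
  (λ i le → U.≋-trans (B.at p i) (U.mk λ j → h i j le)) i B≤i) j

degree-x : ∀ d c A e {B} → d *ᴾ c P.≈ A → (∃ λ i → e ℕ.≤ i × ¬ (B.co (τ d) i U.≋ [])) →
  (∀ i j → e ℕ.+ B ℕ.≤ j → entry A i j ≡ 0ℚ) → ∀ i j → B ℕ.≤ j → entry c i j ≡ 0ℚ
degree-x d c A e p ne h i j B≤j = ≡.trans (≡.sym (entry-τ c j i))
  (degree-q (τ d) (τ c) (τ A) e (P.trans (P.sym (τ-* d c)) (τ-cong p)) ne (λ i j le → ≡.trans (entry-τ A i j) (h j i le)) j i B≤j)

module LowestTerms (N D : Poly) (D≉0 : ¬ (D P.≈ P.0#)) where
  open Elimination P-ring κ detectEntry N D

  record Linear (e : Poly → V) : Set where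
    field
      e-cong : ∀ {p r} → p P.≈ r → e p ≃ e r
      e-+    : ∀ p r → e (p +ᴾ r) ≃ e p +ⱽ e r
      e-zero : e P.0# ≃ 0ⱽ
      e-sub  : ∀ p c r → e (p P.- κ.⟦ c ⟧ *ᴾ r) ≃ e p -[ c ] e r
  open Linear

  linear-* : ∀ {e} a → Linear e → Linear (λ p → e (a *ᴾ p))
  linear-* a l = record
    { e-cong = λ {p} {r} h → e-cong l (P.*-congˡ {a} h)
    ; e-+ = λ p r → ≃-trans (e-cong l (P.distribˡ a p r)) (e-+ l _ _)
    ; e-zero = ≃-trans (e-cong l (P.zeroʳ a)) (e-zero l)
    ; e-sub = λ p c r → ≃-trans (e-cong l (P.solve 4 (λ a p c r → a P.:* (p P.:- c P.:* r) P.:= a P.:* p P.:- c P.:* (a P.:* r)) P.refl a p κ.⟦ c ⟧ r)) (e-sub l _ c _) }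

  left right : Poly → V
  left p = p , P.0#
  right p = P.0# , p

  private
    0-sub : ∀ c → P.0# P.≈ P.0# P.- κ.⟦ c ⟧ *ᴾ P.0#
    0-sub c = P.sym (P.trans (P.+-congˡ {P.0#} (P.trans (P.-‿cong (P.zeroʳ κ.⟦ c ⟧)) P.-0#≈0#)) (P.+-identityʳ P.0#))

  linear-left : Linear left
  linear-left = record { e-cong = λ h → h , P.refl ; e-+ = λ p r → P.refl , P.refl ; e-zero = P.refl , P.refl ; e-sub = λ p c r → P.refl , 0-sub c }

  linear-right : Linear right
  linear-right = record { e-cong = λ h → P.refl , h ; e-+ = λ p r → P.refl , P.refl ; e-zero = P.refl , P.refl ; e-sub = λ p c r → 0-sub c , P.refl }

  -- Multiplication by the variable is absorbed into e, so that the span lemmas, stated for all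
  -- linear e, pass through the induction.
  rowMonomials : (Poly → V) → ℕ → List V
  rowMonomials e zero = []
  rowMonomials e (suc X) = e 1ᴾ ∷ rowMonomials (λ p → e (xᴾ *ᴾ p)) X

  monomials : (Poly → V) → ℕ → ℕ → List V
  monomials e X zero = []
  monomials e X (suc Y) = rowMonomials e X ++ monomials (λ p → e (qᴾ *ᴾ p)) X Y

  span-row : ∀ {e} → Linear e → ∀ X a → (∀ j → X ℕ.≤ j → U.co a j ≡ 0ℚ) → Span (rowMonomials e X) (e (a ∷ []))
  span-row l zero a h = ≃-trans (e-cong l (B.∷≋[] (U.mk λ j → h j ℕ.z≤n) B.≋-refl)) (e-zero l)
  span-row {e} l (suc X) [] h = span-zero (rowMonomials e (suc X)) (≃-trans (e-cong l (B.∷≋[] U.≋-refl B.≋-refl)) (e-zero l))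
  span-row {e} l (suc X) (c ∷ a) h = c , span-resp (rowMonomials (λ p → e (xᴾ *ᴾ p)) X) (≃-trans (e-cong l (P.sym split)) (e-sub l ((c ∷ a) ∷ []) c 1ᴾ))
      (span-row (linear-* xᴾ l) X a (λ j le → h (suc j) (ℕ.s≤s le)))
    where
    ca≈ : κ.⟦ c ⟧ +ᴾ xᴾ *ᴾ (a ∷ []) P.≈ (c ∷ a) ∷ []
    ca≈ = P.trans (P.+-congˡ {κ.⟦ c ⟧} (P.trans (B.const-⊛ (0ℚ ∷ 1ℚ ∷ []) (a ∷ [])) (B.∷-cong (x*₁ a) B.≋-refl)))
      (B.∷-cong (U.∷-cong (ℚₚ.+-identityʳ c) U.≋-refl) B.≋-refl)
    split : ((c ∷ a) ∷ []) P.- κ.⟦ c ⟧ *ᴾ 1ᴾ P.≈ xᴾ *ᴾ (a ∷ [])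
    split = P.trans (P.+-congʳ {P.- (κ.⟦ c ⟧ *ᴾ 1ᴾ)} (P.sym ca≈)) (P.solve 2 (λ k r → k P.:+ r P.:- k P.:* P.:1 P.:= r) P.refl κ.⟦ c ⟧ (xᴾ *ᴾ (a ∷ [])))

  span-box : ∀ {e} → Linear e → ∀ X Y p → InBox X Y p → Span (monomials e X Y) (e p)
  span-box l X zero p h = ≃-trans (e-cong l (box-empty (inj₂ ≡.refl) h)) (e-zero l)
  span-box {e} l X (suc Y) [] h = span-zero (monomials e X (suc Y)) (e-zero l)
  span-box {e} l X (suc Y) (a ∷ p) (h , h′) = span-resp (monomials e X (suc Y)) (≃-trans (≃-sym (e-+ l _ _)) (e-cong l split))
    (span-++ (rowMonomials e X) (monomials (λ p → e (qᴾ *ᴾ p)) X Y) (span-row l X a (λ j le → h′ 0 j le)) (span-box (linear-* qᴾ l) X Y p ((λ i j le → h (suc i) j (ℕ.s≤s le)) , λ i j le → h′ (suc i) j le)))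
    where
    split : (a ∷ []) +ᴾ qᴾ *ᴾ p P.≈ a ∷ p
    split = P.trans (P.+-congˡ {a ∷ []} (q*≈X p)) (B.∷-cong (U.⊕-identityʳ a) B.≋-refl)

  module _ (Good : V → Set) where
    good-row : ∀ e X → (∀ p → InBox X 1 p → Good (e p)) → All Good (rowMonomials e X)
    good-row e zero h = []
    good-row e (suc X) h = h 1ᴾ ((λ { (suc i) j _ → ≡.refl }) , λ { zero (suc j) _ → ≡.refl ; (suc i) j _ → ≡.refl })
      ∷ good-row _ X (λ p (b , b′) → h (xᴾ *ᴾ p)
        ( (λ i j le → ≡.trans (U.at (co-x* p i) j) (shift (B.co p i) (λ j → b i j le) j))
        , λ { i (suc j) le → ≡.trans (U.at (co-x* p i) (suc j)) (b′ i j (ℕₚ.≤-pred le)) }))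
      where
      shift : ∀ a → (∀ j → U.co a j ≡ 0ℚ) → ∀ j → U.co (U.X a) j ≡ 0ℚ
      shift a z zero = ≡.refl
      shift a z (suc j) = z j

    good-box : ∀ e X Y → (∀ p → InBox X Y p → Good (e p)) → All Good (monomials e X Y)
    good-box e X zero h = []
    good-box e X (suc Y) h = All.++⁺ (good-row e X (λ p (b , b′) → h p ((λ i j le → b i j (ℕₚ.≤-trans (ℕ.s≤s ℕ.z≤n) le)) , b′)))
      (good-box _ X Y (λ p (b , b′) → h (qᴾ *ᴾ p)
        ( (λ { (suc i) j le → ≡.trans (entry-cong (q*≈X p) (suc i) j) (b i j (ℕₚ.≤-pred le)) })
        , λ { zero j le → entry-cong (q*≈X p) zero j ; (suc i) j le → ≡.trans (entry-cong (q*≈X p) (suc i) j) (b′ i j le) })))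

  private
    width₁ height₁ : ℕ
    width₁ = proj₁ (bounds N)
    height₁ = proj₁ (proj₂ (bounds N))

  -- Only the box of A₂ will shrink. A₁ keeps the box of N, which a cofactor of A₁ cannot leave.
  record Solution (X Y : ℕ) : Set where
    field
      A₁ A₂    : Poly
      box₁     : InBox width₁ height₁ A₁
      box₂     : InBox X Y A₂
      A₂≉0     : ¬ (A₂ P.≈ P.0#)
      equation : N *ᴾ A₂ P.≈ A₁ *ᴾ D

  NoSolution : ℕ → ℕ → Set
  NoSolution X Y = ∀ A₁ A₂ → InBox width₁ height₁ A₁ → InBox X Y A₂ → N *ᴾ A₂ P.≈ A₁ *ᴾ D → A₂ P.≈ P.0#

  private
    zero-box : ∀ {X Y p} → p P.≈ P.0# → InBox X Y p
    zero-box e = (λ i j _ → entry-cong e i j) , (λ i j _ → entry-cong e i j)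

    box-step : ∀ {X Y} p c g → InBox X Y g → InBox X Y (p P.- κ.⟦ c ⟧ *ᴾ g) → InBox X Y p
    box-step p c g (b , b′) (d , d′) = (λ i j le → lemma i j (b i j le) (d i j le)) , (λ i j le → lemma i j (b′ i j le) (d′ i j le))
      where
      lemma : ∀ i j → entry g i j ≡ 0ℚ → entry (p P.- κ.⟦ c ⟧ *ᴾ g) i j ≡ 0ℚ → entry p i j ≡ 0ℚ
      lemma i j e f = ≡.trans (≡.sym (≡.trans (Functional.value-sub (entryFunctional i j) p c g) (≡.trans (≡.cong (λ z → entry p i j ℚ.- c ℚ.* z) e)
        (≡.trans (≡.cong (λ z → entry p i j ℚ.- z) (ℚₚ.*-zeroʳ c)) (ℚₚ.+-identityʳ _))))) f

  solve? : ∀ X Y → Solution X Y ⊎ NoSolution X Y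
  solve? X Y = cases (kernel _ gs ≡.refl)
    where
    gs : List V
    gs = monomials left width₁ height₁ ++ monomials right X Y
    Good : V → Set
    Good (a , b) = InBox width₁ height₁ a × InBox X Y b
    all-good : All Good gs
    all-good = All.++⁺ (good-box Good left width₁ height₁ (λ p b → b , zero-box P.refl)) (good-box Good right X Y (λ p b → zero-box P.refl , b))
    good : ∀ w → Span gs w → Good w
    good w s = span-closed Good (λ (e , f) → zero-box e , zero-box f)
      (λ { {a , a′} c (g , h) (b , b′) (d , d′) → box-step a c g b d , box-step a′ c h b′ d′ }) gs all-good s
    A₁≈0 : ∀ {A₁ A₂} → N *ᴾ A₂ P.≈ A₁ *ᴾ D → A₂ P.≈ P.0# → A₁ P.≈ P.0#
    A₁≈0 {A₁} {A₂} k A₂≈0 = nonzero⇒regular D≉0 A₁ (P.trans (P.*-comm D A₁) (P.trans (P.sym k) (P.trans (P.*-congˡ {N} A₂≈0) (P.zeroʳ N))))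
    cases : Pivot gs → Solution X Y ⊎ NoSolution X Y
    cases (found (A₁ , A₂) s k ne) = inj₁ (record
      { A₁ = A₁ ; A₂ = A₂ ; box₁ = proj₁ (good _ s) ; box₂ = proj₂ (good _ s)
      ; A₂≉0 = λ A₂≈0 → ne (A₁≈0 (P.-≈0⇒≈ k) A₂≈0 , A₂≈0)
      ; equation = P.-≈0⇒≈ k })
    cases (none h) = inj₂ λ A₁ A₂ b b′ e → proj₂ (h (A₁ , A₂)
      (span-resp gs (P.+-identityʳ A₁ , P.+-identityˡ A₂)
        (span-++ (monomials left width₁ height₁) (monomials right X Y) (span-box linear-left width₁ height₁ A₁ b) (span-box linear-right X Y A₂ b′)))
      (P.≈⇒-≈0 e))

  -- Minimality against the two neighbouring boxes: a common divisor involving q would lower Y, one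
  -- involving x would lower X.
  record Minimal : Set where
    field
      X Y      : ℕ
      solution : Solution X Y
      narrow   : ∀ X′ → X ≡ suc X′ → NoSolution X′ Y
      low      : ∀ Y′ → Y ≡ suc Y′ → NoSolution X Y′

  minimal : ∀ X Y → Solution X Y → Minimal
  minimal zero Y s = ⊥-elim (Solution.A₂≉0 s (box-empty (inj₁ ≡.refl) (Solution.box₂ s)))
  minimal (suc X) zero s = ⊥-elim (Solution.A₂≉0 s (box-empty (inj₂ ≡.refl) (Solution.box₂ s)))
  minimal (suc X) (suc Y) s =
    [ minimal X (suc Y)
    , (λ n → [ minimal (suc X) Y
             , (λ n′ → record { X = suc X ; Y = suc Y ; solution = s ; narrow = λ { _ ≡.refl → n } ; low = λ { _ ≡.refl → n′ } })
             ]′ (solve? (suc X) Y))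
    ]′ (solve? X (suc Y))

  initial : ∃ λ X → ∃ λ Y → Solution X Y
  initial = let (X , Y , b) = bounds D in X , Y , record
    { A₁ = N ; A₂ = D ; box₁ = proj₂ (proj₂ (bounds N)) ; box₂ = b ; A₂≉0 = D≉0 ; equation = P.refl }

  -- A nonconstant common divisor could be cancelled, giving a solution in a smaller box.
  module _ (M : Minimal) where
    open Minimal M
    open Solution solution

    minimal-coprime : ∀ d → d P.∣ A₁ → d P.∣ A₂ → P.Unit d
    minimal-coprime d (c₁ , dc₁) (c₂ , dc₂) = cases (B.degree P₁-decide d) (B.degree P₁-decide (τ d))
      where
      c₂≉0 : ¬ (c₂ P.≈ P.0#)
      c₂≉0 e = A₂≉0 (P.trans (P.sym dc₂) (P.trans (P.*-congˡ {d} e) (P.zeroʳ d)))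
      d≉0 : ¬ (d P.≈ P.0#)
      d≉0 e = A₂≉0 (P.trans (P.sym dc₂) (P.trans (P.*-congʳ {c₂} e) (P.zeroˡ c₂)))
      τd≉0 : ¬ (τ d P.≈ P.0#)
      τd≉0 e = d≉0 (P.trans (P.sym (τ-τ d)) (τ-cong e))
      cancelled : N *ᴾ c₂ P.≈ c₁ *ᴾ D
      cancelled = P.regular-cancel {d} (nonzero⇒regular d≉0) (P.trans (P.solve 3 (λ d n c → d P.:* (n P.:* c) P.:= n P.:* (d P.:* c)) P.refl d N c₂)
        (P.trans (P.*-congˡ {N} dc₂) (P.trans equation (P.trans (P.*-congʳ {D} (P.sym dc₁)) (P.*-assoc d c₁ D)))))
      some-q : ∃ λ i → 0 ℕ.≤ i × ¬ (B.co d i U.≋ [])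
      some-q = let (i , ne) = B.nonzero-coefficient P₁-decide d d≉0 in i , ℕ.z≤n , ne
      some-x : ∃ λ i → 0 ℕ.≤ i × ¬ (B.co (τ d) i U.≋ [])
      some-x = let (i , ne) = B.nonzero-coefficient P₁-decide (τ d) τd≉0 in i , ℕ.z≤n , ne
      box-c₁ : InBox width₁ height₁ c₁
      box-c₁ = degree-q d c₁ A₁ 0 dc₁ some-q (proj₁ box₁) , degree-x d c₁ A₁ 0 dc₁ some-x (proj₂ box₁)
      not-low : ∀ k → ¬ (B.co d (suc k) U.≋ []) → ∀ Y′ → Y ≡ Y′ → P.Unit d
      not-low k ne zero e = ⊥-elim (A₂≉0 (box-empty (inj₂ e) box₂))
      not-low k ne (suc Y′) e = ⊥-elim (c₂≉0 (low Y′ e c₁ c₂ box-c₁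
        (degree-q d c₂ A₂ 1 dc₂ (suc k , ℕ.s≤s ℕ.z≤n , ne) (≡.subst (λ Y → ∀ i j → Y ℕ.≤ i → entry A₂ i j ≡ 0ℚ) e (proj₁ box₂))
        , degree-x d c₂ A₂ 0 dc₂ some-x (proj₂ box₂)) cancelled))
      not-narrow : ∀ k → ¬ (B.co (τ d) (suc k) U.≋ []) → ∀ X′ → X ≡ X′ → P.Unit d
      not-narrow k ne zero e = ⊥-elim (A₂≉0 (box-empty (inj₁ e) box₂))
      not-narrow k ne (suc X′) e = ⊥-elim (c₂≉0 (narrow X′ e c₁ c₂ box-c₁
        (degree-q d c₂ A₂ 0 dc₂ some-q (proj₁ box₂)
        , degree-x d c₂ A₂ 1 dc₂ (suc k , ℕ.s≤s ℕ.z≤n , ne) (≡.subst (λ X → ∀ i j → X ℕ.≤ j → entry A₂ i j ≡ 0ℚ) e (proj₂ box₂))) cancelled))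
      cases : d P.≈ P.0# ⊎ ∃ (B.Degree P₁-decide d) → τ d P.≈ P.0# ⊎ ∃ (B.Degree P₁-decide (τ d)) → P.Unit d
      cases (inj₁ e) _ = ⊥-elim (d≉0 e)
      cases _ (inj₁ e) = ⊥-elim (τd≉0 e)
      cases (inj₂ (suc k , ne , _)) _ = not-low k ne Y ≡.refl
      cases _ (inj₂ (suc k , ne , _)) = not-narrow k ne X ≡.refl
      -- Degree 0 in both variables leaves a nonzero rational number.
      cases (inj₂ (zero , _ , z)) (inj₂ (zero , _ , z′)) =
        P.unit-cong (P.sym constant) (κ.homo-unit {entry d 0 0} (ℚ-inverse (entry d 0 0) (λ e → d≉0 (P.trans constant (P.trans (κ.⟦⟧-cong e) κ.0#-homo)))))
        where
        constant : d P.≈ κ.⟦ entry d 0 0 ⟧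
        constant = entries⇒≈ λ
          { zero zero → ≡.refl
          ; zero (suc j) → ≡.trans (≡.sym (entry-τ d (suc j) 0)) (U.at (z′ (suc j) (ℕ.s≤s ℕ.z≤n)) 0)
          ; (suc i) j → U.at (z (suc i) (ℕ.s≤s ℕ.z≤n)) j }

  lowestTerms : ∃ λ A₁ → ∃ λ A₂ → ¬ (A₂ P.≈ P.0#) × N *ᴾ A₂ P.≈ A₁ *ᴾ D × (∀ d → d P.∣ A₁ → d P.∣ A₂ → P.Unit d)
  lowestTerms = A₁ , A₂ , A₂≉0 , equation , minimal-coprime M
    where
    M = let (X , Y , s) = initial in minimal X Y s
    open Solution (Minimal.solution M)

-- Regular elements of ℚ[x,q]

private
  module Q = RingTheory ℚ-ring
  module P₁ = RingTheory U.polynomialRing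
  module c₀ = HomTheory {P-ring} {U.polynomialRing} B.constantTerm
  module c₀₀ = HomTheory {U.polynomialRing} {ℚ-ring} U.constantTerm

x₁ : P₁
x₁ = 0ℚ ∷ 1ℚ ∷ []

sum-nonneg : ∀ k → 0ℚ ℚ.≤ Q.sum k (λ _ → 1ℚ)
sum-nonneg zero = ℚₚ.≤-refl
sum-nonneg (suc k) = ℚₚ.+-mono-≤ {0ℚ} {Q.sum k (λ _ → 1ℚ)} {0ℚ} {1ℚ} (sum-nonneg k) (ℚₚ.nonNegative⁻¹ 1ℚ)

sum-positive : ∀ k → Q.sum (suc k) (λ _ → 1ℚ) ≢ 0ℚ
sum-positive k e = ℚₚ.<⇒≢ (ℚₚ.+-mono-≤-< {0ℚ} {Q.sum k (λ _ → 1ℚ)} {0ℚ} {1ℚ} (sum-nonneg k) (ℚₚ.positive⁻¹ 1ℚ)) (≡.sym e)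

unit-ℕ : ∀ k → P.Unit (P.sum (suc k) (λ _ → P.1#))
unit-ℕ k = P.unit-cong (P.trans (κ.homo-sum (suc k) (λ _ → 1ℚ)) (P.sum-cong (suc k) {λ _ → κ.⟦ 1ℚ ⟧} {λ _ → P.1#} (λ _ _ → κ.1#-homo)))
  (κ.homo-unit {Q.sum (suc k) (λ _ → 1ℚ)} (ℚ-inverse _ (sum-positive k)))

P-nontrivial : ¬ (P.1# P.≈ P.0#)
P-nontrivial e with () ← entry-cong e 0 0

-- `B.co p 0` is p at q = 0; if that is nonzero, so is p, and ℚ[x,q] is a domain.
constantTerm-regular : ∀ p {a} → B.co p 0 U.≋ a → ¬ (a U.≋ []) → P.Regular p
constantTerm-regular p e ne = nonzero⇒regular {p} λ f → ne (U.≋-trans (U.≋-sym e) (B.at f 0))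

co-q^ : ∀ i → B.co (qᴾ P.^ suc i) 0 U.≋ []
co-q^ i = U.≋-trans (c₀.*-homo qᴾ (qᴾ P.^ i)) (P₁.zeroˡ (B.co (qᴾ P.^ i) 0))

co-1-q^ : ∀ i → B.co (P.1# P.- qᴾ P.^ suc i) 0 U.≋ P₁.1#
co-1-q^ i = U.≋-trans (c₀.homo-1- (qᴾ P.^ suc i)) (U.≋-trans (P₁.+-congˡ {P₁.1#} (P₁.-‿cong (co-q^ i))) (P₁.+-identityʳ P₁.1#))

co-1-xq^ : ∀ i → B.co (P.1# P.- xᴾ *ᴾ qᴾ P.^ suc i) 0 U.≋ P₁.1#
co-1-xq^ i = U.≋-trans (c₀.homo-1- (xᴾ *ᴾ qᴾ P.^ suc i)) (U.≋-trans (P₁.+-congˡ {P₁.1#} (P₁.-‿cong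
  (U.≋-trans (c₀.*-homo xᴾ (qᴾ P.^ suc i)) (U.≋-trans (P₁.*-congˡ {x₁} (co-q^ i)) (P₁.zeroʳ x₁))))) (P₁.+-identityʳ P₁.1#))

co-x-q^ : ∀ i → B.co (xᴾ P.- qᴾ P.^ suc i) 0 U.≋ x₁
co-x-q^ i = U.≋-trans (c₀.homo-- xᴾ (qᴾ P.^ suc i)) (U.≋-trans (P₁.+-congˡ {x₁} (P₁.-‿cong (co-q^ i))) (P₁.+-identityʳ x₁))

1₁≉0 : ¬ (P₁.1# U.≋ [])
1₁≉0 e with () ← U.at e 0

x₁≉0 : ¬ (x₁ U.≋ [])
x₁≉0 e with () ← U.at e 1

regular-q : P.Regular qᴾ
regular-q = nonzero⇒regular {qᴾ} λ e → absurd (entry-cong e 1 0)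
  where
  absurd : 1ℚ ≢ 0ℚ
  absurd ()

regular-x : P.Regular xᴾ
regular-x = constantTerm-regular xᴾ U.≋-refl x₁≉0

regular-1-q^ : ∀ i → P.Regular (P.1# P.- qᴾ P.^ suc i)
regular-1-q^ i = constantTerm-regular (P.1# P.- qᴾ P.^ suc i) (co-1-q^ i) 1₁≉0

regular-1+q^ : ∀ i → P.Regular (P.1# P.+ qᴾ P.^ suc i)
regular-1+q^ i = constantTerm-regular (P.1# P.+ qᴾ P.^ suc i) (U.≋-trans (c₀.+-homo P.1# (qᴾ P.^ suc i)) (U.≋-trans (P₁.+-congˡ {P₁.1#} (co-q^ i)) (P₁.+-identityʳ P₁.1#))) 1₁≉0

regular-1-xq^ : ∀ i → P.Regular (P.1# P.- xᴾ *ᴾ qᴾ P.^ suc i)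
regular-1-xq^ i = constantTerm-regular (P.1# P.- xᴾ *ᴾ qᴾ P.^ suc i) (co-1-xq^ i) 1₁≉0

regular-x-q^ : ∀ i → P.Regular (xᴾ P.- qᴾ P.^ suc i)
regular-x-q^ i = constantTerm-regular (xᴾ P.- qᴾ P.^ suc i) (co-x-q^ i) x₁≉0

co-[] : ∀ n → B.co (P.[ suc n ] qᴾ) 0 U.≋ P₁.1#
co-[] zero = U.≋-trans (c₀.+-homo P.0# P.1#) (P₁.+-identityˡ P₁.1#)
co-[] (suc n) = U.≋-trans (c₀.+-homo (P.[ suc n ] qᴾ) (qᴾ P.^ suc n)) (U.≋-trans (P₁.+-cong (co-[] n) (co-q^ n)) (P₁.+-identityʳ P₁.1#))

private
  1-x₁^ : ℕ → P₁
  1-x₁^ j = P₁.1# P₁.- x₁ P₁.^ suc j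

  1-x^ : ∀ j → P.1# P.- xᴾ P.^ suc j P.≈ 1-x₁^ j ∷ []
  1-x^ j = P.trans (P.+-congˡ {P.1#} (P.-‿cong (P.sym (constant.homo-^ x₁ (suc j))))) (P.sym (constant.homo-1- (x₁ P₁.^ suc j)))
    where module constant = HomTheory {U.polynomialRing} {P-ring} B.constant

  1-x^≉0 : ∀ j → ¬ (1-x₁^ j U.≋ [])
  1-x^≉0 j e = absurd (≡.trans (≡.sym (≡.trans (c₀₀.homo-1- (x₁ P₁.^ suc j)) (≡.cong (λ z → 1ℚ ℚ.- z) (≡.trans (c₀₀.*-homo x₁ (x₁ P₁.^ j)) (ℚₚ.*-zeroˡ (U.co (x₁ P₁.^ j) 0)))))) (U.at e 0))
    where
    absurd : 1ℚ ≢ 0ℚ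
    absurd ()

-- r a ≡ 0 mod p gives p c = r a; then r divides c, because r is constant in q and the
-- constant term of p is a unit modulo r, and r can be cancelled.
regular-mod : ∀ p j {v s} → (B.co p 0 *₁ v) U.≋ P₁.1# +₁ (1-x₁^ j *₁ s) →
  RingTheory.Regular (Quotient.quotient P-ring p) (P.1# P.- xᴾ P.^ suc j)
regular-mod p j {v} {s} e a h = ∣⇒≈0 (g , P.regular-cancel {r} regular-r (P.trans cancel (P.*-comm a r)))
  where
  open Quotient P-ring p using (∣⇒≈0; ≈0⇒∣)
  r : Poly
  r = (1-x₁^ j) ∷ []
  regular-r : P.Regular r
  regular-r = constantTerm-regular r U.≋-refl (1-x^≉0 j)
  d : p P.∣ (P.1# P.- xᴾ P.^ suc j) *ᴾ a
  d = ≈0⇒∣ h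
  c : Poly
  c = proj₁ d
  pc≈ra : p *ᴾ c P.≈ r *ᴾ a
  pc≈ra = P.trans (proj₂ d) (P.*-congʳ {a} (1-x^ j))
  quotient-c : ∃ λ g → c P.≈ (1-x₁^ j) B.· g
  quotient-c = B.scalar-divides (1-x₁^ j) p {v} {s} e c a (P.trans pc≈ra (B.const-⊛ (1-x₁^ j) a))
  g : Poly
  g = proj₁ quotient-c
  cancel : r *ᴾ (p *ᴾ g) P.≈ a *ᴾ r
  cancel = P.trans (P.solve 3 (λ r p g → r P.:* (p P.:* g) P.:= p P.:* (r P.:* g)) P.refl r p g)
    (P.trans (P.*-congˡ {p} (P.trans (B.const-⊛ (1-x₁^ j) g) (P.sym (proj₂ quotient-c)))) (P.trans pc≈ra (P.*-comm r a)))

private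
  unit-constant : ∀ p j → B.co p 0 U.≋ P₁.1# → (B.co p 0 *₁ P₁.1#) U.≋ P₁.1# +₁ (1-x₁^ j *₁ [])
  unit-constant p j e = U.≋-trans (P₁.*-identityʳ (B.co p 0)) (U.≋-trans e (U.≋-sym (U.≋-trans (P₁.+-congˡ {P₁.1#} (P₁.zeroʳ (1-x₁^ j))) (P₁.+-identityʳ P₁.1#))))

regular-mod-[] : ∀ n j → RingTheory.Regular (Quotient.quotient P-ring (P.[ suc n ] qᴾ)) (P.1# P.- xᴾ P.^ suc j)
regular-mod-[] n j = regular-mod (P.[ suc n ] qᴾ) j {P₁.1#} {[]} (unit-constant (P.[ suc n ] qᴾ) j (co-[] n))

regular-mod-1-xq^ : ∀ n j → RingTheory.Regular (Quotient.quotient P-ring (P.1# P.- xᴾ *ᴾ qᴾ P.^ suc n)) (P.1# P.- xᴾ P.^ suc j)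
regular-mod-1-xq^ n j = regular-mod (P.1# P.- xᴾ *ᴾ qᴾ P.^ suc n) j {P₁.1#} {[]} (unit-constant (P.1# P.- xᴾ *ᴾ qᴾ P.^ suc n) j (co-1-xq^ n))

regular-mod-x-q^ : ∀ n j → RingTheory.Regular (Quotient.quotient P-ring (xᴾ P.- qᴾ P.^ suc n)) (P.1# P.- xᴾ P.^ suc j)
-- The constant term in q is x, and x · x^j = 1 - (1 - x^(j+1)), so v = x^j and s = -1.
regular-mod-x-q^ n j = regular-mod (xᴾ P.- qᴾ P.^ suc n) j {x₁ P₁.^ j} {P₁.- P₁.1#}
  (U.≋-trans (P₁.*-congʳ {x₁ P₁.^ j} (co-x-q^ n)) (lemma U.polynomialRing (x₁ P₁.^ suc j)))
  where
  lemma : ∀ (R : Ring₀) (let open RingTheory R) y → y ≈ 1# + (1# - y) * - 1#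
  lemma R y = solve 1 (λ y → y := :1 :+ (:1 :- y) :* :- :1) refl y
    where open RingTheory R

-- At q = 0 the equation pc = qa reads x c(0) = 0. Hence q divides c and can be cancelled.
regular-q-mod-x-q^ : ∀ n → RingTheory.Regular (Quotient.quotient P-ring (xᴾ P.- qᴾ P.^ suc n)) qᴾ
regular-q-mod-x-q^ n a h = ∣⇒≈0 (c′ , P.regular-cancel {qᴾ} regular-q (P.trans (P.solve 3 (λ q p c → q P.:* (p P.:* c) P.:= p P.:* (q P.:* c)) P.refl qᴾ p c′)
    (P.trans (P.*-congˡ {p} (P.sym c≈qc′)) (proj₂ d))))
  where
  p : Poly
  p = xᴾ P.- qᴾ P.^ suc n
  open Quotient P-ring p using (∣⇒≈0; ≈0⇒∣)
  d : p P.∣ qᴾ *ᴾ a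
  d = ≈0⇒∣ h
  c : Poly
  c = proj₁ d
  tail : Poly → Poly
  tail [] = []
  tail (_ ∷ p) = p
  tail-X : ∀ c → B.co c 0 U.≋ [] → c P.≈ B.X (tail c)
  tail-X [] _ = B.≋-sym B.X-[]
  tail-X (b ∷ c) e = B.∷-cong e B.≋-refl
  c′ : Poly
  c′ = tail c
  x₁c₀≈0 : (x₁ *₁ B.co c 0) U.≋ []
  x₁c₀≈0 = U.≋-trans (P₁.*-congʳ {B.co c 0} (U.≋-sym (co-x-q^ n))) (U.≋-trans (U.≋-sym (c₀.*-homo p c))
    (U.≋-trans (B.at (proj₂ d) 0) (U.≋-trans (c₀.*-homo qᴾ a) (P₁.zeroˡ (B.co a 0)))))
  c≈qc′ : c P.≈ qᴾ *ᴾ c′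
  c≈qc′ = P.trans (tail-X c ([ (λ e → ⊥-elim (x₁≉0 e)) , (λ e → e) ]′ (P₁-zero-divisor x₁ (B.co c 0) x₁c₀≈0))) (P.sym (q*≈X c′))

-- Values of rational functions

open import Data.Nat using (_≥_; _/_; _%_; _*_)
open import Data.Nat.Divisibility using (_∣_; ∣-refl)

∣⇒∣ᴾ : ∀ d p → d P.∣ p → d ∣ᴾ p
∣⇒∣ᴾ d p (c , e) = c , ≈⇒≈ᴾ e

∣ᴾ⇒∣ : ∀ d p → d ∣ᴾ p → d P.∣ p
∣ᴾ⇒∣ d p (c , e) = c , ≈ᴾ⇒≈ {d *ᴾ c} {p} e

^ᴾ≡^ : ∀ p k → p ^ᴾ k ≡ p P.^ k
^ᴾ≡^ p zero = ≡.refl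
^ᴾ≡^ p (suc k) = ≡.cong (p *ᴾ_) (^ᴾ≡^ p k)

qint≡[] : ∀ k → qint k ≡ P.[ k ] qᴾ
qint≡[] zero = ≡.refl
qint≡[] (suc k) = ≡.cong₂ _+ᴾ_ (qint≡[] k) (^ᴾ≡^ qᴾ k)

modulus≡ : ∀ k → modulus k ≡ P.[ k ] qᴾ *ᴾ (P.1# P.- xᴾ *ᴾ qᴾ P.^ k) *ᴾ (xᴾ P.- qᴾ P.^ k)
modulus≡ k = ≡.cong₂ (λ a b → a *ᴾ (1ᴾ -ᴾ xᴾ *ᴾ b) *ᴾ (xᴾ -ᴾ b)) (qint≡[] k) (^ᴾ≡^ qᴾ k)

open TotalQuotient P-ring using (regular⇒unit; ι-injective; unit⇒regular-ι) renaming (fractions to K; ι to ιʰ)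

module K = RingTheory K
module ι = HomTheory {P-ring} {K} ιʰ
module SK = Summand K ι.⟦ qᴾ ⟧ ι.⟦ xᴾ ⟧
module V = Values {P-ring} {K} ιʰ
module TK = TruncatedPowers K

infix 4 _▷_
-- A `Frac` is a bare pair, possibly with denominator 0. The relation records that it denotes z and
-- that its denominator is regular.
record _▷_ (f : Frac) (z : K.Carrier) : Set where
  constructor mk
  field
    unit-den : K.Unit ι.⟦ den f ⟧
    value    : z K.* ι.⟦ den f ⟧ K.≈ ι.⟦ num f ⟧

▷-cong : ∀ {f z w} → z K.≈ w → f ▷ z → f ▷ w
▷-cong e (mk a v) = mk a (K.trans (K.*-congʳ (K.sym e)) v)

▷-poly : ∀ p → poly p ▷ ι.⟦ p ⟧
▷-poly p = mk (ι.homo-unit P.unit-1) (K.trans (K.*-congˡ ι.1#-homo) (K.*-identityʳ _))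

▷-1 : 1ᶠ ▷ K.1#
▷-1 = ▷-cong ι.1#-homo (▷-poly 1ᴾ)

unit-*ι : ∀ {a b} → K.Unit ι.⟦ a ⟧ → K.Unit ι.⟦ b ⟧ → K.Unit ι.⟦ a *ᴾ b ⟧
unit-*ι {a} {b} u v = K.unit-cong (K.sym (ι.*-homo a b)) (K.unit-* u v)

▷-+ : ∀ {f g z w} → f ▷ z → g ▷ w → f +ᶠ g ▷ z K.+ w
▷-+ (mk a v) (mk b w) = mk (unit-*ι a b) (V.value-+ v w)

▷-- : ∀ {f g z w} → f ▷ z → g ▷ w → f -ᶠ g ▷ z K.- w
▷-- (mk a v) (mk b w) = mk (unit-*ι a b) (V.value-sub v w)

▷-* : ∀ {f g z w} → f ▷ z → g ▷ w → f *ᶠ g ▷ z K.* w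
▷-* (mk a v) (mk b w) = mk (unit-*ι a b) (V.value-* v w)

▷-/ : ∀ {f g z w} → f ▷ z → g ▷ w → (u : K.Unit w) → f /ᶠ g ▷ z K.* proj₁ u
▷-/ (mk a v) (mk b w) u = mk (unit-*ι a (K.unit-cong w (K.unit-* u b))) (V.value-/ (proj₂ u) v w)

▷-^ : ∀ {f z} k → f ▷ z → f ^ᶠ k ▷ z K.^ k
▷-^ zero p = ▷-1
▷-^ (suc k) p = ▷-* p (▷-^ k p)

▷-sum : ∀ k {f g} → (∀ i → f i ▷ g i) → sumᶠ k f ▷ K.sum k g
▷-sum zero p = ▷-cong ι.0#-homo (▷-poly 0ᴾ)
▷-sum (suc k) p = ▷-+ (▷-sum k p) (p k)

▷-prod : ∀ k {f g} → (∀ i → f i ▷ g i) → prodᶠ k f ▷ K.prod k g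
▷-prod zero p = ▷-1
▷-prod (suc k) p = ▷-* (▷-prod k p) (p k)

▷-q : qᶠ ▷ ι.⟦ qᴾ ⟧
▷-q = ▷-poly qᴾ

▷-x : xᶠ ▷ ι.⟦ xᴾ ⟧
▷-x = ▷-poly xᴾ

▷-q⁴ : q⁴ ▷ SK.Q
▷-q⁴ = ▷-^ 4 ▷-q

▷-poch : ∀ {a c} k → a ▷ c → poch a q⁴ k ▷ K.prod k (λ j → K.1# K.- c K.* SK.Q K.^ j)
▷-poch k p = ▷-prod k λ j → ▷-- ▷-1 (▷-* p (▷-^ j ▷-q⁴))

▷-qint : ∀ k → poly (qint k) ▷ K.[ k ] ι.⟦ qᴾ ⟧
▷-qint k = ▷-cong (ι.homo-[] k qᴾ) (≡.subst (λ p → poly p ▷ ι.⟦ P.[ k ] qᴾ ⟧) (≡.sym (qint≡[] k)) (▷-poly (P.[ k ] qᴾ)))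

unit-x : K.Unit ι.⟦ xᴾ ⟧
unit-x = regular⇒unit regular-x

module _ (m : ℕ) (primes : ∀ p → Prime p → p ∣ suc (4 * m) → p % 4 ≡ 1) where

  private
    n : ℕ
    n = suc (4 * m)

    module C = Congruence.Numerator P-ring qᴾ xᴾ m primes unit-ℕ regular-q regular-1-q^ regular-1+q^ regular-1-xq^ regular-x-q^
      (regular-mod-[] (4 * m)) (regular-mod-x-q^ (4 * m)) (regular-mod-1-xq^ (4 * m)) (regular-q-mod-x-q^ (4 * m))

    inverse : ∀ j → SK.den j K.* C.den⁻¹ j K.≈ K.1#
    inverse j = proj₂ (C.unit-denK j)

    module F = SummandForm K ι.⟦ qᴾ ⟧ ι.⟦ xᴾ ⟧ (proj₁ unit-x) (proj₂ unit-x)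

    ▷-quadruple : ∀ {a c} k → a ▷ c → poch a q⁴ k ^ᶠ 2 *ᶠ poch (xᶠ *ᶠ a) q⁴ k *ᶠ poch (a /ᶠ xᶠ) q⁴ k ▷ F.quadruple c k
    ▷-quadruple k p = ▷-* (▷-* (▷-^ 2 (▷-poch k p)) (▷-poch k (▷-* ▷-x p))) (▷-poch k (▷-/ p ▷-x unit-x))

    ▷-α : ∀ k → α k ▷ C.α k
    ▷-α k = ▷-cong (F.α-form C.den⁻¹ inverse k) (▷-* (▷-* (▷-^ (2 * k) ▷-q) (▷-qint (8 * k ℕ.+ 1)))
      (▷-/ (▷-quadruple k ▷-q) (▷-quadruple k ▷-q⁴) (F.unit-quadruple C.den⁻¹ inverse k)))

    ▷-ratio : ratio m ▷ C.ratio
    ▷-ratio = ▷-/ (▷-poch m (▷-^ 2 ▷-q)) (▷-poch m ▷-q⁴) C.unit-bottoms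

    ▷-q^- : ∀ k → q^- k ▷ C.q⁻¹^ k
    ▷-q^- k = ▷-cong (K.*-identityˡ _) (▷-/ ▷-1 (▷-^ k ▷-q) (K.unit-^ k C.unit-qK))

  lhs : Order → Frac
  lhs two   = sumᶠ n s
  lhs three = sumᶠ n t
  lhs four  = sumᶠ n u

  rhs : Order → Frac
  rhs o = poly (qint n) ^ᶠ order o *ᶠ ratio m ^ᶠ order o *ᶠ q^- (order o * m)

  private
    ▷-lhs : ∀ o → lhs o ▷ K.sum n (TK.conv o C.α)
    ▷-lhs two = ▷-sum n λ k → ▷-sum (suc k) λ j → ▷-* (▷-α j) (▷-α (k ∸ j))
    ▷-lhs three = ▷-sum n λ k → ▷-sum (suc k) λ j → ▷-sum (suc (k ∸ j)) λ i → ▷-* (▷-* (▷-α j) (▷-α i)) (▷-α (k ∸ j ∸ i))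
    ▷-lhs four = ▷-sum n λ k → ▷-sum (suc k) λ j → ▷-sum (suc (k ∸ j)) λ i → ▷-sum (suc (k ∸ j ∸ i)) λ h → ▷-* (▷-* (▷-* (▷-α j) (▷-α i)) (▷-α h)) (▷-α (k ∸ j ∸ i ∸ h))

    ▷-rhs : ∀ o → rhs o ▷ C.rhs o
    ▷-rhs o = ▷-* (▷-* (▷-^ (order o) (▷-qint n)) (▷-^ (order o) ▷-ratio)) (▷-q^- (order o * m))

  unit-den⇒≉0 : ∀ {f z} → f ▷ z → ¬ (den f ≈ᴾ 0ᴾ)
  unit-den⇒≉0 {f} p e = P-nontrivial (unit⇒regular-ι (_▷_.unit-den p) P.1# (P.trans (P.*-congʳ {P.1#} {den f} {P.0#} (≈ᴾ⇒≈ {den f} {P.0#} e)) (P.zeroˡ P.1#)))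

  congruence : ∀ o → lhs o ≡ rhs o mod modulus n
  congruence o = unit-den⇒≉0 (▷-lhs o) , unit-den⇒≉0 (▷-rhs o) , A₁ , A₂ ,
    (λ e → A₂≉0 (≈ᴾ⇒≈ {A₂} {P.0#} e)) , ≈⇒≈ᴾ {N *ᴾ A₂} equation , coprime , ∣⇒∣ᴾ (modulus n) A₁ modulus∣A₁ ,
    (λ d d∣modulus d∣A₂ → coprime d (∣⇒∣ᴾ d A₁ (∣-trans {d} {modulus n} (∣ᴾ⇒∣ d (modulus n) d∣modulus) modulus∣A₁)) d∣A₂)
    where
    N D : Poly
    N = num (lhs o -ᶠ rhs o)
    D = den (lhs o -ᶠ rhs o)
    difference : lhs o -ᶠ rhs o ▷ C.difference o
    difference = ▷-- (▷-lhs o) (▷-rhs o)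
    D≉0 : ¬ (D P.≈ P.0#)
    D≉0 e = unit-den⇒≉0 difference (≈⇒≈ᴾ e)
    lowest : ∃ λ A₁ → ∃ λ A₂ → ¬ (A₂ P.≈ P.0#) × N *ᴾ A₂ P.≈ A₁ *ᴾ D × (∀ d → d P.∣ A₁ → d P.∣ A₂ → P.Unit d)
    lowest = LowestTerms.lowestTerms N D D≉0
    A₁ A₂ : Poly
    A₁ = proj₁ lowest
    A₂ = proj₁ (proj₂ lowest)
    A₂≉0 : ¬ (A₂ P.≈ P.0#)
    A₂≉0 = proj₁ (proj₂ (proj₂ lowest))
    equation : N *ᴾ A₂ P.≈ A₁ *ᴾ D
    equation = proj₁ (proj₂ (proj₂ (proj₂ lowest)))
    coprime : Coprime A₁ A₂
    coprime d d∣A₁ d∣A₂ = ∣⇒∣ᴾ d 1ᴾ (proj₂ (proj₂ (proj₂ (proj₂ lowest))) d (∣ᴾ⇒∣ d A₁ d∣A₁) (∣ᴾ⇒∣ d A₂ d∣A₂))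
    ∣-trans : ∀ {a b c} → a P.∣ b → b P.∣ c → a P.∣ c
    ∣-trans {a} (k , e) (l , f) = k *ᴾ l , P.trans (P.sym (P.*-assoc a k l)) (P.trans (P.*-congʳ {l} e) f)
    cleared : C.difference o K.* ι.⟦ A₂ ⟧ K.≈ ι.⟦ A₁ ⟧
    cleared = K.unit-cancel (_▷_.unit-den difference) (begin
      ι.⟦ D ⟧ K.* (C.difference o K.* ι.⟦ A₂ ⟧)      ≈⟨ K.solve 3 (λ d z a → d K.:* (z K.:* a) K.:= z K.:* d K.:* a) K.refl _ _ _ ⟩
      C.difference o K.* ι.⟦ D ⟧ K.* ι.⟦ A₂ ⟧        ≈⟨ K.*-congʳ (_▷_.value difference) ⟩
      ι.⟦ N ⟧ K.* ι.⟦ A₂ ⟧                           ≈⟨ ι.*-homo N A₂ ⟨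
      ι.⟦ N *ᴾ A₂ ⟧                                  ≈⟨ ι.⟦⟧-cong equation ⟩
      ι.⟦ A₁ *ᴾ D ⟧                                  ≈⟨ K.trans (ι.*-homo A₁ D) (K.*-comm _ _) ⟩
      ι.⟦ D ⟧ K.* ι.⟦ A₁ ⟧                           ∎)
      where open import Relation.Binary.Reasoning.Setoid K.setoid
    modulus∣A₁ : modulus n P.∣ A₁
    modulus∣A₁ = ≡.subst (P._∣ A₁) (≡.sym (modulus≡ n)) (C.modulus∣A₁ o A₁ A₂ cleared)

-- The exponents in terms of m, where n = 4m + 1

m*n/m≡n : ∀ m n .{{_ : ℕ.NonZero m}} → (m * n) / m ≡ n
m*n/m≡n m n = ≡.trans (≡.cong (_/ m) (ℕₚ.*-comm m n)) (ℕ.m*n/n≡m n m)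

theorem3 : (n : ℕ) → n ≥ 1 → (∀ p → Prime p → p ∣ n → p % 4 ≡ 1) →
    (sumᶠ n s ≡ poly (qint n) ^ᶠ 2 *ᶠ ratio ((n ∸ 1) / 4) ^ᶠ 2 *ᶠ q^- ((n ∸ 1) / 2) mod modulus n)
    × (sumᶠ n t ≡ poly (qint n) ^ᶠ 3 *ᶠ ratio ((n ∸ 1) / 4) ^ᶠ 3 *ᶠ q^- ((3 * (n ∸ 1)) / 4) mod modulus n)
    × (sumᶠ n u ≡ poly (qint n) ^ᶠ 4 *ᶠ ratio ((n ∸ 1) / 4) ^ᶠ 4 *ᶠ q^- (n ∸ 1) mod modulus n)
theorem3 n n≥1 primes = go (n / 4) n n≡ primes
  where
  n≡ : n ≡ suc (4 * (n / 4))
  -- n is a divisor of itself, so it is 1 modulo 4 like all its divisors.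
  n≡ = ≡.trans (ℕ.m≡m%n+[m/n]*n n 4) (≡.cong₂ ℕ._+_ (divisor%4≡1 primes n {{ℕ.>-nonZero n≥1}} ∣-refl) (ℕₚ.*-comm (n / 4) 4))
  go : ∀ m n → n ≡ suc (4 * m) → (∀ p → Prime p → p ∣ n → p % 4 ≡ 1) →
    (sumᶠ n s ≡ poly (qint n) ^ᶠ 2 *ᶠ ratio ((n ∸ 1) / 4) ^ᶠ 2 *ᶠ q^- ((n ∸ 1) / 2) mod modulus n)
    × (sumᶠ n t ≡ poly (qint n) ^ᶠ 3 *ᶠ ratio ((n ∸ 1) / 4) ^ᶠ 3 *ᶠ q^- ((3 * (n ∸ 1)) / 4) mod modulus n)
    × (sumᶠ n u ≡ poly (qint n) ^ᶠ 4 *ᶠ ratio ((n ∸ 1) / 4) ^ᶠ 4 *ᶠ q^- (n ∸ 1) mod modulus n)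
  go m n ≡.refl primes = shape two m≡ e₂ , shape three m≡ e₃ , shape four m≡ ≡.refl
    where
    m≡ : m ≡ (4 * m) / 4
    m≡ = ≡.sym (m*n/m≡n 4 m)
    e₂ : 2 * m ≡ (4 * m) / 2
    e₂ = ≡.sym (≡.trans (≡.cong (_/ 2) (ℕₚ.*-assoc 2 2 m)) (m*n/m≡n 2 (2 * m)))
    e₃ : 3 * m ≡ (3 * (4 * m)) / 4
    e₃ = ≡.sym (≡.trans (≡.cong (_/ 4) (≡.trans (≡.sym (ℕₚ.*-assoc 3 4 m)) (≡.trans (≡.cong (_* m) (ℕₚ.*-comm 3 4)) (ℕₚ.*-assoc 4 3 m)))) (m*n/m≡n 4 (3 * m)))
    -- The exponents (n-1)/2, 3(n-1)/4 and n-1 are 2m, 3m and 4m, that is m times the order of the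
    -- convolution.
    shape : ∀ o {k e} → m ≡ k → order o * m ≡ e → lhs m primes o ≡ poly (qint n) ^ᶠ order o *ᶠ ratio k ^ᶠ order o *ᶠ q^- e mod modulus n
    shape o ≡.refl ≡.refl = congruence m primes o
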